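{- There is a polynomial $P$ such that the following holds. Let $\mathcal{T}$ be a timed system with data structures $\mathsf{DS}$ whose instructions may also carry atomic propositions from a finite set $\mathsf{AP}$, and let $\Phi\in\mathsf{LCPDL}(\mathsf{AP},\Gamma^{\mathsf{DS}})$ be a specification. One can construct a formula $\Psi\in\mathsf{EQ\text{ - }ICPDL}(\emptyset,\Gamma^{\mathsf{DS}})$, of size at most $P(|\mathcal{T}|+|\Phi|)$ and of intersection width $2$, such that for all linear $(\emptyset,\Gamma^{\mathsf{DS}})$-labeled graphs $G$: $G\models\Psi$ if and only if there exists a feasible $\tau\in L(\mathcal{T})$ such that $G=\pi_\emptyset(G_\tau)$ (up to isomorphism) and $\pi_{\mathsf{AP}}(G_\tau)\not\models\Phi$.
   Context: Labeled graphs. A $(\Sigma,\Gamma)$-labeled graph is $G=(V,E,\lambda)$ with $V$ finite, $\lambda:V\to 2^{\Sigma}$, $E\subseteq V\times\Gamma\times V$; $E_\gamma=\{(u,v):(u,\gamma,v)\in E\}$. $\mathsf{succ}\in\Gamma$. $G$ is linear if $E_{\mathsf{succ}}$ is the successor relation of a total order on $V$. For $\Sigma'\subseteq\Sigma$, $\pi_{\Sigma'}(G)=(V,E,\lambda')$ with $\lambda'(u)=\lambda(u)\cap\Sigma'$. Logic. $\mathsf{ICPDL}(\Sigma,\Gamma)$ has sentences $\Phi$, state formulae $\sigma$, path formulae $\pi$ (for $p\in\Sigma$, $\gamma\in\Gamma$): $\Phi::=\mathsf{E}\,\sigma\mid\neg\Phi\mid\Phi\vee\Phi$; $\sigma::=\top\mid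 p\mid\sigma\vee\sigma\mid\neg\sigma\mid\langle\pi\rangle\sigma\mid\mathsf{loop}(\pi)$; $\pi::=\xrightarrow{\gamma}\mid\mathsf{test}\{\sigma\}\mid\pi+\pi\mid\pi\cdot\pi\mid\pi^*\mid\pi^{ -1}\mid\pi\cap\pi$. $\mathsf{LCPDL}$ is the fragment without $\cap$. State formulae denote subsets of $V$, path formulae binary relations on $V$: $[\![p]\!]=\{v:p\in\lambda(v)\}$, $[\![\top]\!]=V$, Booleans as usual, $[\![\langle\pi\rangle\sigma]\!]=\{u:\exists v\in[\![\sigma]\!],(u,v)\in[\![\pi]\!]\}$, $[\![\mathsf{loop}(\pi)]\!]=\{v:(v,v)\in[\![\pi]\!]\}$, $[\![\xrightarrow{\gamma}]\!]=E_\gamma$, $[\![\mathsf{test}\{\sigma\}]\!]=\{(v,v):v\in[\![\sigma]\!]\}$, and $+,\cdot,{}^*,{}^{ -1},\cap$ are union, composition, reflexive-transitive closure, converse, intersection. $G\models\mathsf{E}\,\sigma$ iff $[\![\sigma]\!]\neq\emptyset$. An $\mathsf{EQ\text{ - }ICPDL}(\Sigma,\Gamma)$ formula is $\exists p_1,\dots,p_n\,\Phi$ with $A=\{p_1,\dots,p_n\}$ disjoint from $\Sigma$ and $\Phi\in\mathsf{ICPDL}(\Sigma\uplus A,\Gamma)$; it holds in $G$ iff some $\lambda':V\to2^{A}$ satisfies $(V,E,\lambda\cup\lambda')\models\Phi$. Intersection width: $\mathsf{iw}(\xrightarrow{\gamma})=\mathsf{iw}(\mathsf{test}\{\sigma\})=1$,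 $\mathsf{iw}(\pi_1+\pi_2)=\mathsf{iw}(\pi_1\cdot\pi_2)=\max(\mathsf{iw}(\pi_1),\mathsf{iw}(\pi_2))$, $\mathsf{iw}(\pi^{ -1})=\mathsf{iw}(\pi^*)=\mathsf{iw}(\pi)$, $\mathsf{iw}(\pi_1\cap\pi_2)=\mathsf{iw}(\pi_1)+\mathsf{iw}(\pi_2)$; the width of a formula is the maximum over its path subformulae. Instructions. $\mathsf{DS}$ is a finite set of data structures, each designated a stack or a queue; $\Sigma^{\mathsf{DS}}=\{r(d),w(d):d\in\mathsf{DS}\}\cup\{\mathrm{nop}\}$ and $\Gamma^{\mathsf{DS}}=\mathsf{DS}\cup\{\mathsf{succ}\}$. A sequence $\sigma$ over $\Sigma^{\mathsf{DS}}$ is valid if for every $d$ each prefix has at most as many $r(d)$ as $w(d)$, and $\sigma$ has equally many of both. For valid $\sigma=\sigma_1\cdots\sigma_n$, $G_\sigma$ has $V=\{1,\dots,n\}$, $\lambda(i)=\{\sigma_i\}$, $\mathsf{succ}$-edges $i\to i+1$, and for each $d$ the $d$-edges matching each write position $w(d)$ to exactly one later read position $r(d)$ (bijectively), LIFO (well-nested) if $d$ is a stack and FIFO if $d$ is a queue. Let $\mathsf{Clocks}$ be a finite set of clocks and $M\ge1$. $\Sigma^{\mathsf{DS}}_{\mathsf{Clocks}}$ consists of $\Sigma^{\mathsf{DS}}$, resets $x:=0$, and constraints $x\bowtie\beta$, $d\bowtie\beta$, $(x-y)\bowtie\beta$, $(d-x)\bowtie\beta$, $(x-d)\bowtie\beta$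 for $x,y\in\mathsf{Clocks}$, $d\in\mathsf{DS}$, ${\bowtie}\in\{\le,<,=,>,\ge\}$, $\beta\in\{0,\dots,M-1\}$. A sequence of instructions is $\tau=\tau_1\cdots\tau_n$ with each $\tau_i\subseteq\mathsf{AP}\cup\Sigma^{\mathsf{DS}}_{\mathsf{Clocks}}$ containing exactly one element of $\Sigma^{\mathsf{DS}}$, and $\tau_1\cap\Sigma^{\mathsf{DS}}_{\mathsf{Clocks}}=\{\mathrm{nop}\}\cup\{x:=0:x\in\mathsf{Clocks}\}$. $\sigma_\tau$ is the induced sequence over $\Sigma^{\mathsf{DS}}$; $\tau$ is valid if $\sigma_\tau$ is; then $G_\tau$ is the $(\mathsf{AP}\cup\Sigma^{\mathsf{DS}}_{\mathsf{Clocks}},\Gamma^{\mathsf{DS}})$-graph $G_{\sigma_\tau}$ with node $i$ relabeled by $\tau_i$. Feasibility. For a position $i$ let $p_x(i)$ be the largest $j<i$ with $(x:=0)\in\tau_j$, and $p_d(i)$ the $j$ with a $d$-edge $j\to i$ in $G_\tau$. A valid $\tau$ is feasible if there is $\mathsf{ts}:\{1,\dots,n\}\to\mathbb{R}_{\ge0}$, monotone ($i\le j\Rightarrow\mathsf{ts}(i)\le\mathsf{ts}(j)$), such that for each position $i$: for each constraint $a\bowtie\beta$ in $\tau_i$ ($a\in\mathsf{Clocks}\cup\mathsf{DS}$), $p_a(i)$ exists and $\mathsf{ts}(i)-\mathsf{ts}(p_a(i))\bowtie\beta$; for each constraint $(a-b)\bowtie\beta$ in $\tau_i$, $p_a(i),p_b(i)$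 exist and $\mathsf{ts}(p_b(i))-\mathsf{ts}(p_a(i))\bowtie\beta$. A timed system $\mathcal{T}$ is a regular language of such sequences, presented by a finite automaton; $L(\mathcal{T})$ is the set of valid sequences in it. $|\mathcal{T}|$ accounts for the automaton, $|\mathsf{AP}|$, $|\mathsf{Clocks}|$, $|\mathsf{DS}|$ and $M$ (constants in unary). -}

module Defs where

open import Data.Bool.Base using (Bool; true; false; T)
open import Data.Empty using (⊥)
open import Data.Fin.Base as Fin using (Fin; toℕ; inject₁)
import Data.Fin.Properties as Fin
open import Data.Integer.Base as ℤ using (+_)
open import Data.List.Base using (List; []; _∷_; length; filterᵇ; take; tabulate)
open import Data.List.Membership.Propositional using (_∈_)
open import Data.Nat.Base as ℕ using (ℕ; zero; suc; _⊔_)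
import Data.Nat.Properties as ℕ
open import Data.Product using (Σ-syntax; ∃; ∃₂; ∃!; _×_; _,_; proj₁; proj₂)
open import Data.Rational.Base as ℚ using (ℚ; 0ℚ)
import Data.Rational.Properties as ℚ
import Data.Rational.Solver as ℚ-Solver
open import Data.Rational.Unnormalised.Base as ℚᵘ using (mkℚᵘ; *≡*)
import Data.Rational.Unnormalised.Properties as ℚᵘ
open import Data.Sum.Base using (_⊎_; inj₁; inj₂; [_,_])
open import Data.Unit.Base using (⊤)
open import Function.Base using (_∘_; flip)
open import Function.Bundles using (_⇔_; _↔_; Inverse)
open import Level using (0ℓ)
open import Relation.Binary.Construct.Closure.ReflexiveTransitive using (Star)
open import Relation.Binary.Construct.Intersection using () renaming (_∩_ to _∩ᴿ_)
open import Relation.Binary.Construct.Union using () renaming (_∪_ to _∪ᴿ_)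
open import Relation.Binary.Core using (Rel)
open import Relation.Binary.PropositionalEquality
  using (_≡_; _≢_; _≗_; refl; sym; trans; cong; cong₂)
open import Relation.Binary.Structures using (IsTotalOrder)
open import Relation.Nullary.Decidable using (does)
open import Relation.Nullary.Negation using (¬_)

-- Bishop's real numbers: regular sequences of rationals, with his orders.

1/1+ 2/1+ : ℕ → ℚ
1/1+ n = + 1 ℚ./ suc n
2/1+ n = + 2 ℚ./ suc n

record ℝ : Set where
  field
    seq     : ℕ → ℚ
    regular : ∀ m n → ℚ.∣ seq m ℚ.- seq n ∣ ℚ.≤ 1/1+ m ℚ.+ 1/1+ n

open ℝ public

infix 4 _≤ᴿ_ _<ᴿ_ _≈ᴿ_
infixl 6 _-ᴿ_

_≤ᴿ_ _<ᴿ_ _≈ᴿ_ : Rel ℝ 0ℓ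
x ≤ᴿ y = ∀ n → seq x n ℚ.- seq y n ℚ.≤ 2/1+ n
x <ᴿ y = ∃ λ n → 2/1+ n ℚ.< seq y n ℚ.- seq x n
x ≈ᴿ y = ∀ n → ℚ.∣ seq x n ℚ.- seq y n ∣ ℚ.≤ 2/1+ n

-- n ↦ 2n+1, so that two errors 1/(2n+2) add up to 1/(n+1).
dbl : ℕ → ℕ
dbl n = n ℕ.+ suc n

1/1+-dbl : ∀ n → 1/1+ (dbl n) ℚ.+ 1/1+ (dbl n) ≡ 1/1+ n
1/1+-dbl n = ℚ.toℚᵘ-injective (begin-equality
  ℚ.toℚᵘ (1/1+ (dbl n) ℚ.+ 1/1+ (dbl n))
    ≃⟨ ℚ.toℚᵘ-homo-+ (1/1+ (dbl n)) (1/1+ (dbl n)) ⟩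
  ℚ.toℚᵘ (1/1+ (dbl n)) ℚᵘ.+ ℚ.toℚᵘ (1/1+ (dbl n))
    ≃⟨ ℚᵘ.+-cong (ℚ.toℚᵘ-fromℚᵘ (mkℚᵘ (+ 1) (dbl n)))
                 (ℚ.toℚᵘ-fromℚᵘ (mkℚᵘ (+ 1) (dbl n))) ⟩
  mkℚᵘ (+ 1) (dbl n) ℚᵘ.+ mkℚᵘ (+ 1) (dbl n)
    ≃⟨ *≡* (cong +_ nat) ⟩
  mkℚᵘ (+ 1) n
    ≃⟨ ℚ.toℚᵘ-fromℚᵘ (mkℚᵘ (+ 1) n) ⟨
  ℚ.toℚᵘ (1/1+ n) ∎)
  where
  open ℚᵘ.≤-Reasoning
  k = suc (dbl n)
  nat : (1 ℕ.* k ℕ.+ 1 ℕ.* k) ℕ.* suc n ≡ 1 ℕ.* (k ℕ.* k)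
  nat = trans (cong₂ (λ a b → (a ℕ.+ b) ℕ.* suc n) (ℕ.*-identityˡ k) (ℕ.*-identityˡ k))
       (trans (ℕ.*-distribʳ-+ (suc n) k k)
       (trans (sym (ℕ.*-distribˡ-+ k (suc n) (suc n)))
              (sym (ℕ.*-identityˡ (k ℕ.* k)))))

_-ᴿ_ : ℝ → ℝ → ℝ
seq (x -ᴿ y) n = seq x (dbl n) ℚ.- seq y (dbl n)
regular (x -ᴿ y) m n = begin
  ℚ.∣ (xm ℚ.- ym) ℚ.- (xn ℚ.- yn) ∣       ≡⟨ cong ℚ.∣_∣ (swap xm ym xn yn) ⟩
  ℚ.∣ (xm ℚ.- xn) ℚ.- (ym ℚ.- yn) ∣       ≤⟨ ℚ.∣p-q∣≤∣p∣+∣q∣ (xm ℚ.- xn) (ym ℚ.- yn) ⟩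
  ℚ.∣ xm ℚ.- xn ∣ ℚ.+ ℚ.∣ ym ℚ.- yn ∣     ≤⟨ ℚ.+-mono-≤ (regular x (dbl m) (dbl n))
                                                        (regular y (dbl m) (dbl n)) ⟩
  (em ℚ.+ en) ℚ.+ (em ℚ.+ en)             ≡⟨ regroup em en ⟩
  (em ℚ.+ em) ℚ.+ (en ℚ.+ en)             ≡⟨ cong₂ ℚ._+_ (1/1+-dbl m) (1/1+-dbl n) ⟩
  1/1+ m ℚ.+ 1/1+ n                       ∎
  where
  open ℚ.≤-Reasoning
  open ℚ-Solver.+-*-Solver
  xm = seq x (dbl m)
  ym = seq y (dbl m)
  xn = seq x (dbl n)
  yn = seq y (dbl n)
  em = 1/1+ (dbl m)
  en = 1/1+ (dbl n)
  swap : ∀ a b c d → (a ℚ.- b) ℚ.- (c ℚ.- d) ≡ (a ℚ.- c) ℚ.- (b ℚ.- d)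
  swap = solve 4 (λ a b c d → (a :- b) :- (c :- d) := (a :- c) :- (b :- d)) refl
  regroup : ∀ a b → (a ℚ.+ b) ℚ.+ (a ℚ.+ b) ≡ (a ℚ.+ a) ℚ.+ (b ℚ.+ b)
  regroup = solve 2 (λ a b → (a :+ b) :+ (a :+ b) := (a :+ a) :+ (b :+ b)) refl

fromℕᴿ : ℕ → ℝ
seq (fromℕᴿ k) _ = + k ℚ./ 1
regular (fromℕᴿ k) m n = begin
  ℚ.∣ q ℚ.- q ∣       ≡⟨ cong ℚ.∣_∣ (ℚ.+-inverseʳ q) ⟩
  0ℚ ℚ.+ 0ℚ           ≤⟨ ℚ.+-mono-≤ (nonNeg m) (nonNeg n) ⟩
  1/1+ m ℚ.+ 1/1+ n   ∎
  where
  open ℚ.≤-Reasoning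
  q = + k ℚ./ 1
  nonNeg : ∀ i → 0ℚ ℚ.≤ 1/1+ i
  nonNeg i = ℚ.nonNegative⁻¹ (1/1+ i) {{ℚ.normalize-nonNeg 1 (suc i)}}

-- A finite vertex set is taken to be some Fin n; E and λ are given by
-- characteristic functions.

record Graph (Σ Γ : Set) : Set where
  field
    order : ℕ
    edge  : Fin order → Γ → Fin order → Bool
    label : Fin order → Σ → Bool

  V : Set
  V = Fin order

  E[_] : Γ → Rel V 0ℓ
  E[ γ ] u v = T (edge u γ v)

open Graph public using (V; E[_]; order; edge; label)

infix 4 _≅_

record _≅_ {Σ Γ : Set} (G H : Graph Σ Γ) : Set where
  field
    vertices : V G ↔ V H
  open Inverse vertices using (to)
  field
    edges  : ∀ u γ v → edge G u γ v ≡ edge H (to u) γ (to v)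
    labels : ∀ u p → label G u p ≡ label H (to u) p

-- π_Σ′(G), with Σ′ presented by an inclusion into Σ.
restrict : {Σ Σ′ Γ : Set} → (Σ′ → Σ) → Graph Σ Γ → Graph Σ′ Γ
restrict ι G = record { order = order G ; edge = edge G ; label = λ v → label G v ∘ ι }

Covers : {A : Set} → Rel A 0ℓ → Rel A 0ℓ
Covers _≤_ u v = u ≤ v × u ≢ v × (∀ w → u ≤ w → w ≤ v → w ≡ u ⊎ w ≡ v)

LinearWrt : {Σ Γ : Set} → Γ → Graph Σ Γ → Set₁
LinearWrt succ G =
  ∃ λ (_≤_ : Rel (V G) 0ℓ) →
    IsTotalOrder _≡_ _≤_ × (∀ u v → E[_] G succ u v ⇔ Covers _≤_ u v)

infixr 5 _∨′_
infixr 6 _⊕_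
infixr 7 _∩_
infixr 8 _·_
infix  9 _✶ _⁻¹
infix  10 ¬′_

mutual
  data State (Σ Γ : Set) : Set where
    ⊤′   : State Σ Γ
    prop : Σ → State Σ Γ
    _∨′_ : State Σ Γ → State Σ Γ → State Σ Γ
    ¬′_  : State Σ Γ → State Σ Γ
    ⟨_⟩_ : Path Σ Γ → State Σ Γ → State Σ Γ
    loop : Path Σ Γ → State Σ Γ

  data Path (Σ Γ : Set) : Set where
    ⟶    : Γ → Path Σ Γ
    test : State Σ Γ → Path Σ Γ
    _⊕_  : Path Σ Γ → Path Σ Γ → Path Σ Γ
    _·_  : Path Σ Γ → Path Σ Γ → Path Σ Γ
    _✶   : Path Σ Γ → Path Σ Γ
    _⁻¹  : Path Σ Γ → Path Σ Γ
    _∩_  : Path Σ Γ → Path Σ Γ → Path Σ Γ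

data ICPDL (Σ Γ : Set) : Set where
  E    : State Σ Γ → ICPDL Σ Γ
  ¬′_  : ICPDL Σ Γ → ICPDL Σ Γ
  _∨′_ : ICPDL Σ Γ → ICPDL Σ Γ → ICPDL Σ Γ

module _ {Σ Γ : Set} (G : Graph Σ Γ) where

  mutual
    ⟦_⟧ˢ : State Σ Γ → V G → Set
    ⟦ ⊤′ ⟧ˢ v      = ⊤
    ⟦ prop p ⟧ˢ v  = T (label G v p)
    ⟦ σ ∨′ τ ⟧ˢ v  = ⟦ σ ⟧ˢ v ⊎ ⟦ τ ⟧ˢ v
    ⟦ ¬′ σ ⟧ˢ v    = ¬ ⟦ σ ⟧ˢ v
    ⟦ ⟨ π ⟩ σ ⟧ˢ u = ∃ λ v → ⟦ σ ⟧ˢ v × ⟦ π ⟧ᵖ u v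
    ⟦ loop π ⟧ˢ v  = ⟦ π ⟧ᵖ v v

    ⟦_⟧ᵖ : Path Σ Γ → Rel (V G) 0ℓ
    ⟦ ⟶ γ ⟧ᵖ     = E[_] G γ
    ⟦ test σ ⟧ᵖ  = λ u v → u ≡ v × ⟦ σ ⟧ˢ v
    ⟦ π ⊕ ρ ⟧ᵖ   = ⟦ π ⟧ᵖ ∪ᴿ ⟦ ρ ⟧ᵖ
    ⟦ π · ρ ⟧ᵖ   = λ u v → ∃ λ x → ⟦ π ⟧ᵖ u x × ⟦ ρ ⟧ᵖ x v
    ⟦ π ✶ ⟧ᵖ     = Star ⟦ π ⟧ᵖ
    ⟦ π ⁻¹ ⟧ᵖ    = flip ⟦ π ⟧ᵖ
    ⟦ π ∩ ρ ⟧ᵖ   = ⟦ π ⟧ᵖ ∩ᴿ ⟦ ρ ⟧ᵖ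

infix 4 _⊨_ _⊨∃_

_⊨_ : {Σ Γ : Set} → Graph Σ Γ → ICPDL Σ Γ → Set
G ⊨ E σ      = ∃ λ v → ⟦_⟧ˢ G σ v
G ⊨ ¬′ Φ     = ¬ (G ⊨ Φ)
G ⊨ (Φ ∨′ Ψ) = (G ⊨ Φ) ⊎ (G ⊨ Ψ)

mutual
  ∩-freeˢ : {Σ Γ : Set} → State Σ Γ → Set
  ∩-freeˢ ⊤′        = ⊤
  ∩-freeˢ (prop _)  = ⊤
  ∩-freeˢ (σ ∨′ τ)  = ∩-freeˢ σ × ∩-freeˢ τ
  ∩-freeˢ (¬′ σ)    = ∩-freeˢ σ
  ∩-freeˢ (⟨ π ⟩ σ) = ∩-freeᵖ π × ∩-freeˢ σ
  ∩-freeˢ (loop π)  = ∩-freeᵖ π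

  ∩-freeᵖ : {Σ Γ : Set} → Path Σ Γ → Set
  ∩-freeᵖ (⟶ _)    = ⊤
  ∩-freeᵖ (test σ) = ∩-freeˢ σ
  ∩-freeᵖ (π ⊕ ρ)  = ∩-freeᵖ π × ∩-freeᵖ ρ
  ∩-freeᵖ (π · ρ)  = ∩-freeᵖ π × ∩-freeᵖ ρ
  ∩-freeᵖ (π ✶)    = ∩-freeᵖ π
  ∩-freeᵖ (π ⁻¹)   = ∩-freeᵖ π
  ∩-freeᵖ (_ ∩ _)  = ⊥

∩-free : {Σ Γ : Set} → ICPDL Σ Γ → Set
∩-free (E σ)    = ∩-freeˢ σ
∩-free (¬′ Φ)   = ∩-free Φ
∩-free (Φ ∨′ Ψ) = ∩-free Φ × ∩-free Ψ

LCPDL : Set → Set → Set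
LCPDL Σ Γ = Σ[ Φ ∈ ICPDL Σ Γ ] ∩-free Φ

-- Number of nodes of the syntax tree.

mutual
  sizeˢ : {Σ Γ : Set} → State Σ Γ → ℕ
  sizeˢ ⊤′        = 1
  sizeˢ (prop _)  = 1
  sizeˢ (σ ∨′ τ)  = 1 ℕ.+ sizeˢ σ ℕ.+ sizeˢ τ
  sizeˢ (¬′ σ)    = 1 ℕ.+ sizeˢ σ
  sizeˢ (⟨ π ⟩ σ) = 1 ℕ.+ sizeᵖ π ℕ.+ sizeˢ σ
  sizeˢ (loop π)  = 1 ℕ.+ sizeᵖ π

  sizeᵖ : {Σ Γ : Set} → Path Σ Γ → ℕ
  sizeᵖ (⟶ _)    = 1
  sizeᵖ (test σ) = 1 ℕ.+ sizeˢ σ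
  sizeᵖ (π ⊕ ρ)  = 1 ℕ.+ sizeᵖ π ℕ.+ sizeᵖ ρ
  sizeᵖ (π · ρ)  = 1 ℕ.+ sizeᵖ π ℕ.+ sizeᵖ ρ
  sizeᵖ (π ✶)    = 1 ℕ.+ sizeᵖ π
  sizeᵖ (π ⁻¹)   = 1 ℕ.+ sizeᵖ π
  sizeᵖ (π ∩ ρ)  = 1 ℕ.+ sizeᵖ π ℕ.+ sizeᵖ ρ

size : {Σ Γ : Set} → ICPDL Σ Γ → ℕ
size (E σ)    = 1 ℕ.+ sizeˢ σ
size (¬′ Φ)   = 1 ℕ.+ size Φ
size (Φ ∨′ Ψ) = 1 ℕ.+ size Φ ℕ.+ size Ψ

iw : {Σ Γ : Set} → Path Σ Γ → ℕ
iw (⟶ _)    = 1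
iw (test _) = 1
iw (π ⊕ ρ)  = iw π ⊔ iw ρ
iw (π · ρ)  = iw π ⊔ iw ρ
iw (π ✶)    = iw π
iw (π ⁻¹)   = iw π
iw (π ∩ ρ)  = iw π ℕ.+ iw ρ

-- Maximum of iw over all path subformulae, including those below a test.

mutual
  widthˢ : {Σ Γ : Set} → State Σ Γ → ℕ
  widthˢ ⊤′        = 0
  widthˢ (prop _)  = 0
  widthˢ (σ ∨′ τ)  = widthˢ σ ⊔ widthˢ τ
  widthˢ (¬′ σ)    = widthˢ σ
  widthˢ (⟨ π ⟩ σ) = widthᵖ π ⊔ widthˢ σ
  widthˢ (loop π)  = widthᵖ π

  widthᵖ : {Σ Γ : Set} → Path Σ Γ → ℕ
  widthᵖ {Σ} (⟶ γ) = iw {Σ} (⟶ γ)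
  widthᵖ (test σ) = iw (test σ) ⊔ widthˢ σ
  widthᵖ (π ⊕ ρ)  = iw (π ⊕ ρ) ⊔ widthᵖ π ⊔ widthᵖ ρ
  widthᵖ (π · ρ)  = iw (π · ρ) ⊔ widthᵖ π ⊔ widthᵖ ρ
  widthᵖ (π ✶)    = iw (π ✶) ⊔ widthᵖ π
  widthᵖ (π ⁻¹)   = iw (π ⁻¹) ⊔ widthᵖ π
  widthᵖ (π ∩ ρ)  = iw (π ∩ ρ) ⊔ widthᵖ π ⊔ widthᵖ ρ

width : {Σ Γ : Set} → ICPDL Σ Γ → ℕ
width (E σ)    = widthˢ σ
width (¬′ Φ)   = width Φ
width (Φ ∨′ Ψ) = width Φ ⊔ width Ψ

-- ∃ p₁ … pₙ. Φ, with n = #vars and A = Fin n disjoint from Σ by construction.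
record EQ-ICPDL (Σ Γ : Set) : Set where
  field
    #vars  : ℕ
    matrix : ICPDL (Σ ⊎ Fin #vars) Γ

open EQ-ICPDL public

expand : {Σ A Γ : Set} (G : Graph Σ Γ) → (V G → A → Bool) → Graph (Σ ⊎ A) Γ
expand G λ′ = record
  { order = order G ; edge = edge G ; label = λ v → [ label G v , λ′ v ] }

_⊨∃_ : {Σ Γ : Set} → Graph Σ Γ → EQ-ICPDL Σ Γ → Set
G ⊨∃ Ψ = Σ[ λ′ ∈ (V G → Fin (#vars Ψ) → Bool) ] expand G λ′ ⊨ matrix Ψ

size∃ : {Σ Γ : Set} → EQ-ICPDL Σ Γ → ℕ
size∃ Ψ = #vars Ψ ℕ.+ size (matrix Ψ)

width∃ : {Σ Γ : Set} → EQ-ICPDL Σ Γ → ℕ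
width∃ Ψ = width (matrix Ψ)

data Kind : Set where
  stack queue : Kind

data Op (DS : Set) : Set where
  nop : Op DS
  r w : DS → Op DS

data Γ^ (DS : Set) : Set where
  succ : Γ^ DS
  data-edge : DS → Γ^ DS

Linear : {Σ DS : Set} → Graph Σ (Γ^ DS) → Set₁
Linear = LinearWrt succ

module _ {#DS : ℕ} where

  private
    DS : Set
    DS = Fin #DS

  isRead isWrite : DS → Op DS → Bool
  isRead d (r d′)  = does (d Fin.≟ d′)
  isRead d _       = false
  isWrite d (w d′) = does (d Fin.≟ d′)
  isWrite d _      = false

  #r #w : DS → List (Op DS) → ℕ
  #r d = length ∘ filterᵇ (isRead d)
  #w d = length ∘ filterᵇ (isWrite d)

  Valid : {n : ℕ} → (Fin n → Op DS) → Set
  Valid σ = ∀ d →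
    (∀ k → #r d (take k (tabulate σ)) ℕ.≤ #w d (take k (tabulate σ))) ×
    #r d (tabulate σ) ≡ #w d (tabulate σ)

  Discipline : {n : ℕ} → Kind → Rel (Fin n) 0ℓ → Set
  Discipline stack _↷_ =
    ∀ {i j i′ j′} → i ↷ j → i′ ↷ j′ → ¬ (i Fin.< i′ × i′ Fin.< j × j Fin.< j′)
  Discipline queue _↷_ =
    ∀ {i j i′ j′} → i ↷ j → i′ ↷ j′ → i Fin.< i′ → j Fin.< j′

  -- The d-edges of G_σ.  A valid σ has exactly one such relation for each d.
  record Matching (kind : DS → Kind) {n : ℕ} (σ : Fin n → Op DS) (d : DS) : Set where
    field
      match : Fin n → Fin n → Bool

    _↷_ : Rel (Fin n) 0ℓ
    i ↷ j = T (match i j)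

    field
      sound      : ∀ {i j} → i ↷ j → σ i ≡ w d × σ j ≡ r d × i Fin.< j
      writes     : ∀ i → σ i ≡ w d → ∃! _≡_ λ j → i ↷ j
      reads      : ∀ j → σ j ≡ r d → ∃! _≡_ λ i → i ↷ j
      discipline : Discipline (kind d) _↷_

record Signature : Set where
  field
    #AP #Clocks #DS : ℕ
    kind            : Fin #DS → Kind
    M               : ℕ
    M≥1             : M ℕ.≥ 1

  AP Clock DS Const : Set
  AP     = Fin #AP
  Clock  = Fin #Clocks
  DS     = Fin #DS
  Const  = Fin M

data Cmp : Set where
  ≤′ <′ =′ >′ ≥′ : Cmp

_⟨_⟩ᴿ_ : ℝ → Cmp → ℝ → Set
x ⟨ ≤′ ⟩ᴿ y = x ≤ᴿ y
x ⟨ <′ ⟩ᴿ y = x <ᴿ y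
x ⟨ =′ ⟩ᴿ y = x ≈ᴿ y
x ⟨ >′ ⟩ᴿ y = y <ᴿ x
x ⟨ ≥′ ⟩ᴿ y = y ≤ᴿ x

module Timed (S : Signature) where
  open Signature S

  data Diff : Set where
    _-ᶜᶜ_ : Clock → Clock → Diff
    _-ᵈᶜ_ : DS → Clock → Diff
    _-ᶜᵈ_ : Clock → DS → Diff

  minuend subtrahend : Diff → Clock ⊎ DS
  minuend (x -ᶜᶜ y)    = inj₁ x
  minuend (d -ᵈᶜ x)    = inj₂ d
  minuend (x -ᶜᵈ d)    = inj₁ x
  subtrahend (x -ᶜᶜ y) = inj₁ y
  subtrahend (d -ᵈᶜ x) = inj₁ x
  subtrahend (x -ᶜᵈ d) = inj₂ d

  data Instr : Set where
    op         : Op DS → Instr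
    reset      : Clock → Instr
    constraint : Clock ⊎ DS → Cmp → Const → Instr
    diff       : Diff → Cmp → Const → Instr

  Letter : Set
  Letter = AP ⊎ Instr → Bool

  infix 4 _∈ᴸ_
  _∈ᴸ_ : AP ⊎ Instr → Letter → Set
  a ∈ᴸ ℓ = T (ℓ a)

  Word : ℕ → Set
  Word n = Fin n → Letter

  record IsInstrSeq {n : ℕ} (τ : Word n) : Set where
    field
      nonempty : n ℕ.≥ 1
      oneOp    : ∀ i → ∃! _≡_ λ o → inj₂ (op o) ∈ᴸ τ i
      first    : ∀ i → toℕ i ≡ 0 → ∀ a →
                 inj₂ a ∈ᴸ τ i ⇔ (a ≡ op nop ⊎ ∃ λ x → a ≡ reset x)

    σ : Fin n → Op DS
    σ i = proj₁ (oneOp i)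

  -- A valid sequence of instructions together with the d-edges of its graph,
  -- which are determined by the sequence.
  record ValidSeq {n : ℕ} (τ : Word n) : Set where
    field
      isInstrSeq : IsInstrSeq τ
    open IsInstrSeq isInstrSeq public
    field
      valid    : Valid σ
      matching : ∀ d → Matching kind σ d

  module _ {n : ℕ} {τ : Word n} (v : ValidSeq τ) where
    open ValidSeq v

    graph : Graph (AP ⊎ Instr) (Γ^ DS)
    graph = record { order = n ; edge = e ; label = τ }
      where
      e : Fin n → Γ^ DS → Fin n → Bool
      e i succ          j = does (toℕ j ℕ.≟ suc (toℕ i))
      e i (data-edge d) j = Matching.match (matching d) i j

    -- Prev a i j means that p_a(i) exists and equals j.
    Prev : Clock ⊎ DS → Fin n → Fin n → Set
    Prev (inj₁ x) i j =
      j Fin.< i × inj₂ (reset x) ∈ᴸ τ j ×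
      (∀ k → k Fin.< i → inj₂ (reset x) ∈ᴸ τ k → k Fin.≤ j)
    Prev (inj₂ d) i j = E[_] graph (data-edge d) j i

    record Feasible : Set where
      field
        ts          : Fin n → ℝ
        nonNegative : ∀ i → fromℕᴿ 0 ≤ᴿ ts i
        monotone    : ∀ i j → i Fin.≤ j → ts i ≤ᴿ ts j
        constraints : ∀ i a ⋈ β → inj₂ (constraint a ⋈ β) ∈ᴸ τ i →
                      ∃ λ j → Prev a i j × (ts i -ᴿ ts j) ⟨ ⋈ ⟩ᴿ fromℕᴿ (toℕ β)
        diffs       : ∀ i δ ⋈ β → inj₂ (diff δ ⋈ β) ∈ᴸ τ i →
                      ∃₂ λ j k → Prev (minuend δ) i j × Prev (subtrahend δ) i k ×
                                 (ts k -ᴿ ts j) ⟨ ⋈ ⟩ᴿ fromℕᴿ (toℕ β)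

  record Automaton : Set where
    field
      #states : ℕ
      initial : Fin #states → Bool
      final   : Fin #states → Bool
      δ       : List (Fin #states × Letter × Fin #states)

    -- Transition letters are compared extensionally with those of the word.
    Accepts : {n : ℕ} → Word n → Set
    Accepts {n} τ =
      Σ[ ρ ∈ (Fin (suc n) → Fin #states) ]
        T (initial (ρ Fin.zero)) × T (final (ρ (Fin.fromℕ n))) ×
        (∀ i → ∃ λ a → (ρ (inject₁ i) , a , ρ (Fin.suc i)) ∈ δ × a ≗ τ i)

record TimedSystem : Set where
  field
    sig       : Signature
  open Signature sig public
  open Timed sig public
  field
    automaton : Automaton
  open Automaton automaton public
  field
    wellFormed : ∀ {n} (τ : Word n) → Accepts τ → IsInstrSeq τ

  -- Each letter is a subset of a set of size polynomial in the other
  -- parameters, so a transition counts for 1; M counts in full (unary).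
  size-𝒯 : ℕ
  size-𝒯 = #states ℕ.+ length δ ℕ.+ #AP ℕ.+ #Clocks ℕ.+ #DS ℕ.+ M

  -- L(𝒯), with each valid sequence carrying the data needed to form its graph.
  record L : Set where
    field
      len      : ℕ
      word     : Word len
      accepted : Accepts word
      validSeq : ValidSeq word

    G : Graph (AP ⊎ Instr) (Γ^ DS)
    G = graph validSeq

-- Coefficients, constant term first.  Natural coefficients suffice for
-- upper bounds.
Polynomial : Set
Polynomial = List ℕ

eval : Polynomial → ℕ → ℕ
eval []      n = 0
eval (c ∷ P) n = c ℕ.+ n ℕ.* eval P n

{-# OPTIONS --safe #-}
module Submission where

-- The formula guesses, at every node, the transition of the automaton taken there
-- and the integer part of its timestamp: the residue modulo M, together with the
-- increment (0, 1, or at least 2) of the quotient.  This suffices to tell whether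
-- two integer parts differ by less than, exactly, or more than a constant β < M.
-- Unless the difference is exactly β, a constraint is decided by the integer parts;
-- if it is, the constraint compares two fractional parts, which is the intersection
-- of two ∩-free paths.  Fractional parts fulfilling all these comparisons exist iff
-- no cycle of comparisons contains a strict one, and that is a loop formula.
--
-- Conversely a feasible sequence only has integer parts up to double negation, as
-- its timestamps are constructive reals.  But there are finitely many labellings of
-- a finite graph and truth of a formula in it is decidable, so one can be found.

-- Integer parts are unbounded, while a labelling offers only finitely many choices per node. What
-- saves the encoding is that every constant is below M: once two quotients differ by 2 or more, the
-- integer parts differ by more than M, and each comparison with a constant has a fixed answer.
-- Hence a path need only count quotient increments up to 2, and it can do so without ∩.
-- Intersection is spent where two routes must share both ends: the one through the node imposing a
-- constraint and the one counting increments. A violation visible in the integer parts closes into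
-- a cycle, so `loop` detects it. A comparison of fractional parts has to be a genuine relation
-- between its two ends, because it is iterated by `✶`; this is what forces the ∩ there. In the
-- soundness direction the fractional parts are k/(n+1), where n is the number of nodes and k counts
-- the nodes from which a chain with a strict comparison arrives.

open import Defs
open import Data.Bool.Base using (Bool; true; false; T; not; if_then_else_)
open import Data.Empty using (⊥; ⊥-elim)
open import Data.Fin.Base as Fin using (Fin; zero; suc; toℕ; inject₁)
import Data.Fin.Properties as Fin
open import Data.List.Base
  using (List; []; _∷_; length; map; _++_; allFin; tabulate; take; filterᵇ; lookup; cartesianProductWith)
open import Data.List.Membership.Propositional using (_∈_)
open import Data.List.Membership.Propositional.Properties
  using (∈-allFin; ∈-lookup; ∈-map⁺; ∈-++⁺ˡ; ∈-++⁺ʳ; ∈-cartesianProductWith⁺)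
open import Data.List.Properties using (length-map; length-++; length-tabulate)
open import Data.List.Relation.Unary.Any as Any using (here; there)
open import Data.List.Relation.Unary.Any.Properties using (lookup-index)
open import Data.Nat.Base using (ℕ; NonZero; >-nonZero; zero; suc; _+_; _*_; _≤_; _<_; _⊔_; z≤n; s≤s)
open import Data.Nat.DivMod using (_/_; _%_; _mod_; m≡m%n+[m/n]*n; /-monoˡ-≤)
import Data.Nat.Properties as ℕ
open import Data.Nat.Tactic.RingSolver using (solve-∀)
open import Data.Product using (Σ-syntax; ∃; ∃₂; _×_; _,_; proj₁; proj₂)
open import Data.Sum.Base as Sum using (_⊎_; inj₁; inj₂; [_,_])
open import Data.Unit.Base using (⊤; tt)
open import Function.Base using (_∘_; id)
open import Function.Bundles using (_⇔_; Inverse; Equivalence; mk⇔; mk↔ₛ′)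
open import Level using (0ℓ)
open import Relation.Binary.Construct.Closure.ReflexiveTransitive using (Star; ε; _◅_; _◅◅_)
open import Relation.Binary.Core using (Rel)
open import Relation.Binary.Definitions using (tri<; tri≈; tri>)
open import Relation.Binary.PropositionalEquality
  using (_≡_; _≢_; _≗_; refl; sym; trans; cong; cong₂; subst; subst₂; module ≡-Reasoning)
open import Relation.Binary.Structures using (IsTotalOrder)
open import Relation.Nullary.Decidable
  using (Dec; yes; no; does; map′; _×-dec_; _⊎-dec_; ¬?; T?; decidable-stable)
open import Relation.Nullary.Negation using (¬_; contradiction)
import Data.Integer.Base as ℤ
import Data.Integer.Properties as ℤ
import Data.Integer.Tactic.RingSolver as ℤ-RingSolver
open import Data.Rational.Base as ℚ using (ℚ; 0ℚ; 1ℚ)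
import Data.Rational.Properties as ℚ
import Data.Rational.Solver as ℚ-Solver
open import Data.Rational.Unnormalised.Base as ℚᵘ using (mkℚᵘ; *≡*; *≤*; *<*)
import Data.Rational.Unnormalised.Properties as ℚᵘ

-- Sizes and widths of formulas

-- Bounds are syntax, so that one expression serves every timed system and can be turned into a
-- `Polynomial`. Most of these expressions are left to unification, which reads them off the shape
-- of the size proofs.
data Bound : Set where
  con     : ℕ → Bound
  var     : Bound
  _⊞_ _⊠_ : Bound → Bound → Bound

infixl 6 _⊞_
infixl 7 _⊠_

⟪_⟫ : Bound → ℕ → ℕ
⟪ con k ⟫ n = k
⟪ var ⟫ n   = n
⟪ e ⊞ f ⟫ n = ⟪ e ⟫ n + ⟪ f ⟫ n
⟪ e ⊠ f ⟫ n = ⟪ e ⟫ n * ⟪ f ⟫ n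

add : Polynomial → Polynomial → Polynomial
add []      Q       = Q
add (c ∷ P) []      = c ∷ P
add (c ∷ P) (d ∷ Q) = (c + d) ∷ add P Q

mul : Polynomial → Polynomial → Polynomial
mul []      Q = []
mul (c ∷ P) Q = add (map (c *_) Q) (0 ∷ mul P Q)

eval-add : ∀ P Q n → eval (add P Q) n ≡ eval P n + eval Q n
eval-add []      Q       n = refl
eval-add (c ∷ P) []      n = sym (ℕ.+-identityʳ _)
eval-add (c ∷ P) (d ∷ Q) n =
  trans (cong (λ z → c + d + n * z) (eval-add P Q n)) (regroup c d n (eval P n) (eval Q n))
  where
  regroup : ∀ c d n a b → c + d + n * (a + b) ≡ (c + n * a) + (d + n * b)
  regroup = solve-∀

eval-scale : ∀ c P n → eval (map (c *_) P) n ≡ c * eval P n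
eval-scale c []      n = sym (ℕ.*-zeroʳ c)
eval-scale c (d ∷ P) n = trans (cong (λ z → c * d + n * z) (eval-scale c P n)) (regroup c d n (eval P n))
  where
  regroup : ∀ c d n a → c * d + n * (c * a) ≡ c * (d + n * a)
  regroup = solve-∀

eval-mul : ∀ P Q n → eval (mul P Q) n ≡ eval P n * eval Q n
eval-mul []      Q n = refl
eval-mul (c ∷ P) Q n = begin
  eval (add (map (c *_) Q) (0 ∷ mul P Q)) n      ≡⟨ eval-add (map (c *_) Q) (0 ∷ mul P Q) n ⟩
  eval (map (c *_) Q) n + n * eval (mul P Q) n   ≡⟨ cong₂ (λ a b → a + n * b) (eval-scale c Q n) (eval-mul P Q n) ⟩
  c * eval Q n + n * (eval P n * eval Q n)       ≡⟨ regroup c n (eval P n) (eval Q n) ⟩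
  (c + n * eval P n) * eval Q n                  ∎
  where
  open ≡-Reasoning
  regroup : ∀ c n a b → c * b + n * (a * b) ≡ (c + n * a) * b
  regroup = solve-∀

polynomial : Bound → Polynomial
polynomial (con k) = k ∷ []
polynomial var       = 0 ∷ 1 ∷ []
polynomial (e ⊞ f) = add (polynomial e) (polynomial f)
polynomial (e ⊠ f) = mul (polynomial e) (polynomial f)

eval-polynomial : ∀ e n → eval (polynomial e) n ≡ ⟪ e ⟫ n
eval-polynomial (con k) n = trans (cong (k +_) (ℕ.*-zeroʳ n)) (ℕ.+-identityʳ k)
eval-polynomial var       n = trans (cong (λ z → n * (1 + z)) (ℕ.*-zeroʳ n)) (ℕ.*-identityʳ n)
eval-polynomial (e ⊞ f) n = trans (eval-add (polynomial e) (polynomial f) n)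
                                  (cong₂ _+_ (eval-polynomial e n) (eval-polynomial f n))
eval-polynomial (e ⊠ f) n = trans (eval-mul (polynomial e) (polynomial f) n)
                                  (cong₂ _*_ (eval-polynomial e n) (eval-polynomial f n))

record Enum (A : Set) : Set where
  no-eta-equality
  field
    elems    : List A
    complete : ∀ x → x ∈ elems

open Enum public

enum-Fin : ∀ n → Enum (Fin n)
elems (enum-Fin n) = allFin n
complete (enum-Fin n) = ∈-allFin

enum-map : {A B : Set} (f : A → B) (g : B → A) → (∀ b → f (g b) ≡ b) → Enum A → Enum B
elems (enum-map f g fg as) = map f (elems as)
complete (enum-map f g fg as) = λ b → subst (_∈ map f (elems as)) (fg b) (∈-map⁺ f (complete as (g b)))

infixr 4 _×ᵉ_
_×ᵉ_ : {A B : Set} → Enum A → Enum B → Enum (A × B)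
elems (as ×ᵉ bs) = cartesianProductWith _,_ (elems as) (elems bs)
complete (as ×ᵉ bs) = λ (a , b) → ∈-cartesianProductWith⁺ _,_ (complete as a) (complete bs b)

enum-⊎ : {A B : Set} → Enum A → Enum B → Enum (A ⊎ B)
elems (enum-⊎ as bs) = map inj₁ (elems as) ++ map inj₂ (elems bs)
complete (enum-⊎ as bs) = λ
    { (inj₁ a) → ∈-++⁺ˡ (∈-map⁺ inj₁ (complete as a))
    ; (inj₂ b) → ∈-++⁺ʳ _ (∈-map⁺ inj₂ (complete bs b)) }

module _ {Σ Γ : Set} where

  infixr 6 _∧′_
  -- Testing `σ` on the spot leaves the node unchanged. A proof lists the second conjunct before the
  -- first, which explains patterns such as `(_ , q , refl , p)` later on.
  _∧′_ : State Σ Γ → State Σ Γ → State Σ Γ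
  σ ∧′ τ = ⟨ test σ ⟩ τ

  ⊥′ : State Σ Γ
  ⊥′ = ¬′ ⊤′

  when : Bool → State Σ Γ → State Σ Γ
  when b σ = if b then σ else ⊥′

  whenᵖ : Bool → Path Σ Γ → Path Σ Γ
  whenᵖ b π = if b then π else test ⊥′

  anyOf : {A : Set} → List A → (A → State Σ Γ) → State Σ Γ
  anyOf []       f = ⊥′
  anyOf (x ∷ xs) f = f x ∨′ anyOf xs f

  anyOfᵖ : {A : Set} → List A → (A → Path Σ Γ) → Path Σ Γ
  anyOfᵖ []       f = test ⊥′
  anyOfᵖ (x ∷ xs) f = f x ⊕ anyOfᵖ xs f

  ⋁ : {A : Set} → Enum A → (A → State Σ Γ) → State Σ Γ
  ⋁ as = anyOf (elems as)

  ⨁ : {A : Set} → Enum A → (A → Path Σ Γ) → Path Σ Γ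
  ⨁ as = anyOfᵖ (elems as)

module _ {Σ Γ : Set} (G : Graph Σ Γ) where

  ∧⁺ : ∀ {σ τ v} → ⟦_⟧ˢ G σ v → ⟦_⟧ˢ G τ v → ⟦_⟧ˢ G (σ ∧′ τ) v
  ∧⁺ p q = _ , q , refl , p

  when⁺ : ∀ {b σ v} → T b → ⟦_⟧ˢ G σ v → ⟦_⟧ˢ G (when b σ) v
  when⁺ {true} _ p = p

  when⁻ : ∀ {b σ v} → ⟦_⟧ˢ G (when b σ) v → T b × ⟦_⟧ˢ G σ v
  when⁻ {true}  p = tt , p
  when⁻ {false} p = contradiction tt p

  whenᵖ⁺ : ∀ {b π u v} → T b → ⟦_⟧ᵖ G π u v → ⟦_⟧ᵖ G (whenᵖ b π) u v
  whenᵖ⁺ {true} _ p = p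

  whenᵖ⁻ : ∀ {b π u v} → ⟦_⟧ᵖ G (whenᵖ b π) u v → T b × ⟦_⟧ᵖ G π u v
  whenᵖ⁻ {true}  p       = tt , p
  whenᵖ⁻ {false} (_ , p) = contradiction tt p

  anyOf⁺ : ∀ {A : Set} {xs : List A} {f x v} → x ∈ xs → ⟦_⟧ˢ G (f x) v → ⟦_⟧ˢ G (anyOf xs f) v
  anyOf⁺ (here refl) p = inj₁ p
  anyOf⁺ (there x∈)  p = inj₂ (anyOf⁺ x∈ p)

  anyOf⁻ : ∀ {A : Set} (xs : List A) {f v} → ⟦_⟧ˢ G (anyOf xs f) v → ∃ λ x → ⟦_⟧ˢ G (f x) v
  anyOf⁻ []       p        = contradiction tt p
  anyOf⁻ (x ∷ xs) (inj₁ p) = x , p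
  anyOf⁻ (x ∷ xs) (inj₂ p) = anyOf⁻ xs p

  anyOfᵖ⁺ : ∀ {A : Set} {xs : List A} {f x u v} → x ∈ xs → ⟦_⟧ᵖ G (f x) u v → ⟦_⟧ᵖ G (anyOfᵖ xs f) u v
  anyOfᵖ⁺ (here refl) p = inj₁ p
  anyOfᵖ⁺ (there x∈)  p = inj₂ (anyOfᵖ⁺ x∈ p)

  anyOfᵖ⁻ : ∀ {A : Set} (xs : List A) {f u v} → ⟦_⟧ᵖ G (anyOfᵖ xs f) u v → ∃ λ x → ⟦_⟧ᵖ G (f x) u v
  anyOfᵖ⁻ []       (_ , p)  = contradiction tt p
  anyOfᵖ⁻ (x ∷ xs) (inj₁ p) = x , p
  anyOfᵖ⁻ (x ∷ xs) (inj₂ p) = anyOfᵖ⁻ xs p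

  module _ {A : Set} (as : Enum A) where

    ⋁⁺ : ∀ {f v} x → ⟦_⟧ˢ G (f x) v → ⟦_⟧ˢ G (⋁ as f) v
    ⋁⁺ x = anyOf⁺ (complete as x)

    ⋁⁻ : ∀ {f v} → ⟦_⟧ˢ G (⋁ as f) v → ∃ λ x → ⟦_⟧ˢ G (f x) v
    ⋁⁻ = anyOf⁻ (elems as)

    ⨁⁺ : ∀ {f u v} x → ⟦_⟧ᵖ G (f x) u v → ⟦_⟧ᵖ G (⨁ as f) u v
    ⨁⁺ x = anyOfᵖ⁺ (complete as x)

    ⨁⁻ : ∀ {f u v} → ⟦_⟧ᵖ G (⨁ as f) u v → ∃ λ x → ⟦_⟧ᵖ G (f x) u v
    ⨁⁻ = anyOfᵖ⁻ (elems as)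

iw≤widthᵖ : ∀ {Σ Γ} (π : Path Σ Γ) → iw π ≤ widthᵖ π
iw≤widthᵖ (⟶ γ)    = ℕ.≤-refl
iw≤widthᵖ (test σ) = ℕ.m≤m⊔n 1 (widthˢ σ)
iw≤widthᵖ (π ⊕ ρ)  = ℕ.≤-trans (ℕ.m≤m⊔n _ (widthᵖ π)) (ℕ.m≤m⊔n _ (widthᵖ ρ))
iw≤widthᵖ (π · ρ)  = ℕ.≤-trans (ℕ.m≤m⊔n _ (widthᵖ π)) (ℕ.m≤m⊔n _ (widthᵖ ρ))
iw≤widthᵖ (π ✶)    = ℕ.m≤m⊔n _ (widthᵖ π)
iw≤widthᵖ (π ⁻¹)   = ℕ.m≤m⊔n _ (widthᵖ π)
iw≤widthᵖ (π ∩ ρ)  = ℕ.≤-trans (ℕ.m≤m⊔n _ (widthᵖ π)) (ℕ.m≤m⊔n _ (widthᵖ ρ))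

record Few {A : Set} (N : ℕ) (as : Enum A) (e : Bound) : Set where
  constructor few
  field
    length≤ : length (elems as) ≤ ⟪ e ⟫ N

record Smallˢ {Σ Γ : Set} (N : ℕ) (σ : State Σ Γ) (e : Bound) : Set where
  constructor smallˢ
  field
    size≤  : sizeˢ σ ≤ ⟪ e ⟫ N
    width≤ : widthˢ σ ≤ 2

-- Paths with `k` equal to 1 may be intersected, giving `k` equal to 2 (see `_∩ᵖ_`). The width is
-- bounded separately because a test hides the width of its formula from `iw`.
record Smallᵖ {Σ Γ : Set} (N k : ℕ) (π : Path Σ Γ) (e : Bound) : Set where
  constructor smallᵖ
  field
    size≤  : sizeᵖ π ≤ ⟪ e ⟫ N
    iw≤    : iw π ≤ k
    width≤ : widthᵖ π ≤ 2

private
  ⊔³ : ∀ {a b c d} → a ≤ b ⊔ c → b ≤ d → c ≤ d → a ⊔ b ⊔ c ≤ d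
  ⊔³ a≤ b≤ c≤ = ℕ.⊔-lub (ℕ.⊔-lub (ℕ.≤-trans a≤ (ℕ.⊔-lub b≤ c≤)) b≤) c≤

record Small∃ {Σ Γ : Set} (N : ℕ) (Ψ : EQ-ICPDL Σ Γ) (e : Bound) : Set where
  constructor small∃
  field
    size≤  : size∃ Ψ ≤ ⟪ e ⟫ N
    width≡ : width∃ Ψ ≡ 2

few-Fin : ∀ {N n} → n ≤ N → Few N (enum-Fin n) var
few-Fin {n = n} n≤N = few (ℕ.≤-trans (ℕ.≤-reflexive (length-tabulate {n = n} (λ i → i))) n≤N)

few-map : ∀ {N A B} {f : A → B} {g fg} {as : Enum A} {e} → Few N as e → Few N (enum-map f g fg as) e
few-map {f = f} {as = as} (few h) = few (ℕ.≤-trans (ℕ.≤-reflexive (length-map f (elems as))) h)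

infixr 4 _⊎ˡ_ _×ˡ_

_⊎ˡ_ : ∀ {N A B} {as : Enum A} {bs : Enum B} {e f} → Few N as e → Few N bs f → Few N (enum-⊎ as bs) (e ⊞ f)
_⊎ˡ_ {as = as} {bs} (few h) (few k) = few (ℕ.≤-trans (ℕ.≤-reflexive (trans (length-++ (map inj₁ (elems as)))
  (cong₂ _+_ (length-map inj₁ (elems as)) (length-map inj₂ (elems bs))))) (ℕ.+-mono-≤ h k))

_×ˡ_ : ∀ {N A B} {as : Enum A} {bs : Enum B} {e f} → Few N as e → Few N bs f → Few N (as ×ᵉ bs) (e ⊠ f)
_×ˡ_ {as = as} {bs} (few h) (few k) =
  few (ℕ.≤-trans (ℕ.≤-reflexive (length-product (elems as) (elems bs))) (ℕ.*-mono-≤ h k))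
  where
  length-product : {A B : Set} (xs : List A) (ys : List B) →
                   length (cartesianProductWith _,_ xs ys) ≡ length xs * length ys
  length-product []       ys = refl
  length-product (x ∷ xs) ys = trans (length-++ (map (x ,_) ys))
                                     (cong₂ _+_ (length-map (x ,_) ys) (length-product xs ys))

module _ {Σ Γ : Set} {N : ℕ} where

  ⊤ˢ : Smallˢ {Σ} {Γ} N ⊤′ (con 1)
  ⊤ˢ = smallˢ ℕ.≤-refl z≤n

  propˢ : ∀ {p} → Smallˢ {Σ} {Γ} N (prop p) (con 1)
  propˢ = smallˢ ℕ.≤-refl z≤n

  _∨ˢ_ : ∀ {σ τ : State Σ Γ} {e f} → Smallˢ N σ e → Smallˢ N τ f → Smallˢ N (σ ∨′ τ) (con 1 ⊞ e ⊞ f)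
  smallˢ s h ∨ˢ smallˢ s′ h′ = smallˢ (s≤s (ℕ.+-mono-≤ s s′)) (ℕ.⊔-lub h h′)

  infixr 5 _∨ˢ_

  ¬ˢ_ : ∀ {σ : State Σ Γ} {e} → Smallˢ N σ e → Smallˢ N (¬′ σ) (con 1 ⊞ e)
  ¬ˢ smallˢ s h = smallˢ (s≤s s) h

  ⟨_⟩ˢ_ : ∀ {π : Path Σ Γ} {σ k e f} → Smallᵖ N k π e → Smallˢ N σ f → Smallˢ N (⟨ π ⟩ σ) (con 1 ⊞ e ⊞ f)
  ⟨ smallᵖ s _ h ⟩ˢ smallˢ s′ h′ = smallˢ (s≤s (ℕ.+-mono-≤ s s′)) (ℕ.⊔-lub h h′)

  loopˢ : ∀ {π : Path Σ Γ} {k e} → Smallᵖ N k π e → Smallˢ N (loop π) (con 1 ⊞ e)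
  loopˢ (smallᵖ s _ h) = smallˢ (s≤s s) h

  ⟶ᵖ : ∀ {γ} → Smallᵖ {Σ} {Γ} N 1 (⟶ γ) (con 1)
  ⟶ᵖ = smallᵖ ℕ.≤-refl ℕ.≤-refl (s≤s z≤n)

  testᵖ : ∀ {σ : State Σ Γ} {e} → Smallˢ N σ e → Smallᵖ N 1 (test σ) (con 1 ⊞ e)
  testᵖ (smallˢ s h) = smallᵖ (s≤s s) ℕ.≤-refl (ℕ.⊔-lub (s≤s z≤n) h)

  _⊕ᵖ_ : ∀ {π ρ : Path Σ Γ} {k e f} → Smallᵖ N k π e → Smallᵖ N k ρ f → Smallᵖ N k (π ⊕ ρ) (con 1 ⊞ e ⊞ f)
  _⊕ᵖ_ {π} {ρ} (smallᵖ s i h) (smallᵖ s′ i′ h′) =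
    smallᵖ (s≤s (ℕ.+-mono-≤ s s′)) (ℕ.⊔-lub i i′) (⊔³ (ℕ.⊔-mono-≤ (iw≤widthᵖ π) (iw≤widthᵖ ρ)) h h′)

  _·ᵖ_ : ∀ {π ρ : Path Σ Γ} {k e f} → Smallᵖ N k π e → Smallᵖ N k ρ f → Smallᵖ N k (π · ρ) (con 1 ⊞ e ⊞ f)
  _·ᵖ_ {π} {ρ} (smallᵖ s i h) (smallᵖ s′ i′ h′) =
    smallᵖ (s≤s (ℕ.+-mono-≤ s s′)) (ℕ.⊔-lub i i′) (⊔³ (ℕ.⊔-mono-≤ (iw≤widthᵖ π) (iw≤widthᵖ ρ)) h h′)

  infixr 6 _⊕ᵖ_
  infixr 8 _·ᵖ_

  _✶ᵖ : ∀ {π : Path Σ Γ} {k e} → Smallᵖ N k π e → Smallᵖ N k (π ✶) (con 1 ⊞ e)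
  _✶ᵖ {π} (smallᵖ s i h) = smallᵖ (s≤s s) i (ℕ.⊔-lub (ℕ.≤-trans (iw≤widthᵖ π) h) h)

  _⁻¹ᵖ : ∀ {π : Path Σ Γ} {k e} → Smallᵖ N k π e → Smallᵖ N k (π ⁻¹) (con 1 ⊞ e)
  _⁻¹ᵖ {π} (smallᵖ s i h) = smallᵖ (s≤s s) i (ℕ.⊔-lub (ℕ.≤-trans (iw≤widthᵖ π) h) h)

  _∩ᵖ_ : ∀ {π ρ : Path Σ Γ} {e f} → Smallᵖ N 1 π e → Smallᵖ N 1 ρ f → Smallᵖ N 2 (π ∩ ρ) (con 1 ⊞ e ⊞ f)
  smallᵖ s i h ∩ᵖ smallᵖ s′ i′ h′ =
    smallᵖ (s≤s (ℕ.+-mono-≤ s s′)) (ℕ.+-mono-≤ i i′) (ℕ.⊔-lub (ℕ.⊔-lub (ℕ.+-mono-≤ i i′) h) h′)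

  infixr 7 _∩ᵖ_
  infix  9 _✶ᵖ _⁻¹ᵖ
  infix  10 ¬ˢ_

  infixr 6 _∧ˢ_
  _∧ˢ_ : ∀ {σ τ : State Σ Γ} {e f} → Smallˢ N σ e → Smallˢ N τ f → Smallˢ N (σ ∧′ τ) (con 1 ⊞ (con 1 ⊞ e) ⊞ f)
  s ∧ˢ t = ⟨ testᵖ s ⟩ˢ t

  -- The 2 is the size of `⊥′`, which replaces `σ` when `b` is false; a sum stands in for the
  -- maximum. Likewise the 3 in `whenPᵖ` is the size of `test ⊥′`.
  whenˢ : ∀ {b} {σ : State Σ Γ} {e} → Smallˢ N σ e → Smallˢ N (when b σ) (con 2 ⊞ e)
  whenˢ {true}  {e = e} (smallˢ s h) = smallˢ (ℕ.≤-trans s (ℕ.m≤n+m _ 2)) h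
  whenˢ {false} {e = e} _            = smallˢ (ℕ.m≤m+n 2 _) z≤n

  whenPᵖ : ∀ {b} {π : Path Σ Γ} {k e} → 1 ≤ k → Smallᵖ N k π e → Smallᵖ N k (whenᵖ b π) (con 3 ⊞ e)
  whenPᵖ {true}  1≤k (smallᵖ s i h) = smallᵖ (ℕ.≤-trans s (ℕ.m≤n+m _ 3)) i h
  whenPᵖ {false} 1≤k _              = smallᵖ (ℕ.m≤m+n 3 _) 1≤k (s≤s z≤n)

  private
    anyOf-size : ∀ {A : Set} (xs : List A) {f : A → State Σ Γ} {e} → (∀ x → Smallˢ N (f x) e) →
                 sizeˢ (anyOf xs f) ≤ length xs * (1 + ⟪ e ⟫ N) + 2
    anyOf-size []       s = ℕ.≤-refl
    anyOf-size (x ∷ xs) {f} {e} s = begin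
      1 + sizeˢ (f x) + sizeˢ (anyOf xs f)                 ≤⟨ ℕ.+-mono-≤ (s≤s (Smallˢ.size≤ (s x))) (anyOf-size xs s) ⟩
      1 + ⟪ e ⟫ N + (length xs * (1 + ⟪ e ⟫ N) + 2)        ≡⟨ ℕ.+-assoc (1 + ⟪ e ⟫ N) (length xs * (1 + ⟪ e ⟫ N)) 2 ⟨
      1 + ⟪ e ⟫ N + length xs * (1 + ⟪ e ⟫ N) + 2          ∎
      where open ℕ.≤-Reasoning

    anyOf-width : ∀ {A : Set} (xs : List A) {f : A → State Σ Γ} {e} → (∀ x → Smallˢ N (f x) e) →
                  widthˢ (anyOf xs f) ≤ 2
    anyOf-width []       s = z≤n
    anyOf-width (x ∷ xs) s = ℕ.⊔-lub (Smallˢ.width≤ (s x)) (anyOf-width xs s)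

    anyOfᵖ-size : ∀ {A : Set} (xs : List A) {f : A → Path Σ Γ} {k e} → (∀ x → Smallᵖ N k (f x) e) →
                  sizeᵖ (anyOfᵖ xs f) ≤ length xs * (1 + ⟪ e ⟫ N) + 3
    anyOfᵖ-size []       s = ℕ.≤-refl
    anyOfᵖ-size (x ∷ xs) {f} {k} {e} s = begin
      1 + sizeᵖ (f x) + sizeᵖ (anyOfᵖ xs f)                ≤⟨ ℕ.+-mono-≤ (s≤s (Smallᵖ.size≤ (s x))) (anyOfᵖ-size xs s) ⟩
      1 + ⟪ e ⟫ N + (length xs * (1 + ⟪ e ⟫ N) + 3)        ≡⟨ ℕ.+-assoc (1 + ⟪ e ⟫ N) (length xs * (1 + ⟪ e ⟫ N)) 3 ⟨
      1 + ⟪ e ⟫ N + length xs * (1 + ⟪ e ⟫ N) + 3          ∎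
      where open ℕ.≤-Reasoning

    anyOfᵖ-iw : ∀ {A : Set} (xs : List A) {f : A → Path Σ Γ} {k e} → 1 ≤ k → (∀ x → Smallᵖ N k (f x) e) →
                iw (anyOfᵖ xs f) ≤ k
    anyOfᵖ-iw []       1≤k s = 1≤k
    anyOfᵖ-iw (x ∷ xs) 1≤k s = ℕ.⊔-lub (Smallᵖ.iw≤ (s x)) (anyOfᵖ-iw xs 1≤k s)

    anyOfᵖ-width : ∀ {A : Set} (xs : List A) {f : A → Path Σ Γ} {k e} → (∀ x → Smallᵖ N k (f x) e) →
                   widthᵖ (anyOfᵖ xs f) ≤ 2
    anyOfᵖ-width []       s = s≤s z≤n
    anyOfᵖ-width (x ∷ xs) {f} s =
      ⊔³ (ℕ.⊔-mono-≤ (iw≤widthᵖ (f x)) (iw≤widthᵖ (anyOfᵖ xs f))) (Smallᵖ.width≤ (s x)) (anyOfᵖ-width xs s)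

  ⋁ˢ : ∀ {A : Set} {as : Enum A} {l} {f : A → State Σ Γ} {e} → Few N as l →
       (∀ x → Smallˢ N (f x) e) → Smallˢ N (⋁ as f) (l ⊠ (con 1 ⊞ e) ⊞ con 2)
  ⋁ˢ {as = as} {e = e} (few l) s = smallˢ
    (ℕ.≤-trans (anyOf-size (elems as) s) (ℕ.+-monoˡ-≤ 2 (ℕ.*-monoˡ-≤ (1 + ⟪ e ⟫ N) l)))
    (anyOf-width (elems as) s)

  ⨁ᵖ : ∀ {A : Set} {as : Enum A} {l} {f : A → Path Σ Γ} {k e} → 1 ≤ k → Few N as l →
       (∀ x → Smallᵖ N k (f x) e) → Smallᵖ N k (⨁ as f) (l ⊠ (con 1 ⊞ e) ⊞ con 3)
  ⨁ᵖ {as = as} {e = e} 1≤k (few l) s = smallᵖ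
    (ℕ.≤-trans (anyOfᵖ-size (elems as) s) (ℕ.+-monoˡ-≤ 3 (ℕ.*-monoˡ-≤ (1 + ⟪ e ⟫ N) l)))
    (anyOfᵖ-iw (elems as) 1≤k s)
    (anyOfᵖ-width (elems as) s)

-- Substitution, isomorphism and decidability

module _ {Σ Σ′ Γ : Set} (s : Σ → State Σ′ Γ) where

  mutual
    substˢ : State Σ Γ → State Σ′ Γ
    substˢ ⊤′        = ⊤′
    substˢ (prop p)  = s p
    substˢ (σ ∨′ τ)  = substˢ σ ∨′ substˢ τ
    substˢ (¬′ σ)    = ¬′ substˢ σ
    substˢ (⟨ π ⟩ σ) = ⟨ substᵖ π ⟩ substˢ σ
    substˢ (loop π)  = loop (substᵖ π)

    substᵖ : Path Σ Γ → Path Σ′ Γ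
    substᵖ (⟶ γ)    = ⟶ γ
    substᵖ (test σ) = test (substˢ σ)
    substᵖ (π ⊕ ρ)  = substᵖ π ⊕ substᵖ ρ
    substᵖ (π · ρ)  = substᵖ π · substᵖ ρ
    substᵖ (π ✶)    = substᵖ π ✶
    substᵖ (π ⁻¹)   = substᵖ π ⁻¹
    substᵖ (π ∩ ρ)  = substᵖ π ∩ substᵖ ρ

  substᶠ : ICPDL Σ Γ → ICPDL Σ′ Γ
  substᶠ (E σ)    = E (substˢ σ)
  substᶠ (¬′ Φ)   = ¬′ substᶠ Φ
  substᶠ (Φ ∨′ Ψ) = substᶠ Φ ∨′ substᶠ Ψ

  module _ {N : ℕ} {e : Bound} (small : ∀ p → Smallˢ N (s p) e) where

    private
      -- The growth factor of the substitution. The added 1 keeps it positive, which leaves other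
      -- than propositions and all inner nodes rely on.
      c = 1 + ⟪ e ⟫ N

      leaf : ∀ {a} → a ≤ 1 → a ≤ 1 * c
      leaf z≤n       = z≤n
      leaf (s≤s z≤n) = s≤s z≤n

      node₁ : ∀ {a a′} → a ≤ a′ * c → 1 + a ≤ (1 + a′) * c
      node₁ p = s≤s (ℕ.≤-trans p (ℕ.m≤n+m _ _))

      node₂ : ∀ {a a′ b b′} → a ≤ a′ * c → b ≤ b′ * c → 1 + a + b ≤ (1 + a′ + b′) * c
      node₂ {a} {a′} {b} {b′} p q = node₁ {a + b} {a′ + b′}
        (ℕ.≤-trans (ℕ.+-mono-≤ p q) (ℕ.≤-reflexive (sym (ℕ.*-distribʳ-+ c a′ b′))))

    mutual
      substˢ-size : ∀ σ → sizeˢ (substˢ σ) ≤ sizeˢ σ * c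
      substˢ-size ⊤′        = leaf ℕ.≤-refl
      substˢ-size (prop p)  = ℕ.≤-trans (ℕ.m≤n⇒m≤1+n (Smallˢ.size≤ (small p))) (ℕ.≤-reflexive (sym (ℕ.*-identityˡ c)))
      substˢ-size (σ ∨′ τ)  = node₂ {a′ = sizeˢ σ} (substˢ-size σ) (substˢ-size τ)
      substˢ-size (¬′ σ)    = node₁ {a′ = sizeˢ σ} (substˢ-size σ)
      substˢ-size (⟨ π ⟩ σ) = node₂ {a′ = sizeᵖ π} (substᵖ-size π) (substˢ-size σ)
      substˢ-size (loop π)  = node₁ {a′ = sizeᵖ π} (substᵖ-size π)

      substᵖ-size : ∀ π → sizeᵖ (substᵖ π) ≤ sizeᵖ π * c
      substᵖ-size (⟶ γ)    = leaf ℕ.≤-refl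
      substᵖ-size (test σ) = node₁ {a′ = sizeˢ σ} (substˢ-size σ)
      substᵖ-size (π ⊕ ρ)  = node₂ {a′ = sizeᵖ π} (substᵖ-size π) (substᵖ-size ρ)
      substᵖ-size (π · ρ)  = node₂ {a′ = sizeᵖ π} (substᵖ-size π) (substᵖ-size ρ)
      substᵖ-size (π ✶)    = node₁ {a′ = sizeᵖ π} (substᵖ-size π)
      substᵖ-size (π ⁻¹)   = node₁ {a′ = sizeᵖ π} (substᵖ-size π)
      substᵖ-size (π ∩ ρ)  = node₂ {a′ = sizeᵖ π} (substᵖ-size π) (substᵖ-size ρ)

    substᶠ-size : ∀ Φ → size (substᶠ Φ) ≤ size Φ * c
    substᶠ-size (E σ)    = node₁ {a′ = sizeˢ σ} (substˢ-size σ)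
    substᶠ-size (¬′ Φ)   = node₁ {a′ = size Φ} (substᶠ-size Φ)
    substᶠ-size (Φ ∨′ Ψ) = node₂ {a′ = size Φ} (substᶠ-size Φ) (substᶠ-size Ψ)

    -- Substitution reaches only formulas inside tests, and a `test` has `iw` 1 whatever it
    -- contains.
    substᵖ-iw : ∀ π → ∩-freeᵖ π → iw (substᵖ π) ≤ 1
    substᵖ-iw (⟶ γ)    _       = ℕ.≤-refl
    substᵖ-iw (test σ) _       = ℕ.≤-refl
    substᵖ-iw (π ⊕ ρ)  (f , g) = ℕ.⊔-lub (substᵖ-iw π f) (substᵖ-iw ρ g)
    substᵖ-iw (π · ρ)  (f , g) = ℕ.⊔-lub (substᵖ-iw π f) (substᵖ-iw ρ g)
    substᵖ-iw (π ✶)    f       = substᵖ-iw π f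
    substᵖ-iw (π ⁻¹)   f       = substᵖ-iw π f

    private
      1≤⇒≤2 : ∀ {a} → a ≤ 1 → a ≤ 2
      1≤⇒≤2 = ℕ.m≤n⇒m≤1+n

    mutual
      substˢ-width : ∀ σ → ∩-freeˢ σ → widthˢ (substˢ σ) ≤ 2
      substˢ-width ⊤′        _       = z≤n
      substˢ-width (prop p)  _       = Smallˢ.width≤ (small p)
      substˢ-width (σ ∨′ τ)  (f , g) = ℕ.⊔-lub (substˢ-width σ f) (substˢ-width τ g)
      substˢ-width (¬′ σ)    f       = substˢ-width σ f
      substˢ-width (⟨ π ⟩ σ) (f , g) = ℕ.⊔-lub (substᵖ-width π f) (substˢ-width σ g)
      substˢ-width (loop π)  f       = substᵖ-width π f

      substᵖ-width : ∀ π → ∩-freeᵖ π → widthᵖ (substᵖ π) ≤ 2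
      substᵖ-width (⟶ γ)    _ = s≤s z≤n
      substᵖ-width (test σ) f = ℕ.⊔-lub (s≤s z≤n) (substˢ-width σ f)
      substᵖ-width (π ⊕ ρ) (f , g) =
        ℕ.⊔-lub (ℕ.⊔-lub (1≤⇒≤2 (substᵖ-iw (π ⊕ ρ) (f , g))) (substᵖ-width π f)) (substᵖ-width ρ g)
      substᵖ-width (π · ρ) (f , g) =
        ℕ.⊔-lub (ℕ.⊔-lub (1≤⇒≤2 (substᵖ-iw (π · ρ) (f , g))) (substᵖ-width π f)) (substᵖ-width ρ g)
      substᵖ-width (π ✶)  f = ℕ.⊔-lub (1≤⇒≤2 (substᵖ-iw π f)) (substᵖ-width π f)
      substᵖ-width (π ⁻¹) f = ℕ.⊔-lub (1≤⇒≤2 (substᵖ-iw π f)) (substᵖ-width π f)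

    substᶠ-width : ∀ Φ → ∩-free Φ → width (substᶠ Φ) ≤ 2
    substᶠ-width (E σ)    f       = substˢ-width σ f
    substᶠ-width (¬′ Φ)   f       = substᶠ-width Φ f
    substᶠ-width (Φ ∨′ Ψ) (f , g) = ℕ.⊔-lub (substᶠ-width Φ f) (substᶠ-width Ψ g)

module _ {Σ Γ : Set} where

  mutual
    substˢ-prop : (σ : State Σ Γ) → substˢ prop σ ≡ σ
    substˢ-prop ⊤′        = refl
    substˢ-prop (prop p)  = refl
    substˢ-prop (σ ∨′ τ)  = cong₂ _∨′_ (substˢ-prop σ) (substˢ-prop τ)
    substˢ-prop (¬′ σ)    = cong ¬′_ (substˢ-prop σ)
    substˢ-prop (⟨ π ⟩ σ) = cong₂ ⟨_⟩_ (substᵖ-prop π) (substˢ-prop σ)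
    substˢ-prop (loop π)  = cong loop (substᵖ-prop π)

    substᵖ-prop : (π : Path Σ Γ) → substᵖ prop π ≡ π
    substᵖ-prop (⟶ γ)    = refl
    substᵖ-prop (test σ) = cong test (substˢ-prop σ)
    substᵖ-prop (π ⊕ ρ)  = cong₂ _⊕_ (substᵖ-prop π) (substᵖ-prop ρ)
    substᵖ-prop (π · ρ)  = cong₂ _·_ (substᵖ-prop π) (substᵖ-prop ρ)
    substᵖ-prop (π ✶)    = cong _✶ (substᵖ-prop π)
    substᵖ-prop (π ⁻¹)   = cong _⁻¹ (substᵖ-prop π)
    substᵖ-prop (π ∩ ρ)  = cong₂ _∩_ (substᵖ-prop π) (substᵖ-prop ρ)

  substᶠ-prop : (Φ : ICPDL Σ Γ) → substᶠ prop Φ ≡ Φ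
  substᶠ-prop (E σ)    = cong E (substˢ-prop σ)
  substᶠ-prop (¬′ Φ)   = cong ¬′_ (substᶠ-prop Φ)
  substᶠ-prop (Φ ∨′ Ψ) = cong₂ _∨′_ (substᶠ-prop Φ) (substᶠ-prop Ψ)

-- An isomorphism of the underlying unlabelled graphs under which the label p
-- of G becomes the formula s p of H.
record Interpretation {Σ Σ′ Γ : Set} (G : Graph Σ Γ) (H : Graph Σ′ Γ) (s : Σ → State Σ′ Γ) : Set where
  field
    to      : V G → V H
    from    : V H → V G
    to-from : ∀ x → to (from x) ≡ x
    from-to : ∀ v → from (to v) ≡ v
    edges   : ∀ u γ v → edge G u γ v ≡ edge H (to u) γ (to v)
    labels⁺ : ∀ v p → T (label G v p) → ⟦_⟧ˢ H (s p) (to v)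
    labels⁻ : ∀ v p → ⟦_⟧ˢ H (s p) (to v) → T (label G v p)

  mutual
    -- Both directions are proved at once, since negation turns each into the other.
    stateTo : ∀ σ {v} → ⟦_⟧ˢ G σ v → ⟦_⟧ˢ H (substˢ s σ) (to v)
    stateTo ⊤′ p              = tt
    stateTo (prop p) q        = labels⁺ _ p q
    stateTo (σ ∨′ τ) (inj₁ p) = inj₁ (stateTo σ p)
    stateTo (σ ∨′ τ) (inj₂ p) = inj₂ (stateTo τ p)
    stateTo (¬′ σ) ¬p q       = ¬p (subst (⟦_⟧ˢ G σ) (from-to _) (stateFrom σ q))
    stateTo (⟨ π ⟩ σ) (v , p , q) = to v , stateTo σ p , pathTo π q
    stateTo (loop π) p        = pathTo π p

    stateFrom : ∀ σ {x} → ⟦_⟧ˢ H (substˢ s σ) x → ⟦_⟧ˢ G σ (from x)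
    stateFrom ⊤′ p              = tt
    stateFrom (prop p) q        = labels⁻ _ p (subst (⟦_⟧ˢ H (s p)) (sym (to-from _)) q)
    stateFrom (σ ∨′ τ) (inj₁ p) = inj₁ (stateFrom σ p)
    stateFrom (σ ∨′ τ) (inj₂ p) = inj₂ (stateFrom τ p)
    stateFrom (¬′ σ) ¬p q       = ¬p (subst (⟦_⟧ˢ H (substˢ s σ)) (to-from _) (stateTo σ q))
    stateFrom (⟨ π ⟩ σ) (v , p , q) = from v , stateFrom σ p , pathFrom π q
    stateFrom (loop π) p        = pathFrom π p

    pathTo : ∀ π {u v} → ⟦_⟧ᵖ G π u v → ⟦_⟧ᵖ H (substᵖ s π) (to u) (to v)
    pathTo (⟶ γ) p           = subst T (edges _ γ _) p
    pathTo (test σ) (u≡v , p) = cong to u≡v , stateTo σ p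
    pathTo (π ⊕ ρ) (inj₁ p)  = inj₁ (pathTo π p)
    pathTo (π ⊕ ρ) (inj₂ p)  = inj₂ (pathTo ρ p)
    pathTo (π · ρ) (x , p , q) = to x , pathTo π p , pathTo ρ q
    pathTo (π ✶) p           = starTo π p
    pathTo (π ⁻¹) p          = pathTo π p
    pathTo (π ∩ ρ) (p , q)   = pathTo π p , pathTo ρ q

    pathFrom : ∀ π {x y} → ⟦_⟧ᵖ H (substᵖ s π) x y → ⟦_⟧ᵖ G π (from x) (from y)
    pathFrom (⟶ γ) p = subst T
      (sym (trans (edges _ γ _) (cong₂ (λ a b → edge H a γ b) (to-from _) (to-from _)))) p
    pathFrom (test σ) (u≡v , p) = cong from u≡v , stateFrom σ p
    pathFrom (π ⊕ ρ) (inj₁ p)  = inj₁ (pathFrom π p)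
    pathFrom (π ⊕ ρ) (inj₂ p)  = inj₂ (pathFrom ρ p)
    pathFrom (π · ρ) (x , p , q) = from x , pathFrom π p , pathFrom ρ q
    pathFrom (π ✶) p           = starFrom π p
    pathFrom (π ⁻¹) p          = pathFrom π p
    pathFrom (π ∩ ρ) (p , q)   = pathFrom π p , pathFrom ρ q

    starTo : ∀ π {u v} → Star (⟦_⟧ᵖ G π) u v → Star (⟦_⟧ᵖ H (substᵖ s π)) (to u) (to v)
    starTo π ε       = ε
    starTo π (p ◅ q) = pathTo π p ◅ starTo π q

    starFrom : ∀ π {x y} → Star (⟦_⟧ᵖ H (substᵖ s π)) x y → Star (⟦_⟧ᵖ G π) (from x) (from y)
    starFrom π ε       = ε
    starFrom π (p ◅ q) = pathFrom π p ◅ starFrom π q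

  mutual
    sentenceTo : ∀ Φ → G ⊨ Φ → H ⊨ substᶠ s Φ
    sentenceTo (E σ) (v , p)     = to v , stateTo σ p
    sentenceTo (¬′ Φ) ¬p q       = ¬p (sentenceFrom Φ q)
    sentenceTo (Φ ∨′ Ψ) (inj₁ p) = inj₁ (sentenceTo Φ p)
    sentenceTo (Φ ∨′ Ψ) (inj₂ p) = inj₂ (sentenceTo Ψ p)

    sentenceFrom : ∀ Φ → H ⊨ substᶠ s Φ → G ⊨ Φ
    sentenceFrom (E σ) (v , p)     = from v , stateFrom σ p
    sentenceFrom (¬′ Φ) ¬p q       = ¬p (sentenceTo Φ q)
    sentenceFrom (Φ ∨′ Ψ) (inj₁ p) = inj₁ (sentenceFrom Φ p)
    sentenceFrom (Φ ∨′ Ψ) (inj₂ p) = inj₂ (sentenceFrom Ψ p)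

-- Floyd–Warshall: Via k is reachability by paths whose inner vertices are below k.
module _ {n : ℕ} {R : Rel (Fin n) 0ℓ} (R? : ∀ u v → Dec (R u v)) where

  private
    Via : ∀ k → k ≤ n → Rel (Fin n) 0ℓ
    Via zero    k≤n u v = u ≡ v ⊎ R u v
    Via (suc k) k<n u v = Via k k≤n u v ⊎ Via k k≤n u x × Via k k≤n x v
      where
      k≤n = ℕ.<⇒≤ k<n
      x   = Fin.fromℕ< k<n

    via? : ∀ k k≤n u v → Dec (Via k k≤n u v)
    via? zero    k≤n u v = (u Fin.≟ v) ⊎-dec R? u v
    via? (suc k) k<n u v = via? k _ u v ⊎-dec (via? k _ u _ ×-dec via? k _ _ v)

    via⇒star : ∀ k k≤n {u v} → Via k k≤n u v → Star R u v
    via⇒star zero    _ (inj₁ refl)     = ε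
    via⇒star zero    _ (inj₂ p)        = p ◅ ε
    via⇒star (suc k) _ (inj₁ p)        = via⇒star k _ p
    via⇒star (suc k) _ (inj₂ (p , q)) = via⇒star k _ p ◅◅ via⇒star k _ q

    via-base : ∀ k k≤n {u v} → u ≡ v ⊎ R u v → Via k k≤n u v
    via-base zero    _ p = p
    via-base (suc k) _ p = inj₁ (via-base k _ p)

    -- If `x` is the new vertex itself, a path ending or starting there need not also visit it
    -- inside. Otherwise `x` was allowed before; when both paths visit the new vertex, the detour
    -- between its two visits is dropped.
    via-trans : ∀ k k≤n {u x v} → toℕ x < k → Via k k≤n u x → Via k k≤n x v → Via k k≤n u v
    via-trans (suc k) k<n {u} {x} {v} x<1+k p q with ℕ.m≤n⇒m<n∨m≡n (ℕ.≤-pred x<1+k)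
    ... | inj₂ x≡k = inj₂ (left (subst (λ y → Via (suc k) k<n u y) x≡ p) , right (subst (λ y → Via (suc k) k<n y v) x≡ q))
      where
      x≡ : x ≡ Fin.fromℕ< k<n
      x≡ = Fin.toℕ-injective (trans x≡k (sym (Fin.toℕ-fromℕ< k<n)))
      left : ∀ {u} → Via (suc k) k<n u (Fin.fromℕ< k<n) → Via k (ℕ.<⇒≤ k<n) u (Fin.fromℕ< k<n)
      left (inj₁ a)       = a
      left (inj₂ (a , _)) = a
      right : ∀ {v} → Via (suc k) k<n (Fin.fromℕ< k<n) v → Via k (ℕ.<⇒≤ k<n) (Fin.fromℕ< k<n) v
      right (inj₁ a)       = a
      right (inj₂ (_ , a)) = a
    ... | inj₁ x<k with p | q
    ... | inj₁ a       | inj₁ b       = inj₁ (via-trans k _ x<k a b)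
    ... | inj₁ a       | inj₂ (b , c) = inj₂ (via-trans k _ x<k a b , c)
    ... | inj₂ (a , b) | inj₁ c       = inj₂ (a , via-trans k _ x<k b c)
    ... | inj₂ (a , b) | inj₂ (c , d) = inj₂ (a , d)

    star⇒via : ∀ {u v} → Star R u v → Via n ℕ.≤-refl u v
    star⇒via ε       = via-base n _ (inj₁ refl)
    star⇒via (p ◅ q) = via-trans n _ (Fin.toℕ<n _) (via-base n _ (inj₂ p)) (star⇒via q)

  star? : ∀ u v → Dec (Star R u v)
  star? u v = map′ (via⇒star n _) star⇒via (via? n _ u v)

module _ {Σ Γ : Set} (G : Graph Σ Γ) where

  mutual
    state? : ∀ σ v → Dec (⟦_⟧ˢ G σ v)
    state? ⊤′ v        = yes tt
    state? (prop p) v  = T? _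
    state? (σ ∨′ τ) v  = state? σ v ⊎-dec state? τ v
    state? (¬′ σ) v    = ¬? (state? σ v)
    state? (⟨ π ⟩ σ) u = Fin.any? λ v → state? σ v ×-dec path? π u v
    state? (loop π) v  = path? π v v

    path? : ∀ π u v → Dec (⟦_⟧ᵖ G π u v)
    path? (⟶ γ) u v    = T? _
    path? (test σ) u v = (u Fin.≟ v) ×-dec state? σ v
    path? (π ⊕ ρ) u v  = path? π u v ⊎-dec path? ρ u v
    path? (π · ρ) u v  = Fin.any? λ x → path? π u x ×-dec path? ρ x v
    path? (π ✶) u v    = star? (path? π) u v
    path? (π ⁻¹) u v   = path? π v u
    path? (π ∩ ρ) u v  = path? π u v ×-dec path? ρ u v

  sentence? : ∀ Φ → Dec (G ⊨ Φ)
  sentence? (E σ)    = Fin.any? (state? σ)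
  sentence? (¬′ Φ)   = ¬? (sentence? Φ)
  sentence? (Φ ∨′ Ψ) = sentence? Φ ⊎-dec sentence? Ψ

-- Functions between finite sets are coded by numbers. Decoding recovers a function only pointwise,
-- whence the hypothesis that `P` respects `≗`.
anyFunction? : ∀ {m k} {P : (Fin m → Fin k) → Set} → (∀ {f g} → f ≗ g → P f → P g) →
               (∀ f → Dec (P f)) → Dec (∃ P)
anyFunction? {m} {k} resp P? = map′
  (λ { (i , p) → Fin.finToFun i , p })
  (λ { (f , p) → Fin.funToFin f , resp (sym ∘ Fin.finToFun-funToFin f) p })
  (Fin.any? (P? ∘ Fin.finToFun))

-- Counting, matchings and linear orders

does⁺ : ∀ {A : Set} (a? : Dec A) → A → T (does a?)
does⁺ (yes _) _ = tt
does⁺ (no ¬a) a = ¬a a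

does⁻ : ∀ {A : Set} (a? : Dec A) → T (does a?) → A
does⁻ (yes a) _ = a

count : ∀ {n} → (Fin n → Bool) → ℕ
count {zero}  P = 0
count {suc n} P = (if P zero then 1 else 0) + count (P ∘ suc)

private
  ind : Bool → ℕ
  ind b = if b then 1 else 0

  ind-mono : ∀ {a b} → (T a → T b) → ind a ≤ ind b
  ind-mono {false}        _ = z≤n
  ind-mono {true} {true}  _ = ℕ.≤-refl
  ind-mono {true} {false} f = ⊥-elim (f tt)

  ind-strict : ∀ {a b} → ¬ T a → T b → ind a < ind b
  ind-strict {true}         ¬a _ = contradiction tt ¬a
  ind-strict {false} {true} _  _ = ℕ.≤-refl

count-mono : ∀ {n} {P Q : Fin n → Bool} → (∀ i → T (P i) → T (Q i)) → count P ≤ count Q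
count-mono {zero}  f = z≤n
count-mono {suc n} f = ℕ.+-mono-≤ (ind-mono (f zero)) (count-mono (f ∘ suc))

count-strict : ∀ {n} {P Q : Fin n → Bool} → (∀ i → T (P i) → T (Q i)) →
               ∀ i → ¬ T (P i) → T (Q i) → count P < count Q
count-strict f zero    ¬p q = ℕ.+-mono-<-≤ (ind-strict ¬p q) (count-mono (f ∘ suc))
count-strict f (suc i) ¬p q = ℕ.+-mono-≤-< (ind-mono (f zero)) (count-strict (f ∘ suc) i ¬p q)

count-all : ∀ n → count {n} (λ _ → true) ≡ n
count-all zero    = refl
count-all (suc n) = cong suc (count-all n)

count≤n : ∀ {n} (P : Fin n → Bool) → count P ≤ n
count≤n {n} P = ℕ.≤-trans (count-mono {P = P} {Q = λ _ → true} _) (ℕ.≤-reflexive (count-all n))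

count<n : ∀ {n} (P : Fin n → Bool) i → ¬ T (P i) → count P < n
count<n {n} P i ¬p = ℕ.<-≤-trans (count-strict {P = P} {Q = λ _ → true} _ i ¬p tt) (ℕ.≤-reflexive (count-all n))

-- Induction on the domain: if `zero` is counted, its image `y` is removed from `Q`. The remaining
-- elements still inject into `Q′`, and the removal lowers the count by at least 1.
count-inj : ∀ {m n} (P : Fin m → Bool) (Q : Fin n → Bool) (f : ∀ j → T (P j) → Fin n) →
            (∀ j p → T (Q (f j p))) →
            (∀ {j j′} p p′ → f j p ≡ f j′ p′ → j ≡ j′) →
            count P ≤ count Q
count-inj {zero}  P Q f into inj = z≤n
count-inj {suc m} P Q f into inj with P zero in eq
... | false = count-inj (P ∘ suc) Q (f ∘ suc) (into ∘ suc) (λ p p′ → Fin.suc-injective ∘ inj p p′)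
... | true  = ℕ.≤-trans
  (s≤s (count-inj (P ∘ suc) Q′ (f ∘ suc)
    (λ j p → does⁺ (Q′? (f (suc j) p)) (into (suc j) p , λ fj≡y → Fin.0≢1+n (sym (inj p p₀ fj≡y))))
    (λ p p′ → Fin.suc-injective ∘ inj p p′)))
  (count-strict (λ i q → proj₁ (does⁻ (Q′? i) q)) y
    (λ q → proj₂ (does⁻ (Q′? y) q) refl) (into zero p₀))
  where
  p₀  = subst T (sym eq) tt
  y   = f zero p₀
  Q′? : ∀ i → Dec (T (Q i) × i ≢ y)
  Q′? i = T? (Q i) ×-dec ¬? (i Fin.≟ y)
  Q′  = λ i → does (Q′? i)

length-filter-tabulate : ∀ {n} {A : Set} (p : A → Bool) (f : Fin n → A) →
                         length (filterᵇ p (tabulate f)) ≡ count (p ∘ f)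
length-filter-tabulate {zero}  p f = refl
length-filter-tabulate {suc n} p f with p (f zero)
... | false = length-filter-tabulate p (f ∘ suc)
... | true  = cong suc (length-filter-tabulate p (f ∘ suc))

length-filter-take : ∀ {n} {A : Set} (p : A → Bool) (f : Fin n → A) k →
                     length (filterᵇ p (take k (tabulate f))) ≡
                     count (λ i → if does (toℕ i ℕ.<? k) then p (f i) else false)
length-filter-take {n} {A} p f zero = sym (none n f)
  where
  none : ∀ n (f : Fin n → A) → count {n} (λ i → if does (toℕ i ℕ.<? 0) then p (f i) else false) ≡ 0
  none zero    f = refl
  none (suc n) f = none n (f ∘ suc)
length-filter-take {zero}  p f (suc k) = refl
length-filter-take {suc n} p f (suc k) with p (f zero)
... | false = length-filter-take p (f ∘ suc) k
... | true  = cong suc (length-filter-take p (f ∘ suc) k)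

private
  if-then : ∀ {P : Set} {P? : Dec P} {b} → T (if does P? then b else false) → P × T b
  if-then {P? = yes p} q = p , q

  then-if : ∀ {P : Set} {P? : Dec P} {b} → P → T b → T (if does P? then b else false)
  then-if {P? = yes _} _ q = q
  then-if {P? = no ¬p} p _ = ¬p p

module _ {#DS : ℕ} where

  isRead⁻ : ∀ {d : Fin #DS} o → T (isRead d o) → o ≡ r d
  isRead⁻ {d} (r d′) p with d Fin.≟ d′
  ... | yes refl = refl

  isWrite⁻ : ∀ {d : Fin #DS} o → T (isWrite d o) → o ≡ w d
  isWrite⁻ {d} (w d′) p with d Fin.≟ d′
  ... | yes refl = refl

  isRead⁺ : ∀ {d : Fin #DS} {o} → o ≡ r d → T (isRead d o)
  isRead⁺ {d} refl = does⁺ (d Fin.≟ d) refl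

  isWrite⁺ : ∀ {d : Fin #DS} {o} → o ≡ w d → T (isWrite d o)
  isWrite⁺ {d} refl = does⁺ (d Fin.≟ d) refl

  -- Each read injects into the writes through its matching write, which comes earlier and hence
  -- lies in the same prefix. For the whole word the map from writes to reads gives the converse
  -- inequality.
  matching⇒valid : ∀ {kind : Fin #DS → Kind} {n} {σ : Fin n → Op (Fin #DS)} →
                   (∀ d → Matching kind σ d) → Valid σ
  matching⇒valid {n = n} {σ} matching d = prefix , ℕ.≤-antisym reads≤writes writes≤reads
    where
    open Matching (matching d)

    writer : ∀ j → T (isRead d (σ j)) → Fin n
    writer j p = proj₁ (reads j (isRead⁻ _ p))

    writer↷ : ∀ j p → writer j p ↷ j
    writer↷ j p = proj₁ (proj₂ (reads j (isRead⁻ _ p)))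

    reader : ∀ i → T (isWrite d (σ i)) → Fin n
    reader i p = proj₁ (writes i (isWrite⁻ _ p))

    reader↷ : ∀ i p → i ↷ reader i p
    reader↷ i p = proj₁ (proj₂ (writes i (isWrite⁻ _ p)))

    functional : ∀ {i j j′} → i ↷ j → i ↷ j′ → j ≡ j′
    functional {i} p q = trans (sym (u p)) (u q)
      where u = λ {y} → proj₂ (proj₂ (writes i (proj₁ (sound p)))) {y}

    cofunctional : ∀ {i i′ j} → i ↷ j → i′ ↷ j → i ≡ i′
    cofunctional {j = j} p q = trans (sym (u p)) (u q)
      where u = λ {y} → proj₂ (proj₂ (reads j (proj₁ (proj₂ (sound p))))) {y}

    reads≤writes : #r d (tabulate σ) ≤ #w d (tabulate σ)
    reads≤writes = subst₂ _≤_ (sym (length-filter-tabulate (isRead d) σ)) (sym (length-filter-tabulate (isWrite d) σ))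
      (count-inj _ _ writer (λ j p → isWrite⁺ (proj₁ (sound (writer↷ j p))))
        (λ {j} {j′} p p′ e → functional (writer↷ j p) (subst (_↷ j′) (sym e) (writer↷ j′ p′))))

    writes≤reads : #w d (tabulate σ) ≤ #r d (tabulate σ)
    writes≤reads = subst₂ _≤_ (sym (length-filter-tabulate (isWrite d) σ)) (sym (length-filter-tabulate (isRead d) σ))
      (count-inj _ _ reader (λ i p → isRead⁺ (proj₁ (proj₂ (sound (reader↷ i p)))))
        (λ {i} {i′} p p′ e → cofunctional (reader↷ i p) (subst (i′ ↷_) (sym e) (reader↷ i′ p′))))

    prefix : ∀ k → #r d (take k (tabulate σ)) ≤ #w d (take k (tabulate σ))
    prefix k = subst₂ _≤_ (sym (length-filter-take (isRead d) σ k)) (sym (length-filter-take (isWrite d) σ k))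
      (count-inj _ _ (λ j p → writer j (proj₂ (if-then {P? = toℕ j ℕ.<? k} p)))
        (λ j p → let j<k , q = if-then {P? = toℕ j ℕ.<? k} p
                     i↦w , _ , i<j = sound (writer↷ j q)
                 in then-if {P? = toℕ (writer j q) ℕ.<? k} (ℕ.<-trans i<j j<k) (isWrite⁺ i↦w))
        (λ {j} {j′} p p′ e → functional (writer↷ j _) (subst (_↷ j′) (sym e) (writer↷ j′ _))))

-- Pigeonhole: a missed `y` could be punched out of the codomain, leaving an injection into a set
-- with one element less.
injective⇒surjective : ∀ {n} (f : Fin n → Fin n) → (∀ {i j} → f i ≡ f j → i ≡ j) → ∀ y → ∃ λ x → f x ≡ y
injective⇒surjective {suc n} f inj y with Fin.any? (λ x → f x Fin.≟ y)
... | yes found = found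
... | no  ¬found = contradiction
  (Fin.injective⇒≤ {f = λ x → Fin.punchOut {i = y} (λ e → ¬found (x , sym e))}
    (λ {i} {j} e → inj (Fin.punchOut-injective {i = y} (λ e → ¬found (i , sym e)) (λ e → ¬found (j , sym e)) e)))
  ℕ.1+n≰n

Step : ∀ {n} → Rel (Fin n) 0ℓ
Step u v = toℕ v ≡ suc (toℕ u)

module _ {n : ℕ} {_⊑_ : Rel (Fin n) 0ℓ} (total-order : IsTotalOrder _≡_ _⊑_) where
  private
    module O = IsTotalOrder total-order

    _⊏_ : Rel (Fin n) 0ℓ
    u ⊏ v = u ⊑ v × u ≢ v

    -- The given order carries no decision procedure; totality together with decidable equality on
    -- `Fin n` supplies one, so that ranks can be counted.
    _⊏?_ : ∀ u v → Dec (u ⊏ v)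
    u ⊏? v with u Fin.≟ v | O.total u v
    ... | yes u≡v | _        = no λ p → proj₂ p u≡v
    ... | no  u≢v | inj₁ u⊑v = yes (u⊑v , u≢v)
    ... | no  u≢v | inj₂ v⊑u = no λ p → u≢v (O.antisym (proj₁ p) v⊑u)

    below : Fin n → Fin n → Bool
    below v u = does (u ⊏? v)

    ⊏-trans : ∀ {u v x} → u ⊏ v → v ⊏ x → u ⊏ x
    ⊏-trans (u⊑v , u≢v) (v⊑x , v≢x) =
      O.trans u⊑v v⊑x , λ { refl → u≢v (O.antisym u⊑v v⊑x) }

  rank : Fin n → Fin n
  rank v = Fin.fromℕ< (count<n (below v) v (λ p → proj₂ (does⁻ (v ⊏? v) p) refl))

  private
    toℕ-rank : ∀ v → toℕ (rank v) ≡ count (below v)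
    toℕ-rank v = Fin.toℕ-fromℕ< _

    rank-mono : ∀ {u v} → u ⊏ v → toℕ (rank u) < toℕ (rank v)
    rank-mono {u} {v} u⊏v = subst₂ _<_ (sym (toℕ-rank u)) (sym (toℕ-rank v))
      (count-strict (λ i p → does⁺ (i ⊏? v) (⊏-trans (does⁻ (i ⊏? u) p) u⊏v))
        u (λ p → proj₂ (does⁻ (u ⊏? u) p) refl) (does⁺ (u ⊏? v) u⊏v))

    rank-reflects : ∀ {u v} → toℕ (rank u) ≤ toℕ (rank v) → u ⊑ v
    rank-reflects {u} {v} p with u Fin.≟ v | O.total u v
    ... | _        | inj₁ u⊑v = u⊑v
    ... | yes refl | inj₂ v⊑u = v⊑u
    ... | no u≢v   | inj₂ v⊑u = contradiction (rank-mono (v⊑u , u≢v ∘ sym)) (ℕ.≤⇒≯ p)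

    rank-mono-≤ : ∀ {u v} → u ⊑ v → toℕ (rank u) ≤ toℕ (rank v)
    rank-mono-≤ {u} {v} u⊑v with u Fin.≟ v
    ... | yes refl = ℕ.≤-refl
    ... | no  u≢v  = ℕ.<⇒≤ (rank-mono (u⊑v , u≢v))

    rank-injective : ∀ {u v} → rank u ≡ rank v → u ≡ v
    rank-injective e = O.antisym (rank-reflects (ℕ.≤-reflexive (cong toℕ e)))
                                 (rank-reflects (ℕ.≤-reflexive (cong toℕ (sym e))))

  unrank : Fin n → Fin n
  unrank y = proj₁ (injective⇒surjective rank rank-injective y)

  rank-unrank : ∀ y → rank (unrank y) ≡ y
  rank-unrank y = proj₂ (injective⇒surjective rank rank-injective y)

  unrank-rank : ∀ v → unrank (rank v) ≡ v
  unrank-rank v = rank-injective (rank-unrank (rank v))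

  -- Ranks fill `Fin n` without gaps. Were the ranks of `u` and `v` more than 1 apart, the node `x`
  -- of the rank following that of `u` would lie strictly between them.
  covers⇒step : ∀ {u v} → Covers _⊑_ u v → Step (rank u) (rank v)
  covers⇒step {u} {v} (u⊑v , u≢v , between) with ℕ.m≤n⇒m<n∨m≡n (rank-mono (u⊑v , u≢v))
  ... | inj₂ e = sym e
  ... | inj₁ l = ⊥-elim ([ (λ e → ℕ.1+n≢n (trans (sym toℕ-x) (cong (toℕ ∘ rank) e))) , (λ e → ℕ.<-irrefl (trans (sym toℕ-x) (cong (toℕ ∘ rank) e)) l) ]
                   (between x (rank-reflects (subst (toℕ (rank u) ≤_) (sym toℕ-x) (ℕ.n≤1+n _)))
                              (rank-reflects (subst (_≤ toℕ (rank v)) (sym toℕ-x) (ℕ.<⇒≤ l)))))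
    where
    1+u<n = ℕ.<-trans l (Fin.toℕ<n (rank v))
    x = unrank (Fin.fromℕ< 1+u<n)
    toℕ-x : toℕ (rank x) ≡ suc (toℕ (rank u))
    toℕ-x = trans (cong toℕ (rank-unrank _)) (Fin.toℕ-fromℕ< 1+u<n)

  step⇒covers : ∀ {u v} → Step (rank u) (rank v) → Covers _⊑_ u v
  step⇒covers {u} {v} e =
    rank-reflects (subst (toℕ (rank u) ≤_) (sym e) (ℕ.n≤1+n _)) ,
    (λ { refl → ℕ.1+n≢n (sym e) }) ,
    λ x u⊑x x⊑v → [ (λ l → inj₂ (rank-injective (Fin.toℕ-injective
                              (ℕ.≤-antisym (rank-mono-≤ x⊑v) (subst (_≤ toℕ (rank x)) (sym e) l)))))
                  , (λ q → inj₁ (sym (rank-injective (Fin.toℕ-injective q)))) ]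
                  (ℕ.m≤n⇒m<n∨m≡n (rank-mono-≤ u⊑x))

predecessor : ∀ {n} {j k : Fin n} → j Fin.< k → ∃ λ k′ → Step k′ k × j Fin.≤ k′
predecessor {k = suc k} (s≤s j≤k) =
  inject₁ k , cong suc (sym (Fin.toℕ-inject₁ k)) , ℕ.≤-trans j≤k (ℕ.≤-reflexive (sym (Fin.toℕ-inject₁ k)))

step⇒< : ∀ {n} {u v : Fin n} → Step u v → u Fin.< v
step⇒< e = ℕ.≤-reflexive (sym e)

upward-induction : ∀ {n} {j : Fin n} (C : Fin n → Set) → C j →
                   (∀ {u v} → Step u v → j Fin.≤ u → C u → C v) → ∀ {k} → j Fin.≤ k → C k
upward-induction {j = j} C base step {k} j≤k = go (toℕ k) ℕ.≤-refl j≤k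
  where
  go : ∀ m {k} → toℕ k ≤ m → j Fin.≤ k → C k
  go m {k} k≤m j≤k with ℕ.m≤n⇒m<n∨m≡n j≤k
  ... | inj₂ j≡k = subst C (Fin.toℕ-injective j≡k) base
  go zero    k≤0 j≤k | inj₁ j<k = contradiction (ℕ.<-≤-trans j<k k≤0) ℕ.n≮0
  go (suc m) {k} k≤m j≤k | inj₁ j<k with predecessor {k = k} j<k
  ... | k′ , s , j≤k′ = step s j≤k′ (go m (ℕ.≤-pred (subst (_≤ suc m) s k≤m)) j≤k′)

-- Inequalities between Bishop reals

ι : ℕ → ℚ
ι k = ℤ.+ k ℚ./ 1

fraction : ∀ k d → ℚ.toℚᵘ (ℤ.+ k ℚ./ suc d) ℚᵘ.≃ mkℚᵘ (ℤ.+ k) d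
fraction k d = ℚ.toℚᵘ-fromℚᵘ (mkℚᵘ (ℤ.+ k) d)

ι-+ : ∀ a b → ι (a + b) ≡ ι a ℚ.+ ι b
ι-+ a b = ℚ.toℚᵘ-injective (begin-equality
  ℚ.toℚᵘ (ι (a + b))                  ≃⟨ fraction (a + b) 0 ⟩
  mkℚᵘ (ℤ.+ (a + b)) 0                  ≃⟨ *≡* (regroup (ℤ.+ a) (ℤ.+ b)) ⟩
  mkℚᵘ (ℤ.+ a) 0 ℚᵘ.+ mkℚᵘ (ℤ.+ b) 0      ≃⟨ ℚᵘ.+-cong (fraction a 0) (fraction b 0) ⟨
  ℚ.toℚᵘ (ι a) ℚᵘ.+ ℚ.toℚᵘ (ι b)      ≃⟨ ℚ.toℚᵘ-homo-+ (ι a) (ι b) ⟨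
  ℚ.toℚᵘ (ι a ℚ.+ ι b)                ∎)
  where
  open ℚᵘ.≤-Reasoning
  regroup : ∀ i j → (i ℤ.+ j) ℤ.* ℤ.+ 1 ≡ (i ℤ.* ℤ.+ 1 ℤ.+ j ℤ.* ℤ.+ 1) ℤ.* ℤ.+ 1
  regroup = ℤ-RingSolver.solve-∀

ι-* : ∀ a b → ι (a * b) ≡ ι a ℚ.* ι b
ι-* a b = ℚ.toℚᵘ-injective (begin-equality
  ℚ.toℚᵘ (ι (a * b))                  ≃⟨ fraction (a * b) 0 ⟩
  mkℚᵘ (ℤ.+ (a * b)) 0                  ≃⟨ *≡* (cong (ℤ._* ℤ.+ 1) (ℤ.pos-* a b)) ⟩
  mkℚᵘ (ℤ.+ a) 0 ℚᵘ.* mkℚᵘ (ℤ.+ b) 0      ≃⟨ ℚᵘ.*-cong (fraction a 0) (fraction b 0) ⟨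
  ℚ.toℚᵘ (ι a) ℚᵘ.* ℚ.toℚᵘ (ι b)      ≃⟨ ℚ.toℚᵘ-homo-* (ι a) (ι b) ⟨
  ℚ.toℚᵘ (ι a ℚ.* ι b)                ∎)
  where open ℚᵘ.≤-Reasoning

ι-1/1+ : ∀ n → ι (suc n) ℚ.* 1/1+ n ≡ 1ℚ
ι-1/1+ n = ℚ.toℚᵘ-injective (begin-equality
  ℚ.toℚᵘ (ι (suc n) ℚ.* 1/1+ n)              ≃⟨ ℚ.toℚᵘ-homo-* (ι (suc n)) (1/1+ n) ⟩
  ℚ.toℚᵘ (ι (suc n)) ℚᵘ.* ℚ.toℚᵘ (1/1+ n)    ≃⟨ ℚᵘ.*-cong (fraction (suc n) 0) (fraction 1 n) ⟩
  mkℚᵘ (ℤ.+ suc n) 0 ℚᵘ.* mkℚᵘ (ℤ.+ 1) n         ≃⟨ *≡* (cong ℤ.+_ (regroup n)) ⟩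
  ℚ.toℚᵘ 1ℚ                                  ∎)
  where
  open ℚᵘ.≤-Reasoning
  regroup : ∀ n → (1 + n) * 1 * 1 ≡ 1 * (1 * (1 + n))
  regroup = solve-∀

2/1+≡ : ∀ n → 2/1+ n ≡ 1/1+ n ℚ.+ 1/1+ n
2/1+≡ n = ℚ.toℚᵘ-injective (begin-equality
  ℚ.toℚᵘ (2/1+ n)                            ≃⟨ fraction 2 n ⟩
  mkℚᵘ (ℤ.+ 2) n                               ≃⟨ *≡* (cong ℤ.+_ (regroup n)) ⟩
  mkℚᵘ (ℤ.+ 1) n ℚᵘ.+ mkℚᵘ (ℤ.+ 1) n             ≃⟨ ℚᵘ.+-cong (fraction 1 n) (fraction 1 n) ⟨
  ℚ.toℚᵘ (1/1+ n) ℚᵘ.+ ℚ.toℚᵘ (1/1+ n)       ≃⟨ ℚ.toℚᵘ-homo-+ (1/1+ n) (1/1+ n) ⟨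
  ℚ.toℚᵘ (1/1+ n ℚ.+ 1/1+ n)                 ∎)
  where
  open ℚᵘ.≤-Reasoning
  regroup : ∀ n → 2 * ((1 + n) * (1 + n)) ≡ (1 * (1 + n) + 1 * (1 + n)) * (1 + n)
  regroup = solve-∀

ι-mono-≤ : ∀ {a b} → a ≤ b → ι a ℚ.≤ ι b
ι-mono-≤ {a} {b} a≤b = ℚ.toℚᵘ-cancel-≤
  (ℚᵘ.≤-respˡ-≃ (ℚᵘ.≃-sym (fraction a 0)) (ℚᵘ.≤-respʳ-≃ (ℚᵘ.≃-sym (fraction b 0))
    (*≤* (ℤ.*-monoʳ-≤-nonNeg (ℤ.+ 1) (ℤ.+≤+ a≤b)))))

ι-mono-< : ∀ {a b} → a < b → ι a ℚ.< ι b
ι-mono-< {a} {b} a<b = ℚ.toℚᵘ-cancel-<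
  (ℚᵘ.<-respˡ-≃ (ℚᵘ.≃-sym (fraction a 0)) (ℚᵘ.<-respʳ-≃ (ℚᵘ.≃-sym (fraction b 0))
    (*<* (ℤ.*-monoʳ-<-pos (ℤ.+ 1) (ℤ.+<+ a<b)))))

-- A denominator is at least 1, so the absolute value of the numerator already bounds `p`.
ι-unbounded : ∀ p → ∃ λ n → p ℚ.< ι (suc n)
ι-unbounded p@record{} = n , ℚ.toℚᵘ-cancel-< (ℚᵘ.<-respʳ-≃ (ℚᵘ.≃-sym (fraction (suc n) 0)) (*<* (begin-strict
  ℚ.↥ p ℤ.* ℤ.+ 1          ≡⟨ ℤ.*-identityʳ (ℚ.↥ p) ⟩
  ℚ.↥ p                  ≤⟨ ≤∣∣ (ℚ.↥ p) ⟩
  ℤ.+ n                    <⟨ ℤ.+<+ ℕ.≤-refl ⟩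
  ℤ.+ suc n                ≡⟨ ℤ.*-identityʳ (ℤ.+ suc n) ⟨
  ℤ.+ suc n ℤ.* ℤ.+ 1        ≤⟨ ℤ.*-monoˡ-≤-nonNeg (ℤ.+ suc n) (ℤ.+≤+ (s≤s z≤n)) ⟩
  ℤ.+ suc n ℤ.* ℚ.↧ p      ∎)))
  where
  open ℤ.≤-Reasoning
  n = ℤ.∣ ℚ.↥ p ∣
  ≤∣∣ : ∀ i → i ℤ.≤ ℤ.+ ℤ.∣ i ∣
  ≤∣∣ (ℤ.+ n)        = ℤ.≤-refl
  ≤∣∣ (ℤ.-[1+ n ]) = ℤ.-≤+

1/1+-positive : ∀ n → ℚ.Positive (1/1+ n)
1/1+-positive n = ℚ.normalize-pos 1 (suc n)

1/1+-nonNeg : ∀ n → 0ℚ ℚ.≤ 1/1+ n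
1/1+-nonNeg n = ℚ.<⇒≤ (ℚ.positive⁻¹ (1/1+ n) {{1/1+-positive n}})

-- Take n+1 above c/δ and multiply by the positive number δ/(n+1).
archimedean : ∀ c δ → 0ℚ ℚ.< δ → ∃ λ n → c ℚ.* 1/1+ n ℚ.< δ
archimedean c δ 0<δ = n , (begin-strict
  c ℚ.* 1/1+ n                          ≡⟨ cong (ℚ._* 1/1+ n) (trans (cong (c ℚ.*_) (ℚ.*-inverseˡ δ {{δ-nonZero}})) (ℚ.*-identityʳ c)) ⟨
  c ℚ.* (ℚ.1/ δ ℚ.* δ) ℚ.* 1/1+ n       ≡⟨ cong (ℚ._* 1/1+ n) (ℚ.*-assoc c (ℚ.1/ δ) δ) ⟨
  c ℚ.* ℚ.1/ δ ℚ.* δ ℚ.* 1/1+ n         <⟨ ℚ.*-monoˡ-<-pos (1/1+ n) {{1/1+-positive n}} (ℚ.*-monoˡ-<-pos δ c/δ<n) ⟩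
  ι (suc n) ℚ.* δ ℚ.* 1/1+ n
    ≡⟨ solve 3 (λ a b c → (a :* b) :* c := (a :* c) :* b) refl (ι (suc n)) δ (1/1+ n) ⟩
  ι (suc n) ℚ.* 1/1+ n ℚ.* δ            ≡⟨ cong (ℚ._* δ) (ι-1/1+ n) ⟩
  1ℚ ℚ.* δ                              ≡⟨ ℚ.*-identityˡ δ ⟩
  δ                                     ∎)
  where
  open ℚ.≤-Reasoning
  open ℚ-Solver.+-*-Solver
  instance
    δ-positive : ℚ.Positive δ
    δ-positive = ℚ.positive 0<δ
    δ-nonZero : ℚ.NonZero δ
    δ-nonZero = ℚ.pos⇒nonZero δ
  n     = proj₁ (ι-unbounded (c ℚ.* ℚ.1/ δ))
  c/δ<n = proj₂ (ι-unbounded (c ℚ.* ℚ.1/ δ))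

-≤⇒≤+ : ∀ {p q s} → p ℚ.- q ℚ.≤ s → p ℚ.≤ q ℚ.+ s
-≤⇒≤+ {p} {q} {s} h = subst₂ ℚ._≤_ (solve 2 (λ p q → (p :- q) :+ q := p) refl p q) (ℚ.+-comm s q) (ℚ.+-monoˡ-≤ q h)
  where open ℚ-Solver.+-*-Solver

≤∣_∣ : ∀ p → p ℚ.≤ ℚ.∣ p ∣
≤∣ p ∣ with ℚ.∣p∣≡p∨∣p∣≡-p p
... | inj₁ e = ℚ.≤-reflexive (sym e)
... | inj₂ e = ℚ.≤-trans (subst₂ ℚ._≤_ (solve 1 (λ p → :- (:- p) := p) refl p) refl (ℚ.neg-antimono-≤ (subst (0ℚ ℚ.≤_) e (ℚ.0≤∣p∣ p)))) (ℚ.0≤∣p∣ p)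
  where open ℚ-Solver.+-*-Solver

∣-∣-swap : ∀ p q → ℚ.∣ p ℚ.- q ∣ ≡ ℚ.∣ q ℚ.- p ∣
∣-∣-swap p q = trans (sym (ℚ.∣-p∣≡∣p∣ (p ℚ.- q))) (cong ℚ.∣_∣ (solve 2 (λ p q → :- (p :- q) := q :- p) refl p q))
  where open ℚ-Solver.+-*-Solver

-- Sequences of rationals up to an error O(1/n): on regular sequences this is
-- Bishop's order, but here it composes without renormalising the error.
infix 4 _≼_ _≺_

record _≼_ (X Y : ℕ → ℚ) : Set where
  constructor within
  field
    error : ℚ
    bound : ∀ n → X n ℚ.≤ Y n ℚ.+ error ℚ.* 1/1+ n

record _≺_ (X Y : ℕ → ℚ) : Set where
  constructor by
  field
    gap      : ℚ
    positive : 0ℚ ℚ.< gap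
    below    : (λ n → X n ℚ.+ gap) ≼ Y

module Algebra where
  open ℚ-Solver.+-*-Solver

  no-error : ∀ y e → y ≡ y ℚ.+ 0ℚ ℚ.* e
  no-error = solve 2 (λ y e → y := y :+ con 0ℚ :* e) refl

  add-errors : ∀ z c d e → (z ℚ.+ d ℚ.* e) ℚ.+ c ℚ.* e ≡ z ℚ.+ (d ℚ.+ c) ℚ.* e
  add-errors = solve 4 (λ z c d e → (z :+ d :* e) :+ c :* e := z :+ (d :+ c) :* e) refl

  exchange : ∀ a b c → (a ℚ.+ b) ℚ.+ c ≡ (a ℚ.+ c) ℚ.+ b
  exchange = solve 3 (λ a b c → (a :+ b) :+ c := (a :+ c) :+ b) refl

  cancel : ∀ x d → (x ℚ.+ d) ℚ.- x ≡ d
  cancel = solve 2 (λ x d → (x :+ d) :- x := d) refl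

  double : ∀ e → e ℚ.+ e ≡ (1ℚ ℚ.+ 1ℚ) ℚ.* e
  double = solve 1 (λ e → e :+ e := (con 1ℚ :+ con 1ℚ) :* e) refl

  start-gap : ∀ x y e f → (x ℚ.+ (e ℚ.+ f)) ℚ.+ (y ℚ.- x ℚ.- (f ℚ.+ f)) ≡ y ℚ.+ (e ℚ.- f)
  start-gap = solve 4 (λ x y e f → (x :+ (e :+ f)) :+ ((y :- x) :- (f :+ f)) := y :+ (e :- f)) refl

  end-gap : ∀ y e f → (y ℚ.+ (f ℚ.+ e)) ℚ.+ (e ℚ.- f) ≡ y ℚ.+ (1ℚ ℚ.+ 1ℚ) ℚ.* e
  end-gap = solve 3 (λ y e f → (y :+ (f :+ e)) :+ (e :- f) := y :+ (con 1ℚ :+ con 1ℚ) :* e) refl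

open Algebra public

add-right : ∀ p q s → p ℚ.≤ q → p ℚ.+ s ℚ.≤ q ℚ.+ s
add-right p q s = ℚ.+-monoˡ-≤ s

≤⇒≼ : ∀ {X Y} → (∀ n → X n ℚ.≤ Y n) → X ≼ Y
≤⇒≼ {X} {Y} h = within 0ℚ λ n → subst (X n ℚ.≤_) (no-error (Y n) (1/1+ n)) (h n)

≡⇒≼ : ∀ {X Y} → X ≗ Y → X ≼ Y
≡⇒≼ {X} {Y} h = ≤⇒≼ {X} {Y} (λ n → ℚ.≤-reflexive (h n))

≼-trans : ∀ {X Y Z} → X ≼ Y → Y ≼ Z → X ≼ Z
≼-trans {X} {Y} {Z} (within c h) (within d k) = within (d ℚ.+ c) λ n → begin
  X n                                       ≤⟨ h n ⟩
  Y n ℚ.+ c ℚ.* 1/1+ n                      ≤⟨ add-right (Y n) (Z n ℚ.+ d ℚ.* 1/1+ n) (c ℚ.* 1/1+ n) (k n) ⟩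
  Z n ℚ.+ d ℚ.* 1/1+ n ℚ.+ c ℚ.* 1/1+ n     ≡⟨ add-errors (Z n) c d (1/1+ n) ⟩
  Z n ℚ.+ (d ℚ.+ c) ℚ.* 1/1+ n              ∎
  where open ℚ.≤-Reasoning

≼-shift : ∀ {X Y} (Z : ℕ → ℚ) → X ≼ Y → (λ n → X n ℚ.+ Z n) ≼ (λ n → Y n ℚ.+ Z n)
≼-shift {X} {Y} Z (within c h) = within c λ n → begin
  X n ℚ.+ Z n                               ≤⟨ add-right (X n) (Y n ℚ.+ c ℚ.* 1/1+ n) (Z n) (h n) ⟩
  Y n ℚ.+ c ℚ.* 1/1+ n ℚ.+ Z n              ≡⟨ exchange (Y n) (c ℚ.* 1/1+ n) (Z n) ⟩
  Y n ℚ.+ Z n ℚ.+ c ℚ.* 1/1+ n              ∎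
  where open ℚ.≤-Reasoning

≺-≼-trans : ∀ {X Y Z} → X ≺ Y → Y ≼ Z → X ≺ Z
≺-≼-trans {X} {Y} {Z} (by δ 0<δ h) k = by δ 0<δ (≼-trans {λ n → X n ℚ.+ δ} {Y} {Z} h k)

≼-≺-trans : ∀ {X Y Z} → X ≼ Y → Y ≺ Z → X ≺ Z
≼-≺-trans {X} {Y} {Z} h (by δ 0<δ k) =
  by δ 0<δ (≼-trans {λ n → X n ℚ.+ δ} {λ n → Y n ℚ.+ δ} {Z} (≼-shift {X} {Y} (λ _ → δ) h) k)

≺⇒≼ : ∀ {X Y} → X ≺ Y → X ≼ Y
≺⇒≼ {X} {Y} (by δ 0<δ h) = ≼-trans {X} {λ n → X n ℚ.+ δ} {Y}
  (≤⇒≼ {X} {λ n → X n ℚ.+ δ} (λ n → subst (ℚ._≤ X n ℚ.+ δ) (ℚ.+-identityʳ (X n)) (ℚ.+-monoʳ-≤ (X n) {0ℚ} {δ} (ℚ.<⇒≤ 0<δ)))) h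

≺-shift : ∀ {X Y} (Z : ℕ → ℚ) → X ≺ Y → (λ n → X n ℚ.+ Z n) ≺ (λ n → Y n ℚ.+ Z n)
≺-shift {X} {Y} Z (by δ 0<δ h) = by δ 0<δ
  (≼-trans {λ n → X n ℚ.+ Z n ℚ.+ δ} {λ n → X n ℚ.+ δ ℚ.+ Z n} {λ n → Y n ℚ.+ Z n}
    (≡⇒≼ {λ n → X n ℚ.+ Z n ℚ.+ δ} {λ n → X n ℚ.+ δ ℚ.+ Z n} (λ n → exchange (X n) (Z n) δ))
    (≼-shift {λ n → X n ℚ.+ δ} {Y} Z h))

-- A fixed gap would lie below an error c/(n+1) for every n. Every contradiction about timestamps
-- and their integer parts in the completeness proof is brought to this form.
≺-irrefl : ∀ {X} → ¬ X ≺ X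
≺-irrefl {X} (by δ 0<δ (within c h)) =
  let n , c/n<δ = archimedean c δ 0<δ
  in ℚ.<-irrefl {δ} {δ} refl (ℚ.≤-<-trans {δ} {c ℚ.* 1/1+ n} {δ}
       (subst₂ ℚ._≤_ (cancel (X n) δ) (cancel (X n) (c ℚ.* 1/1+ n))
         (add-right (X n ℚ.+ δ) (X n ℚ.+ c ℚ.* 1/1+ n) (ℚ.- X n) (h n)))
       c/n<δ)

≤ᴿ⇒≼ : ∀ x y → x ≤ᴿ y → seq x ≼ seq y
≤ᴿ⇒≼ x y h = within (1ℚ ℚ.+ 1ℚ) λ n →
  subst (λ z → seq x n ℚ.≤ seq y n ℚ.+ z) (trans (2/1+≡ n) (double (1/1+ n))) (-≤⇒≤+ {seq x n} {seq y n} {2/1+ n} (h n))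

regular-≤ : ∀ x m n → seq x m ℚ.≤ seq x n ℚ.+ (1/1+ m ℚ.+ 1/1+ n)
regular-≤ x m n = -≤⇒≤+ {seq x m} {seq x n} {1/1+ m ℚ.+ 1/1+ n}
  (ℚ.≤-trans {seq x m ℚ.- seq x n} (≤∣ seq x m ℚ.- seq x n ∣) (regular x m n))

<ᴿ⇒≺ : ∀ x y → x <ᴿ y → seq x ≺ seq y
<ᴿ⇒≺ x y (n , h) = by δ 0<δ (within (1ℚ ℚ.+ 1ℚ) λ m → begin
  seq x m ℚ.+ δ
    ≤⟨ add-right (seq x m) (seq x n ℚ.+ (1/1+ m ℚ.+ 1/1+ n)) δ (regular-≤ x m n) ⟩
  seq x n ℚ.+ (1/1+ m ℚ.+ 1/1+ n) ℚ.+ δ                     ≡⟨ start-gap (seq x n) (seq y n) (1/1+ m) (1/1+ n) ⟩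
  seq y n ℚ.+ (1/1+ m ℚ.- 1/1+ n)
    ≤⟨ add-right (seq y n) (seq y m ℚ.+ (1/1+ n ℚ.+ 1/1+ m)) (1/1+ m ℚ.- 1/1+ n) (regular-≤ y n m) ⟩
  seq y m ℚ.+ (1/1+ n ℚ.+ 1/1+ m) ℚ.+ (1/1+ m ℚ.- 1/1+ n)   ≡⟨ end-gap (seq y m) (1/1+ m) (1/1+ n) ⟩
  seq y m ℚ.+ (1ℚ ℚ.+ 1ℚ) ℚ.* 1/1+ m                        ∎)
  where
  open ℚ.≤-Reasoning
  d = seq y n ℚ.- seq x n
  -- Passing from index n to m costs 1/(m+1) + 1/(n+1) for each of `x` and `y`. The parts 1/(n+1)
  -- are deducted from the gap here, and the parts 1/(m+1) become the error.
  δ = d ℚ.- (1/1+ n ℚ.+ 1/1+ n)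
  0<δ : 0ℚ ℚ.< δ
  0<δ = subst (λ z → 0ℚ ℚ.< d ℚ.- z) (2/1+≡ n)
    (subst (ℚ._< d ℚ.- 2/1+ n) (ℚ.+-inverseʳ (2/1+ n)) (ℚ.+-monoˡ-< (ℚ.- 2/1+ n) {2/1+ n} {d} h))

1/1+-dbl-≤ : ∀ n → 1/1+ (dbl n) ℚ.≤ 1/1+ n
1/1+-dbl-≤ n = subst₂ ℚ._≤_ (ℚ.+-identityʳ (1/1+ (dbl n))) (1/1+-dbl n)
  (ℚ.+-monoʳ-≤ (1/1+ (dbl n)) {0ℚ} {1/1+ (dbl n)} (1/1+-nonNeg (dbl n)))

dbl-≤ : ∀ x n → seq x (dbl n) ℚ.≤ seq x n ℚ.+ (1/1+ n ℚ.+ 1/1+ n)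
dbl-≤ x n = ℚ.≤-trans {seq x (dbl n)} {seq x n ℚ.+ (1/1+ (dbl n) ℚ.+ 1/1+ n)} (regular-≤ x (dbl n) n)
  (ℚ.+-monoʳ-≤ (seq x n) {1/1+ (dbl n) ℚ.+ 1/1+ n} {1/1+ n ℚ.+ 1/1+ n}
    (ℚ.+-monoˡ-≤ (1/1+ n) {1/1+ (dbl n)} {1/1+ n} (1/1+-dbl-≤ n)))

≤-dbl : ∀ x n → seq x n ℚ.≤ seq x (dbl n) ℚ.+ (1/1+ n ℚ.+ 1/1+ n)
≤-dbl x n = ℚ.≤-trans {seq x n} {seq x (dbl n) ℚ.+ (1/1+ n ℚ.+ 1/1+ (dbl n))} (regular-≤ x n (dbl n))
  (ℚ.+-monoʳ-≤ (seq x (dbl n)) {1/1+ n ℚ.+ 1/1+ (dbl n)} {1/1+ n ℚ.+ 1/1+ n}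
    (ℚ.+-monoʳ-≤ (1/1+ n) {1/1+ (dbl n)} {1/1+ n} (1/1+-dbl-≤ n)))

difference-≤ : ∀ a a′ b b′ e → a ℚ.≤ a′ ℚ.+ (e ℚ.+ e) → b′ ℚ.≤ b ℚ.+ (e ℚ.+ e) →
               a ℚ.- b ℚ.≤ a′ ℚ.- b′ ℚ.+ (1ℚ ℚ.+ 1ℚ ℚ.+ (1ℚ ℚ.+ 1ℚ)) ℚ.* e
difference-≤ a a′ b b′ e h k = subst₂ ℚ._≤_
  (solve 3 (λ a b b′ → (a :+ b′) :+ (:- b :- b′) := a :- b) refl a b b′)
  (solve 4 (λ a′ b b′ e → ((a′ :+ (e :+ e)) :+ (b :+ (e :+ e))) :+ (:- b :- b′) :=
                          (a′ :- b′) :+ ((con 1ℚ :+ con 1ℚ) :+ (con 1ℚ :+ con 1ℚ)) :* e) refl a′ b b′ e)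
  (add-right (a ℚ.+ b′) (a′ ℚ.+ (e ℚ.+ e) ℚ.+ (b ℚ.+ (e ℚ.+ e))) (ℚ.- b ℚ.- b′)
    (ℚ.+-mono-≤ {a} {a′ ℚ.+ (e ℚ.+ e)} {b′} {b ℚ.+ (e ℚ.+ e)} h k))
  where open ℚ-Solver.+-*-Solver

_⊖_ : ℝ → ℝ → ℕ → ℚ
(x ⊖ y) n = seq x n ℚ.- seq y n

-- Subtraction samples at `dbl n`, which moves each operand by at most 2/(n+1); hence the error
-- constant 4.
-ᴿ-≼ : ∀ x y → seq (x -ᴿ y) ≼ (x ⊖ y)
-ᴿ-≼ x y = within (1ℚ ℚ.+ 1ℚ ℚ.+ (1ℚ ℚ.+ 1ℚ)) λ n →
  difference-≤ (seq x (dbl n)) (seq x n) (seq y (dbl n)) (seq y n) (1/1+ n) (dbl-≤ x n) (≤-dbl y n)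

≼--ᴿ : ∀ x y → (x ⊖ y) ≼ seq (x -ᴿ y)
≼--ᴿ x y = within (1ℚ ℚ.+ 1ℚ ℚ.+ (1ℚ ℚ.+ 1ℚ)) λ n →
  difference-≤ (seq x n) (seq x (dbl n)) (seq y n) (seq y (dbl n)) (1/1+ n) (≤-dbl x n) (dbl-≤ y n)

≤-everywhere⇒≤ᴿ : ∀ x y → (∀ n → seq x n ℚ.≤ seq y n) → x ≤ᴿ y
≤-everywhere⇒≤ᴿ x y h n = begin
  seq x n ℚ.- seq y n        ≤⟨ add-right (seq x n) (seq y n) (ℚ.- seq y n) (h n) ⟩
  seq y n ℚ.- seq y n        ≡⟨ ℚ.+-inverseʳ (seq y n) ⟩
  0ℚ                         ≤⟨ ℚ.nonNegative⁻¹ (2/1+ n) {{ℚ.normalize-nonNeg 2 (suc n)}} ⟩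
  2/1+ n                     ∎
  where open ℚ.≤-Reasoning

constant-<⇒<ᴿ : ∀ x y {p q} → (∀ n → seq x n ≡ p) → (∀ n → seq y n ≡ q) → p ℚ.< q → x <ᴿ y
constant-<⇒<ᴿ x y {p} {q} x≡p y≡q p<q =
  let n , h = archimedean (1ℚ ℚ.+ 1ℚ) (q ℚ.- p) (subst (ℚ._< q ℚ.- p) (ℚ.+-inverseʳ p) (ℚ.+-monoˡ-< (ℚ.- p) {p} {q} p<q))
  in n , subst₂ ℚ._<_ (sym (trans (2/1+≡ n) (double (1/1+ n)))) (sym (cong₂ ℚ._-_ (y≡q n) (x≡p n))) h

-- The timestamps of the soundness proof. With the common denominator d+1 a whole number β becomes
-- `β * suc d`, and all comparisons reduce to natural numbers.
fractionᴿ : ℕ → ℕ → ℝ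
seq (fractionᴿ d a) _ = ι a ℚ.* 1/1+ d
regular (fractionᴿ d a) m n = begin
  ℚ.∣ q ℚ.- q ∣       ≡⟨ cong ℚ.∣_∣ (ℚ.+-inverseʳ q) ⟩
  0ℚ ℚ.+ 0ℚ           ≤⟨ ℚ.+-mono-≤ {0ℚ} {1/1+ m} {0ℚ} {1/1+ n} (1/1+-nonNeg m) (1/1+-nonNeg n) ⟩
  1/1+ m ℚ.+ 1/1+ n   ∎
  where
  open ℚ.≤-Reasoning
  q = ι a ℚ.* 1/1+ d

fraction-mono-≤ : ∀ d {a b} → a ≤ b → ι a ℚ.* 1/1+ d ℚ.≤ ι b ℚ.* 1/1+ d
fraction-mono-≤ d {a} {b} a≤b = ℚ.*-monoʳ-≤-nonNeg (1/1+ d) {{ℚ.pos⇒nonNeg (1/1+ d) {{1/1+-positive d}}}} {ι a} {ι b} (ι-mono-≤ a≤b)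

fraction-mono-< : ∀ d {a b} → a < b → ι a ℚ.* 1/1+ d ℚ.< ι b ℚ.* 1/1+ d
fraction-mono-< d {a} {b} a<b = ℚ.*-monoˡ-<-pos (1/1+ d) {{1/1+-positive d}} {ι a} {ι b} (ι-mono-< a<b)

fractionᴿ-mono : ∀ d {a b} → a ≤ b → fractionᴿ d a ≤ᴿ fractionᴿ d b
fractionᴿ-mono d {a} {b} a≤b = ≤-everywhere⇒≤ᴿ (fractionᴿ d a) (fractionᴿ d b) (λ _ → fraction-mono-≤ d a≤b)

fractionᴿ-nonNeg : ∀ d a → fromℕᴿ 0 ≤ᴿ fractionᴿ d a
fractionᴿ-nonNeg d a = ≤-everywhere⇒≤ᴿ (fromℕᴿ 0) (fractionᴿ d a)
  (λ _ → subst (ℚ._≤ ι a ℚ.* 1/1+ d) (ℚ.*-zeroˡ (1/1+ d)) (fraction-mono-≤ d {0} {a} z≤n))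

private
  add-whole : ∀ d b β → ι (b + β * suc d) ℚ.* 1/1+ d ≡ ι b ℚ.* 1/1+ d ℚ.+ ι β
  add-whole d b β = begin
    ι (b + β * suc d) ℚ.* 1/1+ d
      ≡⟨ cong (ℚ._* 1/1+ d) (trans (ι-+ b (β * suc d)) (cong (ι b ℚ.+_) (ι-* β (suc d)))) ⟩
    (ι b ℚ.+ ι β ℚ.* ι (suc d)) ℚ.* 1/1+ d
      ≡⟨ solve 4 (λ b β s e → (b :+ β :* s) :* e := b :* e :+ β :* (s :* e)) refl (ι b) (ι β) (ι (suc d)) (1/1+ d) ⟩
    ι b ℚ.* 1/1+ d ℚ.+ ι β ℚ.* (ι (suc d) ℚ.* 1/1+ d)       ≡⟨ cong (λ z → ι b ℚ.* 1/1+ d ℚ.+ ι β ℚ.* z) (ι-1/1+ d) ⟩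
    ι b ℚ.* 1/1+ d ℚ.+ ι β ℚ.* 1ℚ                           ≡⟨ cong (ι b ℚ.* 1/1+ d ℚ.+_) (ℚ.*-identityʳ (ι β)) ⟩
    ι b ℚ.* 1/1+ d ℚ.+ ι β                                  ∎
    where
    open ≡-Reasoning
    open ℚ-Solver.+-*-Solver

  cancel-add : ∀ p β → (p ℚ.+ β) ℚ.- p ≡ β
  cancel-add = solve 2 (λ p β → (p :+ β) :- p := β) refl
    where open ℚ-Solver.+-*-Solver

  whole-difference : ∀ d b β → ι (b + β * suc d) ℚ.* 1/1+ d ℚ.- ι b ℚ.* 1/1+ d ≡ ι β
  whole-difference d b β = trans (cong (ℚ._- ι b ℚ.* 1/1+ d) (add-whole d b β)) (cancel-add (ι b ℚ.* 1/1+ d) (ι β))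

-- x ⋈ β is a conjunction of bounds from above or below, each strict or not.
data Half : Set where
  upper lower : (strict : Bool) → Half

_∈ʰ_ : Half → Cmp → Bool
upper s ∈ʰ ≤′ = not s
upper s ∈ʰ <′ = s
upper s ∈ʰ =′ = not s
upper s ∈ʰ >′ = false
upper s ∈ʰ ≥′ = false
lower s ∈ʰ ≤′ = false
lower s ∈ʰ <′ = false
lower s ∈ʰ =′ = not s
lower s ∈ʰ >′ = s
lower s ∈ʰ ≥′ = not s

Bounded : Half → ℝ → ℝ → Set
Bounded (upper false) x y = x ≤ᴿ y
Bounded (upper true)  x y = x <ᴿ y
Bounded (lower false) x y = y ≤ᴿ x
Bounded (lower true)  x y = y <ᴿ x

cmp⇒bounded : ∀ ⋈ h x y → T (h ∈ʰ ⋈) → x ⟨ ⋈ ⟩ᴿ y → Bounded h x y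
cmp⇒bounded ≤′ (upper false) x y _ p = p
cmp⇒bounded <′ (upper true)  x y _ p = p
cmp⇒bounded =′ (upper false) x y _ p n = ℚ.≤-trans {seq x n ℚ.- seq y n} ≤∣ seq x n ℚ.- seq y n ∣ (p n)
cmp⇒bounded =′ (lower false) x y _ p n = ℚ.≤-trans {seq y n ℚ.- seq x n} ≤∣ seq y n ℚ.- seq x n ∣
  (subst (ℚ._≤ 2/1+ n) (∣-∣-swap (seq x n) (seq y n)) (p n))
cmp⇒bounded >′ (lower true)  x y _ p = p
cmp⇒bounded ≥′ (lower false) x y _ p = p

bounded⇒cmp : ∀ ⋈ x y → (∀ h → T (h ∈ʰ ⋈) → Bounded h x y) → x ⟨ ⋈ ⟩ᴿ y
bounded⇒cmp ≤′ x y b = b (upper false) tt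
bounded⇒cmp <′ x y b = b (upper true) tt
bounded⇒cmp =′ x y b n with ℚ.∣p∣≡p∨∣p∣≡-p (seq x n ℚ.- seq y n)
... | inj₁ e = subst (ℚ._≤ 2/1+ n) (sym e) (b (upper false) tt n)
... | inj₂ e = subst (ℚ._≤ 2/1+ n) (sym (trans e (flip-- (seq x n) (seq y n)))) (b (lower false) tt n)
  where
  flip-- : ∀ p q → ℚ.- (p ℚ.- q) ≡ q ℚ.- p
  flip-- = solve 2 (λ p q → :- (p :- q) := q :- p) refl
    where open ℚ-Solver.+-*-Solver
bounded⇒cmp >′ x y b = b (lower true) tt
bounded⇒cmp ≥′ x y b = b (lower false) tt

_≤[_]_ : ℕ → Bool → ℕ → Set
a ≤[ false ] b = a ≤ b
a ≤[ true  ] b = a < b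

upper-bound : ∀ strict d {a b} β → a ≤[ strict ] (b + β * suc d) →
              Bounded (upper strict) (fractionᴿ d a -ᴿ fractionᴿ d b) (fromℕᴿ β)
upper-bound false d {a} {b} β h = ≤-everywhere⇒≤ᴿ (fractionᴿ d a -ᴿ fractionᴿ d b) (fromℕᴿ β)
  (λ _ → subst (ι a ℚ.* 1/1+ d ℚ.- ι b ℚ.* 1/1+ d ℚ.≤_) (whole-difference d b β)
    (add-right (ι a ℚ.* 1/1+ d) (ι (b + β * suc d) ℚ.* 1/1+ d) (ℚ.- (ι b ℚ.* 1/1+ d)) (fraction-mono-≤ d h)))
upper-bound true d {a} {b} β h = constant-<⇒<ᴿ (fractionᴿ d a -ᴿ fractionᴿ d b) (fromℕᴿ β) (λ _ → refl) (λ _ → refl)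
  (subst (ι a ℚ.* 1/1+ d ℚ.- ι b ℚ.* 1/1+ d ℚ.<_) (whole-difference d b β)
    (ℚ.+-monoˡ-< (ℚ.- (ι b ℚ.* 1/1+ d)) {ι a ℚ.* 1/1+ d} {ι (b + β * suc d) ℚ.* 1/1+ d} (fraction-mono-< d h)))

lower-bound : ∀ strict d {a b} β → (b + β * suc d) ≤[ strict ] a →
              Bounded (lower strict) (fractionᴿ d a -ᴿ fractionᴿ d b) (fromℕᴿ β)
lower-bound false d {a} {b} β h = ≤-everywhere⇒≤ᴿ (fromℕᴿ β) (fractionᴿ d a -ᴿ fractionᴿ d b)
  (λ _ → subst (ℚ._≤ ι a ℚ.* 1/1+ d ℚ.- ι b ℚ.* 1/1+ d) (whole-difference d b β)
    (add-right (ι (b + β * suc d) ℚ.* 1/1+ d) (ι a ℚ.* 1/1+ d) (ℚ.- (ι b ℚ.* 1/1+ d)) (fraction-mono-≤ d h)))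
lower-bound true d {a} {b} β h = constant-<⇒<ᴿ (fromℕᴿ β) (fractionᴿ d a -ᴿ fractionᴿ d b) (λ _ → refl) (λ _ → refl)
  (subst (ℚ._< ι a ℚ.* 1/1+ d ℚ.- ι b ℚ.* 1/1+ d) (whole-difference d b β)
    (ℚ.+-monoˡ-< (ℚ.- (ι b ℚ.* 1/1+ d)) {ι (b + β * suc d) ℚ.* 1/1+ d} {ι a ℚ.* 1/1+ d} (fraction-mono-< d h)))

-- The fractional part of `x` when `q` is its integer part, kept as a plain sequence of rationals
-- since `≼` and `≺` ask for no regularity.
_↓_ : ℝ → ℕ → ℕ → ℚ
(x ↓ q) n = seq x n ℚ.- ι q

𝟎 : ℕ → ℚ
𝟎 _ = 0ℚ

_≼[_]_ : (ℕ → ℚ) → Bool → (ℕ → ℚ) → Set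
A ≼[ false ] B = A ≼ B
A ≼[ true  ] B = A ≺ B

≼[]⇒≼ : ∀ s {A B} → A ≼[ s ] B → A ≼ B
≼[]⇒≼ false h = h
≼[]⇒≼ true  h = ≺⇒≼ h

↓-mono : ∀ x y q → x ≤ᴿ y → (x ↓ q) ≼ (y ↓ q)
↓-mono x y q h = ≼-shift {seq x} {seq y} (λ _ → ℚ.- ι q) (≤ᴿ⇒≼ x y h)

↓-antitone : ∀ x {a b} → a ≤ b → (x ↓ b) ≼ (x ↓ a)
↓-antitone x {a} {b} a≤b = ≤⇒≼ {x ↓ b} {x ↓ a} λ n →
  ℚ.+-monoʳ-≤ (seq x n) {ℚ.- ι b} {ℚ.- ι a} (ℚ.neg-antimono-≤ (ι-mono-≤ a≤b))

private
  module Shift (x y : ℝ) (q β : ℕ) where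
    open ℚ-Solver.+-*-Solver

    -- Adding y - β - q to both sides of a comparison of x - y with β turns it into one of x - (q +
    -- β) with y - q: two fractional parts if the integer parts are q + β and q.
    Z : ℕ → ℚ
    Z n = seq y n ℚ.- ι β ℚ.- ι q

    left : ∀ n → (x ⊖ y) n ℚ.+ Z n ≡ (x ↓ (q + β)) n
    left n = trans (lemma (seq x n) (seq y n) (ι β) (ι q)) (cong (λ z → seq x n ℚ.- z) (sym (ι-+ q β)))
      where
      lemma : ∀ x y β q → (x ℚ.- y) ℚ.+ (y ℚ.- β ℚ.- q) ≡ x ℚ.- (q ℚ.+ β)
      lemma = solve 4 (λ x y β q → (x :- y) :+ ((y :- β) :- q) := x :- (q :+ β)) refl

    right : ∀ n → ι β ℚ.+ Z n ≡ (y ↓ q) n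
    right n = lemma (seq y n) (ι β) (ι q)
      where
      lemma : ∀ y β q → β ℚ.+ (y ℚ.- β ℚ.- q) ≡ y ℚ.- q
      lemma = solve 3 (λ y β q → β :+ ((y :- β) :- q) := y :- q) refl

    L = λ n → (x ⊖ y) n ℚ.+ Z n
    R = λ n → ι β ℚ.+ Z n

    B : ℕ → ℚ
    B _ = ι β

    up-≼ : (x ⊖ y) ≼ B → (x ↓ (q + β)) ≼ (y ↓ q)
    up-≼ h = ≼-trans {_} {L} {_} (≡⇒≼ {_} {L} (sym ∘ left)) (≼-trans {L} {R} {_} (≼-shift {x ⊖ y} {B} Z h) (≡⇒≼ {R} right))

    up-≺ : (x ⊖ y) ≺ B → (x ↓ (q + β)) ≺ (y ↓ q)
    up-≺ h = ≼-≺-trans {_} {L} {_} (≡⇒≼ {_} {L} (sym ∘ left)) (≺-≼-trans {L} {R} {_} (≺-shift {x ⊖ y} {B} Z h) (≡⇒≼ {R} right))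

    low-≼ : B ≼ (x ⊖ y) → (y ↓ q) ≼ (x ↓ (q + β))
    low-≼ h = ≼-trans {_} {R} {_} (≡⇒≼ {_} {R} (sym ∘ right)) (≼-trans {R} {L} {_} (≼-shift {B} {x ⊖ y} Z h) (≡⇒≼ {L} left))

    low-≺ : B ≺ (x ⊖ y) → (y ↓ q) ≺ (x ↓ (q + β))
    low-≺ h = ≼-≺-trans {_} {R} {_} (≡⇒≼ {_} {R} (sym ∘ right)) (≺-≼-trans {R} {L} {_} (≺-shift {B} {x ⊖ y} Z h) (≡⇒≼ {L} left))

upper-bounded : ∀ s x y q β → Bounded (upper s) (x -ᴿ y) (fromℕᴿ β) → (x ↓ (q + β)) ≼[ s ] (y ↓ q)
upper-bounded false x y q β h = Shift.up-≼ x y q β (≼-trans (≼--ᴿ x y) (≤ᴿ⇒≼ (x -ᴿ y) (fromℕᴿ β) h))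
upper-bounded true  x y q β h = Shift.up-≺ x y q β (≼-≺-trans (≼--ᴿ x y) (<ᴿ⇒≺ (x -ᴿ y) (fromℕᴿ β) h))

lower-bounded : ∀ s x y q β → Bounded (lower s) (x -ᴿ y) (fromℕᴿ β) → (y ↓ q) ≼[ s ] (x ↓ (q + β))
lower-bounded false x y q β h = Shift.low-≼ x y q β (≼-trans (≤ᴿ⇒≼ (fromℕᴿ β) (x -ᴿ y) h) (-ᴿ-≼ x y))
lower-bounded true  x y q β h = Shift.low-≺ x y q β (≺-≼-trans (<ᴿ⇒≺ (fromℕᴿ β) (x -ᴿ y) h) (-ᴿ-≼ x y))

-- Constructively valid: `x <ᴿ y` asks for a single index, so refuting it bounds the difference at
-- every index, the order of the rationals being decidable.
≮ᴿ⇒≥ᴿ : ∀ x y → ¬ x <ᴿ y → y ≤ᴿ x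
≮ᴿ⇒≥ᴿ x y x≮y n = ℚ.≮⇒≥ λ h → x≮y (n , h)

record IsFloor (x : ℝ) (q : ℕ) : Set where
  constructor isFloor
  field
    floor-≤ : 𝟎 ≼ (x ↓ q)
    floor-< : (x ↓ suc q) ≺ 𝟎

open IsFloor public

-- Without a floor, `x` being not below m would imply `x` being not below m+1. By induction `x`
-- would be below no natural number, against `x<N`.
floor-exists : ∀ x → fromℕᴿ 0 ≤ᴿ x → ¬ ¬ ∃ (IsFloor x)
floor-exists x 0≤x ¬floor = above (suc N) x<N
  where
  N = proj₁ (ι-unbounded (seq x 0 ℚ.+ 2/1+ 0))

  x<N : x <ᴿ fromℕᴿ (suc N)
  x<N = 0 , subst (ℚ._< ι (suc N) ℚ.- seq x 0) (cancel (seq x 0) (2/1+ 0))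
    (ℚ.+-monoˡ-< (ℚ.- seq x 0) {seq x 0 ℚ.+ 2/1+ 0} {ι (suc N)} (proj₂ (ι-unbounded (seq x 0 ℚ.+ 2/1+ 0))))

  from-≤ : ∀ q → fromℕᴿ q ≤ᴿ x → 𝟎 ≼ (x ↓ q)
  from-≤ q h = ≼-trans {𝟎} {fromℕᴿ q ↓ q} (≡⇒≼ {𝟎} {fromℕᴿ q ↓ q} (λ _ → sym (ℚ.+-inverseʳ (ι q)))) (↓-mono (fromℕᴿ q) x q h)

  from-< : ∀ q → x <ᴿ fromℕᴿ q → (x ↓ q) ≺ 𝟎
  from-< q h = ≺-≼-trans {x ↓ q} {fromℕᴿ q ↓ q} (≺-shift {seq x} {seq (fromℕᴿ q)} (λ _ → ℚ.- ι q) (<ᴿ⇒≺ x (fromℕᴿ q) h))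
    (≡⇒≼ {fromℕᴿ q ↓ q} {𝟎} (λ _ → ℚ.+-inverseʳ (ι q)))

  above : ∀ m → ¬ x <ᴿ fromℕᴿ m
  above zero    x<0 = ≺-irrefl {𝟎} (≼-≺-trans {𝟎} {x ↓ 0} (from-≤ 0 0≤x) (from-< 0 x<0))
  above (suc m) x<1+m = ¬floor (m , isFloor (from-≤ m (≮ᴿ⇒≥ᴿ x (fromℕᴿ m) (above m))) (from-< (suc m) x<1+m))

floors-exist : ∀ {n} (xs : Fin n → ℝ) → (∀ i → fromℕᴿ 0 ≤ᴿ xs i) → ¬ ¬ ∃ λ (q : Fin n → ℕ) → ∀ i → IsFloor (xs i) (q i)
floors-exist {zero}  xs 0≤xs k = k ((λ ()) , λ ())
floors-exist {suc n} xs 0≤xs k =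
  floor-exists (xs zero) (0≤xs zero) λ (q₀ , p₀) →
  floors-exist (xs ∘ suc) (0≤xs ∘ suc) λ (q , p) →
  k ((λ { zero → q₀ ; (suc i) → q i }) , λ { zero → p₀ ; (suc i) → p i })

-- The encoding

enum-Cmp : Enum Cmp
elems enum-Cmp = ≤′ ∷ <′ ∷ =′ ∷ >′ ∷ ≥′ ∷ []
complete enum-Cmp = λ
    { ≤′ → here refl
    ; <′ → there (here refl)
    ; =′ → there (there (here refl))
    ; >′ → there (there (there (here refl)))
    ; ≥′ → there (there (there (there (here refl)))) }

enum-Half : Enum Half
elems enum-Half = upper false ∷ upper true ∷ lower false ∷ lower true ∷ []
complete enum-Half = λ
    { (upper false) → here refl
    ; (upper true)  → there (here refl)
    ; (lower false) → there (there (here refl))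
    ; (lower true)  → there (there (there (here refl))) }

isStrict : Half → Bool
isStrict (upper s) = s
isStrict (lower s) = s

data Ord : Set where
  lt eq gt : Ord

-- Places k - j relative to β, avoiding truncated subtraction.
Compare : Ord → ℕ → ℕ → ℕ → Set
Compare lt β j k = k < j + β
Compare eq β j k = k ≡ j + β
Compare gt β j k = j + β < k

compare? : ∀ o β j k → Dec (Compare o β j k)
compare? lt β j k = k ℕ.<? j + β
compare? eq β j k = k ℕ.≟ j + β
compare? gt β j k = j + β ℕ.<? k

-- Integer parts more than β apart force a real difference above β, as the later one loses no
-- fraction and the earlier one less than 1; dually for less than β. Either refutes the bound,
-- strict or not.
violation : Half → Ord
violation (upper _) = gt
violation (lower _) = lt

module Encoding (𝒯 : TimedSystem) where
  open TimedSystem 𝒯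

  #transitions : ℕ
  #transitions = length δ

  Transition : Set
  Transition = Fin #transitions

  source target : Transition → Fin #states
  source t = proj₁ (lookup δ t)
  target t = proj₂ (proj₂ (lookup δ t))

  letter : Transition → Letter
  letter t = proj₁ (proj₂ (lookup δ t))

  #guessed : ℕ
  #guessed = #transitions + (M + 2)

  Γ : Set
  Γ = Γ^ DS

  Formula Route : Set
  Formula = State (⊥ ⊎ Fin #guessed) Γ
  Route   = Path (⊥ ⊎ Fin #guessed) Γ

  trᵛ : Transition → Fin #guessed
  trᵛ t = t Fin.↑ˡ (M + 2)

  valᵛ : Const → Fin #guessed
  valᵛ a = #transitions Fin.↑ʳ (a Fin.↑ˡ 2)

  flagᵛ : Fin 2 → Fin #guessed
  flagᵛ b = #transitions Fin.↑ʳ (M Fin.↑ʳ b)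

  tr : Transition → Formula
  tr t = prop (inj₂ (trᵛ t))

  val : Const → Formula
  val a = prop (inj₂ (valᵛ a))

  flag : Fin 2 → Formula
  flag b = prop (inj₂ (flagᵛ b))

  transitions : Enum Transition
  transitions = enum-Fin #transitions

  consts : Enum Const
  consts = enum-Fin M

  has : AP ⊎ Instr → Formula
  has a = ⋁ transitions λ t → when (letter t a) (tr t)

  next : Route
  next = ⟶ succ

  -- Integer parts of timestamps are written v + M·Q with val v at the node;
  -- the flags record the increment of Q from the previous node, cut off at 2.
  jump : Fin 3 → Formula
  jump zero             = ¬′ (flag zero ∨′ flag (suc zero))
  jump (suc zero)       = flag zero ∧′ ¬′ flag (suc zero)
  jump (suc (suc zero)) = flag (suc zero)

  hop : Fin 3 → Route
  hop c = next · test (jump c)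

  -- Forward paths sorted by total increment: 0, 1, or at least 2. A flag belongs to the step into
  -- its node, so `hop` tests after moving. A total of at least 2 comes from two increments of 1 or
  -- from a single larger one; what follows is then free.
  walk : Fin 3 → Route
  walk zero             = hop zero ✶
  walk (suc zero)       = hop zero ✶ · hop (suc zero) · hop zero ✶
  walk (suc (suc zero)) = (walk (suc zero) · hop (suc zero) · next ✶) ⊕
                          (next ✶ · hop (suc (suc zero)) · next ✶)

  -- The second node may lie ahead or behind; accordingly the quotient difference `c` is credited to
  -- `b` or to `a`. Class 2 is treated as exactly 2, which gives the right answer for any larger
  -- difference because the residues and β are below M.
  compared : Ord → ℕ → Route
  compared o β = ⨁ (consts ×ᵉ consts ×ᵉ enum-Fin 3) λ (a , b , c) →
    test (val a) ·
    (whenᵖ (does (compare? o β (toℕ a) (toℕ c * M + toℕ b))) (walk c) ⊕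
     whenᵖ (does (compare? o β (toℕ c * M + toℕ a) (toℕ b))) (walk c ⁻¹)) ·
    test (val b)

  -- Leads from p_a(i) to i. The last `next` stays outside the star, since a reset at i itself does
  -- not affect p_x(i).
  since : Clock ⊎ DS → Route
  since (inj₁ x) = test (has (inj₂ (reset x))) · (next · test (¬′ has (inj₂ (reset x)))) ✶ · next
  since (inj₂ d) = ⟶ (data-edge d)

  Term : Set
  Term = (Clock ⊎ DS) ⊎ Diff

  instruction : Term → Cmp → Const → Instr
  instruction (inj₁ a) = constraint a
  instruction (inj₂ δ) = diff δ

  from : Term → Clock ⊎ DS
  from (inj₁ a) = a
  from (inj₂ δ) = minuend δ

  -- A simple constraint measures the time up to its own node, a difference up to p_b(i). With this,
  -- both kinds of constraint bound the time from the start of `span` to its end.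
  until : Term → Route
  until (inj₁ a) = test ⊤′
  until (inj₂ δ) = since (subtrahend δ) ⁻¹

  Constraint : Set
  Constraint = Term × Cmp × Const

  imposed : Constraint → Formula
  imposed (D , ⋈ , β) = has (inj₂ (instruction D ⋈ β))

  span : Constraint → Route
  span (D , ⋈ , β) = since (from D) · test (imposed (D , ⋈ , β)) · until D

  -- When the integer parts differ by exactly β, a bound on the difference compares
  -- the fractional parts; the edge points to the larger one.
  link : Constraint × Half → Route
  link ((D , ⋈ , β) , upper _) = (span (D , ⋈ , β) ∩ compared eq (toℕ β)) ⁻¹
  link ((D , ⋈ , β) , lower _) = span (D , ⋈ , β) ∩ compared eq (toℕ β)

  diffs-enum : Enum Diff
  diffs-enum = enum-map to from′ to-from (enum-⊎ (clocks ×ᵉ clocks) (enum-⊎ (dss ×ᵉ clocks) (clocks ×ᵉ dss)))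
    where
    clocks = enum-Fin #Clocks
    dss = enum-Fin #DS
    to : (Clock × Clock) ⊎ (DS × Clock) ⊎ (Clock × DS) → Diff
    to (inj₁ (x , y))        = x -ᶜᶜ y
    to (inj₂ (inj₁ (d , x))) = d -ᵈᶜ x
    to (inj₂ (inj₂ (x , d))) = x -ᶜᵈ d
    from′ : Diff → (Clock × Clock) ⊎ (DS × Clock) ⊎ (Clock × DS)
    from′ (x -ᶜᶜ y) = inj₁ (x , y)
    from′ (d -ᵈᶜ x) = inj₂ (inj₁ (d , x))
    from′ (x -ᶜᵈ d) = inj₂ (inj₂ (x , d))
    to-from : ∀ δ → to (from′ δ) ≡ δ
    to-from (x -ᶜᶜ y) = refl
    to-from (d -ᵈᶜ x) = refl
    to-from (x -ᶜᵈ d) = refl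

  constraints-enum : Enum Constraint
  constraints-enum = enum-⊎ (enum-⊎ (enum-Fin #Clocks) (enum-Fin #DS)) diffs-enum ×ᵉ enum-Cmp ×ᵉ consts

  halves-enum : Enum (Constraint × Half)
  halves-enum = constraints-enum ×ᵉ enum-Half

  _∈ᶜ_ : Half → Constraint → Bool
  h ∈ᶜ (D , ⋈ , β) = h ∈ʰ ⋈

  -- Forced comparisons of fractional parts. The first summand of `weak` is monotonicity of
  -- timestamps, which says something about fractional parts when two successive integer parts
  -- agree. Every strict edge is also a weak one.
  weak strict : Route
  weak   = (next ∩ compared eq 0) ⊕ (⨁ halves-enum λ (c , h) → whenᵖ (h ∈ᶜ c) (link (c , h)))
  strict = ⨁ halves-enum λ (c , h) → whenᵖ (h ∈ᶜ c) (whenᵖ (isStrict h) (link (c , h)))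

  bad-run : Formula
  bad-run =
    ¬′ (⋁ transitions tr) ∨′
    (⋁ (transitions ×ᵉ transitions) λ (t , t′) → when (not (does (t Fin.≟ t′))) (tr t ∧′ tr t′)) ∨′
    (⋁ transitions λ t → when (not (initial (source t))) (tr t ∧′ ¬′ (⟨ next ⁻¹ ⟩ ⊤′))) ∨′
    (⋁ transitions λ t → when (not (final (target t))) (tr t ∧′ ¬′ (⟨ next ⟩ ⊤′))) ∨′
    (⋁ (transitions ×ᵉ transitions) λ (t , t′) →
      when (not (does (target t Fin.≟ source t′))) (tr t ∧′ ⟨ next ⟩ tr t′))

  -- For a stack, a crossing i < i′ < j < j′ is detected at i′: the intersection finds a node j
  -- ahead of i′ and before the read j′ of i′, and the way back leads from j to its write i and on
  -- to i′. For a queue the loop starts at i and visits i′, j′ and j; `next ✶` admits j′ equal to j,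
  -- which is also a violation.
  bad-discipline : Kind → DS → Formula
  bad-discipline stack d = loop (((next · next ✶) ∩ (⟶ (data-edge d) · (next · next ✶) ⁻¹)) ·
                                 ⟶ (data-edge d) ⁻¹ · next · next ✶)
  bad-discipline queue d = loop (next · next ✶ · ⟶ (data-edge d) · next ✶ · ⟶ (data-edge d) ⁻¹)

  -- Only the successor edges of the graph are known to be well behaved, so everything in `Matching`
  -- has to be checked on the data edges. The two loops ending in `next · next ✶` detect a write
  -- with two reads and a read with two writes.
  bad-matching : DS → Formula
  bad-matching d =
    ((⟨ ⟶ (data-edge d) ⟩ ⊤′) ∧′ ¬′ has (inj₂ (op (w d)))) ∨′
    ((⟨ ⟶ (data-edge d) ⁻¹ ⟩ ⊤′) ∧′ ¬′ has (inj₂ (op (r d)))) ∨′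
    loop (⟶ (data-edge d) · next ✶) ∨′
    (has (inj₂ (op (w d))) ∧′ ¬′ (⟨ ⟶ (data-edge d) ⟩ ⊤′)) ∨′
    (has (inj₂ (op (r d))) ∧′ ¬′ (⟨ ⟶ (data-edge d) ⁻¹ ⟩ ⊤′)) ∨′
    loop (⟶ (data-edge d) ⁻¹ · ⟶ (data-edge d) · next · next ✶) ∨′
    loop (⟶ (data-edge d) · ⟶ (data-edge d) ⁻¹ · next · next ✶) ∨′
    bad-discipline (kind d) d

  -- Quotients cannot decrease, being sums of increments, but residues can; the loop detects a step
  -- to a smaller integer part.
  bad-value : Formula
  bad-value =
    ¬′ (⋁ consts val) ∨′
    (⋁ (consts ×ᵉ consts) λ (a , b) → when (not (does (a Fin.≟ b))) (val a ∧′ val b)) ∨′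
    loop (next · compared lt 0 ⁻¹)

  bad-constraint : Constraint → Formula
  bad-constraint c =
    (imposed c ∧′ ¬′ (⟨ since (from (proj₁ c)) ⁻¹ ⟩ ⊤′)) ∨′
    (imposed c ∧′ ¬′ (⟨ until (proj₁ c) ⟩ ⊤′)) ∨′
    (⋁ enum-Half λ h → when (h ∈ᶜ c) (loop (span c · compared (violation h) (toℕ (proj₂ (proj₂ c))) ⁻¹)))

  -- Each requirement is stated through a defect visible at some node, so that one negated `E`
  -- expresses all of them.
  bad : Formula
  bad = bad-run ∨′ (⋁ (enum-Fin #DS) bad-matching) ∨′ bad-value ∨′ (⋁ constraints-enum bad-constraint) ∨′
        loop (strict · weak ✶)

  specification : ICPDL AP Γ → ICPDL (⊥ ⊎ Fin #guessed) Γ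
  specification = substᶠ (λ p → has (inj₁ p))

  -- The last disjunct excludes the empty graph; its ∩ also makes it evident that
  -- the width is at least 2.
  encode : ICPDL AP Γ → EQ-ICPDL ⊥ Γ
  encode Φ = record
    { #vars  = #guessed
    ; matrix = ¬′ (E bad ∨′ specification Φ ∨′ ¬′ E (loop (test ⊤′ ∩ test ⊤′)))
    }

  -- Size and width of the encoding

  module Size {N : ℕ} (δ≤N : #transitions ≤ N) (M≤N : M ≤ N) (C≤N : #Clocks ≤ N) (D≤N : #DS ≤ N) where

    private
      transitionsˡ : Few N transitions var
      transitionsˡ = few-Fin δ≤N

      constsˡ : Few N consts var
      constsˡ = few-Fin M≤N

      1≤2 : 1 ≤ 2
      1≤2 = s≤s z≤n

      constraintsˡ : ∃ (Few N constraints-enum)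
      constraintsˡ = _ ,
        ((few-Fin C≤N ⊎ˡ few-Fin D≤N) ⊎ˡ
         few-map ((few-Fin C≤N ×ˡ few-Fin C≤N) ⊎ˡ ((few-Fin D≤N ×ˡ few-Fin C≤N) ⊎ˡ (few-Fin C≤N ×ˡ few-Fin D≤N)))) ×ˡ
        few {as = enum-Cmp} {e = con 5} ℕ.≤-refl ×ˡ constsˡ

      halvesˡ : ∃ (Few N halves-enum)
      halvesˡ = _ , proj₂ constraintsˡ ×ˡ few {as = enum-Half} {e = con 4} ℕ.≤-refl

    hasˢ : ∃ λ e → ∀ a → Smallˢ N (has a) e
    hasˢ = _ , λ a → ⋁ˢ transitionsˡ λ t → whenˢ {b = letter t a} propˢ

    private
      nextᵖ : Smallᵖ {⊥ ⊎ Fin #guessed} {Γ} N 1 next (con 1)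
      nextᵖ = ⟶ᵖ

      walkᵖ : ∃ λ e → ∀ c → Smallᵖ N 1 (walk c) e
      -- The size of a walk evaluates to a numeral; 100 is a generous common bound.
      walkᵖ = con 100 , λ
        { zero             → smallᵖ (ℕ.≤ᵇ⇒≤ _ _ tt) ℕ.≤-refl (s≤s z≤n)
        ; (suc zero)       → smallᵖ (ℕ.≤ᵇ⇒≤ _ _ tt) ℕ.≤-refl (s≤s z≤n)
        ; (suc (suc zero)) → smallᵖ (ℕ.≤ᵇ⇒≤ _ _ tt) ℕ.≤-refl (s≤s z≤n) }

      comparedᵖ : ∃ λ e → ∀ o β → Smallᵖ N 1 (compared o β) e
      comparedᵖ = _ , λ o β → ⨁ᵖ ℕ.≤-refl
        (constsˡ ×ˡ constsˡ ×ˡ few {as = enum-Fin 3} {e = con 3} ℕ.≤-refl)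
        λ (a , b , c) → testᵖ propˢ ·ᵖ
          (whenPᵖ {b = does (compare? o β (toℕ a) (toℕ c * M + toℕ b))} ℕ.≤-refl (proj₂ walkᵖ c) ⊕ᵖ
           whenPᵖ {b = does (compare? o β (toℕ c * M + toℕ a) (toℕ b))} ℕ.≤-refl (proj₂ walkᵖ c ⁻¹ᵖ)) ·ᵖ
          testᵖ propˢ

      sinceᵖ : ∃ λ e → ∀ a → Smallᵖ N 1 (since a) e
      sinceᵖ = con 1 ⊞ proj₁ clockᵖ , λ
        { (inj₁ x) → let smallᵖ s i h = proj₂ clockᵖ x in smallᵖ (ℕ.m≤n⇒m≤1+n s) i h
        ; (inj₂ d) → smallᵖ (s≤s z≤n) ℕ.≤-refl (s≤s z≤n) }
        where
        clockᵖ : ∃ λ e → ∀ x → Smallᵖ N 1 (since (inj₁ x)) e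
        clockᵖ = _ , λ x → testᵖ (proj₂ hasˢ (inj₂ (reset x))) ·ᵖ
          (nextᵖ ·ᵖ testᵖ (¬ˢ proj₂ hasˢ (inj₂ (reset x)))) ✶ᵖ ·ᵖ nextᵖ

      untilᵖ : ∃ λ e → ∀ D → Smallᵖ N 1 (until D) e
      untilᵖ = con 1 ⊞ (con 1 ⊞ proj₁ sinceᵖ) , λ
        { (inj₁ a) → smallᵖ (s≤s (s≤s z≤n)) ℕ.≤-refl (s≤s z≤n)
        ; (inj₂ δ) → let smallᵖ s i h = proj₂ sinceᵖ (subtrahend δ) ⁻¹ᵖ in smallᵖ (ℕ.m≤n⇒m≤1+n s) i h }

      spanᵖ : ∃ λ e → ∀ c → Smallᵖ N 1 (span c) e
      spanᵖ = _ , λ (D , ⋈ , β) →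
        proj₂ sinceᵖ (from D) ·ᵖ testᵖ (proj₂ hasˢ (inj₂ (instruction D ⋈ β))) ·ᵖ proj₂ untilᵖ D

      linkᵖ : ∃ λ e → ∀ ch → Smallᵖ N 2 (link ch) e
      linkᵖ = con 1 ⊞ (con 1 ⊞ proj₁ spanᵖ ⊞ proj₁ comparedᵖ) , λ
        { (c@(D , ⋈ , β) , upper _) → (proj₂ spanᵖ c ∩ᵖ proj₂ comparedᵖ eq (toℕ β)) ⁻¹ᵖ
        ; (c@(D , ⋈ , β) , lower _) → let smallᵖ s i h = proj₂ spanᵖ c ∩ᵖ proj₂ comparedᵖ eq (toℕ β)
                                      in smallᵖ (ℕ.m≤n⇒m≤1+n s) i h }

      weakᵖ : ∃ λ e → Smallᵖ N 2 weak e
      weakᵖ = _ , (nextᵖ ∩ᵖ proj₂ comparedᵖ eq 0) ⊕ᵖ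
        ⨁ᵖ 1≤2 (proj₂ halvesˡ) (λ (c , h) → whenPᵖ {b = h ∈ᶜ c} 1≤2 (proj₂ linkᵖ (c , h)))

      strictᵖ : ∃ λ e → Smallᵖ N 2 strict e
      strictᵖ = _ , ⨁ᵖ 1≤2 (proj₂ halvesˡ)
        (λ (c , h) → whenPᵖ {b = h ∈ᶜ c} 1≤2 (whenPᵖ {b = isStrict h} 1≤2 (proj₂ linkᵖ (c , h))))

      bad-runˢ : ∃ λ e → Smallˢ N bad-run e
      bad-runˢ = _ ,
        ¬ˢ ⋁ˢ transitionsˡ (λ _ → propˢ) ∨ˢ
        ⋁ˢ (transitionsˡ ×ˡ transitionsˡ) (λ (t , t′) → whenˢ {b = not (does (t Fin.≟ t′))} (propˢ ∧ˢ propˢ)) ∨ˢ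
        ⋁ˢ transitionsˡ (λ t → whenˢ {b = not (initial (source t))} (propˢ ∧ˢ ¬ˢ (⟨ nextᵖ ⁻¹ᵖ ⟩ˢ ⊤ˢ))) ∨ˢ
        ⋁ˢ transitionsˡ (λ t → whenˢ {b = not (final (target t))} (propˢ ∧ˢ ¬ˢ (⟨ nextᵖ ⟩ˢ ⊤ˢ))) ∨ˢ
        ⋁ˢ (transitionsˡ ×ˡ transitionsˡ) (λ (t , t′) →
          whenˢ {b = not (does (target t Fin.≟ source t′))} (propˢ ∧ˢ (⟨ nextᵖ ⟩ˢ propˢ)))

      disciplineˢ : ∃ λ e → ∀ k d → Smallˢ N (bad-discipline k d) e
      disciplineˢ = con 100 , λ
        { stack d → smallˢ (ℕ.≤ᵇ⇒≤ _ _ tt) ℕ.≤-refl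
        ; queue d → smallˢ (ℕ.≤ᵇ⇒≤ _ _ tt) (s≤s z≤n) }

      bad-matchingˢ : ∃ λ e → ∀ d → Smallˢ N (bad-matching d) e
      bad-matchingˢ = _ , λ d →
        ((⟨ edgeᵖ d ⟩ˢ ⊤ˢ) ∧ˢ ¬ˢ proj₂ hasˢ _) ∨ˢ
        ((⟨ edgeᵖ d ⁻¹ᵖ ⟩ˢ ⊤ˢ) ∧ˢ ¬ˢ proj₂ hasˢ _) ∨ˢ
        loopˢ (edgeᵖ d ·ᵖ nextᵖ ✶ᵖ) ∨ˢ
        (proj₂ hasˢ _ ∧ˢ ¬ˢ (⟨ edgeᵖ d ⟩ˢ ⊤ˢ)) ∨ˢ
        (proj₂ hasˢ _ ∧ˢ ¬ˢ (⟨ edgeᵖ d ⁻¹ᵖ ⟩ˢ ⊤ˢ)) ∨ˢ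
        loopˢ (edgeᵖ d ⁻¹ᵖ ·ᵖ edgeᵖ d ·ᵖ nextᵖ ·ᵖ nextᵖ ✶ᵖ) ∨ˢ
        loopˢ (edgeᵖ d ·ᵖ edgeᵖ d ⁻¹ᵖ ·ᵖ nextᵖ ·ᵖ nextᵖ ✶ᵖ) ∨ˢ
        proj₂ disciplineˢ (kind d) d
        where
        edgeᵖ : ∀ d → Smallᵖ {⊥ ⊎ Fin #guessed} {Γ} N 1 (⟶ (data-edge d)) (con 1)
        edgeᵖ d = ⟶ᵖ

      bad-valueˢ : ∃ λ e → Smallˢ N bad-value e
      bad-valueˢ = _ ,
        ¬ˢ ⋁ˢ constsˡ (λ _ → propˢ) ∨ˢ
        ⋁ˢ (constsˡ ×ˡ constsˡ) (λ (a , b) → whenˢ {b = not (does (a Fin.≟ b))} (propˢ ∧ˢ propˢ)) ∨ˢ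
        loopˢ (nextᵖ ·ᵖ proj₂ comparedᵖ lt 0 ⁻¹ᵖ)

      bad-constraintˢ : ∃ λ e → ∀ c → Smallˢ N (bad-constraint c) e
      bad-constraintˢ = _ , λ c →
        (proj₂ hasˢ _ ∧ˢ ¬ˢ (⟨ proj₂ sinceᵖ (from (proj₁ c)) ⁻¹ᵖ ⟩ˢ ⊤ˢ)) ∨ˢ
        (proj₂ hasˢ _ ∧ˢ ¬ˢ (⟨ proj₂ untilᵖ (proj₁ c) ⟩ˢ ⊤ˢ)) ∨ˢ
        ⋁ˢ {as = enum-Half} (few {e = con 4} ℕ.≤-refl) (λ h → whenˢ {b = h ∈ᶜ c} (loopˢ
          (proj₂ spanᵖ c ·ᵖ proj₂ comparedᵖ (violation h) (toℕ (proj₂ (proj₂ c))) ⁻¹ᵖ)))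

    badˢ : ∃ λ e → Smallˢ N bad e
    badˢ = _ ,
      proj₂ bad-runˢ ∨ˢ ⋁ˢ (few-Fin D≤N) (proj₂ bad-matchingˢ) ∨ˢ proj₂ bad-valueˢ ∨ˢ
      ⋁ˢ (proj₂ constraintsˡ) (proj₂ bad-constraintˢ) ∨ˢ
      loopˢ (proj₂ strictᵖ ·ᵖ proj₂ weakᵖ ✶ᵖ)

    encode-small : ∃ λ e → ∀ Φ → ∩-free Φ → size Φ ≤ N → Small∃ N (encode Φ) e
    -- The three outer summands are the number of guessed propositions, `bad`, and the rest of the
    -- matrix; 8 is the size of the disjunct that excludes the empty graph.
    encode-small = (var ⊞ (var ⊞ con 2)) ⊞ (con 2 ⊞ (con 1 ⊞ proj₁ badˢ) ⊞ (con 1 ⊞ var ⊠ (con 1 ⊞ proj₁ hasˢ) ⊞ con 8)) ,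
      λ Φ free Φ≤N → small∃
        (ℕ.+-mono-≤ (ℕ.+-mono-≤ δ≤N (ℕ.+-monoˡ-≤ 2 M≤N))
          (s≤s (s≤s (ℕ.+-mono-≤ (s≤s (Smallˢ.size≤ (proj₂ badˢ)))
            (s≤s (ℕ.+-monoˡ-≤ 8 (ℕ.≤-trans (substᶠ-size _ (λ p → proj₂ hasˢ (inj₁ p)) Φ)
                                           (ℕ.*-monoˡ-≤ (1 + ⟪ proj₁ hasˢ ⟫ N) Φ≤N))))))))
        (ℕ.≤-antisym
          (ℕ.⊔-lub (Smallˢ.width≤ (proj₂ badˢ)) (ℕ.⊔-lub (substᶠ-width _ (λ p → proj₂ hasˢ (inj₁ p)) Φ free) ℕ.≤-refl))
          (ℕ.≤-trans (ℕ.m≤n⊔m (width (specification Φ)) 2) (ℕ.m≤n⊔m (widthˢ bad) (width (specification Φ) ⊔ 2))))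

-- The expression is chosen before the timed system. Taking the total size for N is what allows
-- this, since N bounds every parameter on which the formula depends.
encode-small : ∃ λ e → ∀ 𝒯 Φ → ∩-free Φ → Small∃ (TimedSystem.size-𝒯 𝒯 + size Φ) (Encoding.encode 𝒯 Φ) e
encode-small = _ , λ 𝒯 Φ free →
  let open TimedSystem 𝒯
      transitions≤ , M≤ , clocks≤ , dss≤ = summands #states (length δ) #AP #Clocks #DS M (size Φ)
  in proj₂ (Encoding.Size.encode-small 𝒯 transitions≤ M≤ clocks≤ dss≤) Φ free (ℕ.m≤n+m (size Φ) size-𝒯)
  where
  last-summand : ∀ {x} s {y} → s + x ≡ y → x ≤ y
  last-summand s e = ℕ.≤-trans (ℕ.m≤n+m _ s) (ℕ.≤-reflexive e)

  summands : ∀ a b c d e f s → let N = a + b + c + d + e + f + s in b ≤ N × f ≤ N × d ≤ N × e ≤ N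
  summands a b c d e f s =
    last-summand (a + c + d + e + f + s) (move-b a b c d e f s) ,
    last-summand (a + b + c + d + e + s) (move-f a b c d e f s) ,
    last-summand (a + b + c + e + f + s) (move-d a b c d e f s) ,
    last-summand (a + b + c + d + f + s) (move-e a b c d e f s)
    where
    move-b : ∀ a b c d e f s → a + c + d + e + f + s + b ≡ a + b + c + d + e + f + s
    move-b = solve-∀
    move-f : ∀ a b c d e f s → a + b + c + d + e + s + f ≡ a + b + c + d + e + f + s
    move-f = solve-∀
    move-d : ∀ a b c d e f s → a + b + c + e + f + s + d ≡ a + b + c + d + e + f + s
    move-d = solve-∀
    move-e : ∀ a b c d e f s → a + b + c + d + f + s + e ≡ a + b + c + d + e + f + s
    move-e = solve-∀

-- Meaning of the routes under a given labelling

Between : ∀ {n} → Fin n → Fin n → (Fin n → Set) → Set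
Between j k P = ∀ m → j Fin.< m → m Fin.≤ k → P m

module _ {n : ℕ} {R : Rel (Fin n) 0ℓ} {P : Fin n → Set} where

  -- The property is known after each step, hence at every node of the path except the one it starts
  -- from.
  star⇒between : (∀ {u v} → R u v → Step u v × P v) → ∀ {j k} → Star R j k → j Fin.≤ k × Between j k P
  star⇒between f ε = ℕ.≤-refl , λ m j<m m≤j → contradiction j<m (ℕ.≤⇒≯ m≤j)
  star⇒between f {j} {k} (_◅_ {j = u} p ps) with f p | star⇒between f ps
  ... | j→u , Pu | u≤k , all = ℕ.≤-trans (ℕ.<⇒≤ (step⇒< j→u)) u≤k , inner
    where
    inner : Between j k P
    inner m j<m m≤k with ℕ.m≤n⇒m<n∨m≡n j<m
    ... | inj₁ 1+j<m = all m (subst (_< toℕ m) (sym j→u) 1+j<m) m≤k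
    ... | inj₂ 1+j≡m = subst P (Fin.toℕ-injective (trans j→u 1+j≡m)) Pu

  between⇒star : (∀ {u v} → Step u v → P v → R u v) → ∀ {j k} → j Fin.≤ k → Between j k P → Star R j k
  between⇒star f {j} = upward-induction (λ k → Between j k P → Star R j k) (λ _ → ε) λ {u} {v} u→v j≤u ih all →
    ih (λ m j<m m≤u → all m j<m (ℕ.≤-trans m≤u (ℕ.<⇒≤ (step⇒< u→v)))) ◅◅
    (f u→v (all v (ℕ.≤-<-trans j≤u (step⇒< u→v)) ℕ.≤-refl) ◅ ε)

shift-compare⁺ : ∀ o β s {j k} → Compare o β j k → Compare o β (s + j) (s + k)
shift-compare⁺ lt β s {j} {k} h = subst (s + k <_) (sym (ℕ.+-assoc s j β)) (ℕ.+-monoʳ-< s h)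
shift-compare⁺ eq β s {j} {k} h = trans (cong (s +_) h) (sym (ℕ.+-assoc s j β))
shift-compare⁺ gt β s {j} {k} h = subst (_< s + k) (sym (ℕ.+-assoc s j β)) (ℕ.+-monoʳ-< s h)

shift-compare⁻ : ∀ o β s {j k} → Compare o β (s + j) (s + k) → Compare o β j k
shift-compare⁻ lt β s {j} {k} h = ℕ.+-cancelˡ-< s k (j + β) (subst (s + k <_) (ℕ.+-assoc s j β) h)
shift-compare⁻ eq β s {j} {k} h = ℕ.+-cancelˡ-≡ s k (j + β) (trans h (ℕ.+-assoc s j β))
shift-compare⁻ gt β s {j} {k} h = ℕ.+-cancelˡ-< s (j + β) k (subst (_< s + k) (ℕ.+-assoc s j β) h)

compare-unique : ∀ o o′ {β j k} → Compare o β j k → Compare o′ β j k → o ≡ o′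
compare-unique lt lt p q    = refl
compare-unique lt eq p refl = contradiction p (ℕ.<-irrefl refl)
compare-unique lt gt p q    = contradiction p (ℕ.<-asym q)
compare-unique eq lt refl q = contradiction q (ℕ.<-irrefl refl)
compare-unique eq eq p q    = refl
compare-unique eq gt refl q = contradiction q (ℕ.<-irrefl refl)
compare-unique gt lt p q    = contradiction q (ℕ.<-asym p)
compare-unique gt eq p refl = contradiction p (ℕ.<-irrefl refl)
compare-unique gt gt p q    = refl

Jump : Fin 3 → ℕ → ℕ → Set
Jump zero             p q = q ≡ p
Jump (suc zero)       p q = q ≡ suc p
Jump (suc (suc zero)) p q = 2 + p ≤ q

module _ {M β a b : ℕ} (a<M : a < M) (b<M : b < M) (β<M : β < M) where

  private
    -- Two quotient steps are worth 2M, more than any two numbers below M together. With a residue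
    -- and β in these roles, quotients at least 2 apart settle every comparison.
    far : ∀ {x y p q} → x < M → y < M → 2 + p ≤ q → p * M + x + y < q * M
    far {x} {y} {p} {q} x<M y<M h = begin-strict
      p * M + x + y      ≡⟨ ℕ.+-assoc (p * M) x y ⟩
      p * M + (x + y)    <⟨ ℕ.+-monoʳ-< (p * M) (ℕ.+-mono-< x<M y<M) ⟩
      p * M + (M + M)    ≡⟨ double-step p M ⟩
      (2 + p) * M        ≤⟨ ℕ.*-monoˡ-≤ M h ⟩
      q * M              ∎
      where
      open ℕ.≤-Reasoning
      double-step : ∀ p M → p * M + (M + M) ≡ (2 + p) * M
      double-step = solve-∀

    after : ∀ {p q} → 2 + p ≤ q → Compare gt β (p * M + a) (q * M + b)
    after h = ℕ.<-≤-trans (far a<M β<M h) (ℕ.m≤m+n _ b)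

    before : ∀ {p q} → 2 + q ≤ p → Compare lt β (p * M + a) (q * M + b)
    before {p} {q} h = ℕ.<-≤-trans (ℕ.≤-<-trans (ℕ.m≤m+n _ 0) (far {y = 0} b<M (ℕ.≤-<-trans z≤n b<M) h))
                                   (ℕ.≤-trans (ℕ.m≤m+n (p * M) a) (ℕ.m≤m+n (p * M + a) β))

    regroup : ∀ p M x → suc p * M + x ≡ p * M + (1 * M + x)
    regroup = solve-∀

    -- For quotients at least 2 apart the outcome `o′` is known both for the true quotients and for
    -- the capped ones, so `o` must be that outcome.
    replace : ∀ o o′ {j k j′ k′} → Compare o′ β j k → Compare o′ β j′ k′ → Compare o β j k → Compare o β j′ k′
    replace o o′ h h′ k = subst (λ o → Compare o β _ _) (sym (compare-unique o o′ k h)) h′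

  forward⁺ : ∀ o c {p q} → Jump c p q → Compare o β (p * M + a) (q * M + b) → Compare o β a (toℕ c * M + b)
  forward⁺ o zero             {p} refl h = shift-compare⁻ o β (p * M) h
  forward⁺ o (suc zero)       {p} refl h =
    shift-compare⁻ o β (p * M) (subst (Compare o β (p * M + a)) (regroup p M b) h)
  forward⁺ o (suc (suc zero)) {p} {q} l h = replace o gt (after l) (after {0} {2} ℕ.≤-refl) h

  forward⁻ : ∀ o c {p q} → Jump c p q → Compare o β a (toℕ c * M + b) → Compare o β (p * M + a) (q * M + b)
  forward⁻ o zero             {p} refl h = shift-compare⁺ o β (p * M) h
  forward⁻ o (suc zero)       {p} refl h =
    subst (Compare o β (p * M + a)) (sym (regroup p M b)) (shift-compare⁺ o β (p * M) h)
  forward⁻ o (suc (suc zero)) {p} {q} l h = replace o gt (after {0} {2} ℕ.≤-refl) (after l) h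

  backward⁺ : ∀ o c {p q} → Jump c q p → Compare o β (p * M + a) (q * M + b) → Compare o β (toℕ c * M + a) b
  backward⁺ o zero             {p} {q} refl h = shift-compare⁻ o β (q * M) h
  backward⁺ o (suc zero)       {p} {q} refl h =
    shift-compare⁻ o β (q * M) (subst (λ j → Compare o β j (q * M + b)) (regroup q M a) h)
  backward⁺ o (suc (suc zero)) {p} {q} l h = replace o lt (before l) (before {2} {0} ℕ.≤-refl) h

  backward⁻ : ∀ o c {p q} → Jump c q p → Compare o β (toℕ c * M + a) b → Compare o β (p * M + a) (q * M + b)
  backward⁻ o zero             {p} {q} refl h = shift-compare⁺ o β (q * M) h
  backward⁻ o (suc zero)       {p} {q} refl h =
    subst (λ j → Compare o β j (q * M + b)) (sym (regroup q M a)) (shift-compare⁺ o β (q * M) h)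
  backward⁻ o (suc (suc zero)) {p} {q} l h = replace o lt (before {2} {0} ℕ.≤-refl) (before l) h

-- The second flag overrides the first, so that any pair of flags denotes exactly one class.
jump-class : Bool → Bool → Fin 3
jump-class _     true  = suc (suc zero)
jump-class true  false = suc zero
jump-class false false = zero

module Semantics (𝒯 : TimedSystem) (H : Graph ⊥ (Γ^ (TimedSystem.DS 𝒯)))
                 (steps : ∀ i j → E[_] H succ i j ⇔ Step i j)
                 (λ′ : V H → Fin (Encoding.#guessed 𝒯) → Bool) where
  open TimedSystem 𝒯
  open Encoding 𝒯

  𝔾 : Graph (⊥ ⊎ Fin #guessed) Γ
  𝔾 = expand H λ′

  infix 4 _⊩_
  _⊩_ : V H → Formula → Set
  i ⊩ σ = ⟦_⟧ˢ 𝔾 σ i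

  Joins : Route → Rel (V H) 0ℓ
  Joins π = ⟦_⟧ᵖ 𝔾 π

  next⁺ : ∀ {i j} → Step i j → Joins next i j
  next⁺ = Equivalence.from (steps _ _)

  next⁻ : ∀ {i j} → Joins next i j → Step i j
  next⁻ = Equivalence.to (steps _ _)

  all-hops⁺ : ∀ {φ j k} → j Fin.≤ k → Between j k (_⊩ φ) → Joins ((next · test φ) ✶) j k
  all-hops⁺ = between⇒star (λ s p → _ , next⁺ s , refl , p)

  all-hops⁻ : ∀ {φ j k} → Joins ((next · test φ) ✶) j k → j Fin.≤ k × Between j k (_⊩ φ)
  all-hops⁻ = star⇒between λ { (_ , s , refl , p) → next⁻ s , p }

  next✶⁺ : ∀ {j k} → j Fin.≤ k → Joins (next ✶) j k
  next✶⁺ j≤k = between⇒star {P = λ _ → ⊤} (λ s _ → next⁺ s) j≤k _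

  next✶⁻ : ∀ {j k} → Joins (next ✶) j k → j Fin.≤ k
  next✶⁻ p = proj₁ (star⇒between {P = λ _ → ⊤} (λ s → next⁻ s , tt) p)

  later⁺ : ∀ {j k} → j Fin.< k → Joins (next · next ✶) j k
  later⁺ {j} {k} j<k = u , next⁺ j→u , next✶⁺ (subst (_≤ toℕ k) (sym j→u) j<k)
    where
    u = Fin.fromℕ< (ℕ.≤-<-trans j<k (Fin.toℕ<n k))
    j→u : Step j u
    j→u = Fin.toℕ-fromℕ< _

  later⁻ : ∀ {j k} → Joins (next · next ✶) j k → j Fin.< k
  later⁻ (_ , s , p) = ℕ.<-≤-trans (step⇒< (next⁻ s)) (next✶⁻ p)

  class : V H → Fin 3
  class i = jump-class (λ′ i (flagᵛ zero)) (λ′ i (flagᵛ (suc zero)))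

  jump⁺ : ∀ i → i ⊩ jump (class i)
  jump⁺ i with λ′ i (flagᵛ zero) in e₀ | λ′ i (flagᵛ (suc zero)) in e₁
  ... | _     | true  = subst T (sym e₁) tt
  ... | true  | false = ∧⁺ 𝔾 {σ = flag zero} {τ = ¬′ flag (suc zero)} (subst T (sym e₀) tt) (subst T e₁)
  ... | false | false = [ subst T e₀ , subst T e₁ ]

  jump⁻ : ∀ i c → i ⊩ jump c → c ≡ class i
  jump⁻ i zero h with λ′ i (flagᵛ zero) | λ′ i (flagᵛ (suc zero))
  ... | _     | true  = contradiction (inj₂ tt) h
  ... | true  | false = contradiction (inj₁ tt) h
  ... | false | false = refl
  jump⁻ i (suc zero) (_ , ¬f₁ , refl , f₀) with λ′ i (flagᵛ zero) | λ′ i (flagᵛ (suc zero))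
  ... | _     | true  = contradiction tt ¬f₁
  ... | true  | false = refl
  jump⁻ i (suc (suc zero)) f₁ with λ′ i (flagᵛ zero) | λ′ i (flagᵛ (suc zero))
  ... | _     | true  = refl

  -- Any quotients compatible with the flags will do: soundness supplies sums of capped increments,
  -- completeness the true quotients of the integer parts.
  module Values (v : V H → Const) (val⁺ : ∀ i → i ⊩ val (v i)) (val⁻ : ∀ i a → i ⊩ val a → a ≡ v i)
                (Q : V H → ℕ) (jumps : ∀ i j → Step i j → Jump (class j) (Q i) (Q j)) where

    int : V H → ℕ
    int i = Q i * M + toℕ (v i)

    hop⁺ : ∀ {i j} → Step i j → Joins (hop (class j)) i j
    hop⁺ s = _ , next⁺ s , refl , jump⁺ _

    hop⁻ : ∀ {i j} c → Joins (hop c) i j → Step i j × Jump c (Q i) (Q j)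
    hop⁻ {i} {j} c (_ , s , refl , p) = next⁻ s , subst (λ c → Jump c (Q i) (Q j)) (sym (jump⁻ j c p)) (jumps i j (next⁻ s))

    Q-mono-jump : ∀ c {p q} → Jump c p q → p ≤ q
    Q-mono-jump zero             refl = ℕ.≤-refl
    Q-mono-jump (suc zero)       refl = ℕ.n≤1+n _
    Q-mono-jump (suc (suc zero)) h    = ℕ.≤-trans (ℕ.m≤n+m _ 2) h

    Q-mono : ∀ {i j} → i Fin.≤ j → Q i ≤ Q j
    Q-mono {i} = upward-induction (λ j → Q i ≤ Q j) ℕ.≤-refl
      (λ {u} {v} s _ h → ℕ.≤-trans h (Q-mono-jump (class v) (jumps u v s)))

    hop-zero⁻ : ∀ {i j} → Joins (hop zero ✶) i j → i Fin.≤ j × Q j ≡ Q i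
    hop-zero⁻ ε = ℕ.≤-refl , refl
    hop-zero⁻ (p ◅ ps) with hop⁻ zero p | hop-zero⁻ ps
    ... | s , e | l , e′ = ℕ.≤-trans (ℕ.<⇒≤ (step⇒< s)) l , trans e′ e

    walk⁻ : ∀ c {i j} → Joins (walk c) i j → i Fin.≤ j × Jump c (Q i) (Q j)
    walk⁻ zero p = hop-zero⁻ p
    walk⁻ (suc zero) (_ , p , _ , h , q) with hop-zero⁻ p | hop⁻ (suc zero) h | hop-zero⁻ q
    ... | l , e | s , e′ | l′ , e″ = ℕ.≤-trans l (ℕ.≤-trans (ℕ.<⇒≤ (step⇒< s)) l′) , trans e″ (trans e′ (cong suc e))
    walk⁻ (suc (suc zero)) (inj₁ (_ , p , _ , h , q)) with walk⁻ (suc zero) p | hop⁻ (suc zero) h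
    ... | l , e | s , e′ = ℕ.≤-trans l (ℕ.≤-trans (ℕ.<⇒≤ (step⇒< s)) (next✶⁻ q)) ,
      ℕ.≤-trans (ℕ.≤-reflexive (sym (trans e′ (cong suc e)))) (Q-mono (next✶⁻ q))
    walk⁻ (suc (suc zero)) (inj₂ (_ , p , _ , h , q)) with hop⁻ (suc (suc zero)) h
    ... | s , e = ℕ.≤-trans (next✶⁻ p) (ℕ.≤-trans (ℕ.<⇒≤ (step⇒< s)) (next✶⁻ q)) ,
      ℕ.≤-trans (s≤s (s≤s (Q-mono (next✶⁻ p)))) (ℕ.≤-trans e (Q-mono (next✶⁻ q)))

    -- Increments add up and are capped at 2. A walk that has reached the cap ends in `next ✶` and
    -- absorbs any further step; a single increment of at least 2 makes the whole walk so far its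
    -- free prefix.
    walk-snoc : ∀ c c′ {i u j} → Joins (walk c) i u → Step u j → Joins (hop c′) u j → ∃ λ c → Joins (walk c) i j
    walk-snoc zero zero p s h = zero , p ◅◅ (h ◅ ε)
    walk-snoc zero (suc zero) p s h = suc zero , (_ , p , _ , h , ε)
    walk-snoc (suc zero) zero (_ , p , _ , h′ , q) s h = suc zero , (_ , p , _ , h′ , q ◅◅ (h ◅ ε))
    walk-snoc (suc zero) (suc zero) p s h = suc (suc zero) , inj₁ (_ , p , _ , h , ε)
    walk-snoc (suc (suc zero)) c′ (inj₁ (_ , p , _ , h′ , q)) s h =
      suc (suc zero) , inj₁ (_ , p , _ , h′ , q ◅◅ (next⁺ s ◅ ε))
    walk-snoc (suc (suc zero)) c′ (inj₂ (_ , p , _ , h′ , q)) s h =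
      suc (suc zero) , inj₂ (_ , p , _ , h′ , q ◅◅ (next⁺ s ◅ ε))
    walk-snoc c@zero       (suc (suc zero)) p s h = suc (suc zero) , inj₂ (_ , next✶⁺ (proj₁ (walk⁻ c p)) , _ , h , ε)
    walk-snoc c@(suc zero) (suc (suc zero)) p s h = suc (suc zero) , inj₂ (_ , next✶⁺ (proj₁ (walk⁻ c p)) , _ , h , ε)

    walk-total : ∀ {i j} → i Fin.≤ j → ∃ λ c → Joins (walk c) i j
    walk-total {i} = upward-induction (λ j → ∃ λ c → Joins (walk c) i j) (zero , ε)
      λ {u} {v} s _ (c , p) → walk-snoc c (class v) p s (hop⁺ s)

    compared⁺ : ∀ o {β i j} → β < M → Compare o β (int i) (int j) → Joins (compared o β) i j
    compared⁺ o {β} {i} {j} β<M h with ℕ.≤-total (toℕ i) (toℕ j)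
    ... | inj₁ i≤j = let c , p = walk-total i≤j in
      ⨁⁺ 𝔾 (consts ×ᵉ consts ×ᵉ enum-Fin 3) (v i , v j , c)
        (i , (refl , val⁺ i) , j ,
         inj₁ (whenᵖ⁺ 𝔾 {π = walk c} (does⁺ (compare? o β (toℕ (v i)) (toℕ c * M + toℕ (v j)))
           (forward⁺ (Fin.toℕ<n (v i)) (Fin.toℕ<n (v j)) β<M o c (proj₂ (walk⁻ c p)) h)) p) ,
         (refl , val⁺ j))
    ... | inj₂ j≤i = let c , p = walk-total j≤i in
      ⨁⁺ 𝔾 (consts ×ᵉ consts ×ᵉ enum-Fin 3) (v i , v j , c)
        (i , (refl , val⁺ i) , j ,
         inj₂ (whenᵖ⁺ 𝔾 {π = walk c ⁻¹} (does⁺ (compare? o β (toℕ c * M + toℕ (v i)) (toℕ (v j)))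
           (backward⁺ (Fin.toℕ<n (v i)) (Fin.toℕ<n (v j)) β<M o c (proj₂ (walk⁻ c p)) h)) p) ,
         (refl , val⁺ j))

    compared⁻ : ∀ o {β i j} → β < M → Joins (compared o β) i j → Compare o β (int i) (int j)
    compared⁻ o {β} {i} {j} β<M h with ⨁⁻ 𝔾 (consts ×ᵉ consts ×ᵉ enum-Fin 3) h
    ... | (a , b , c) , (_ , (refl , pa) , _ , p , (refl , pb)) with val⁻ i a pa | val⁻ j b pb
    ... | refl | refl with p
    ... | inj₁ q = let t , q′ = whenᵖ⁻ 𝔾 {b = does (compare? o β (toℕ (v i)) (toℕ c * M + toℕ (v j)))} {π = walk c} q in
      forward⁻ (Fin.toℕ<n (v i)) (Fin.toℕ<n (v j)) β<M o c (proj₂ (walk⁻ c q′))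
        (does⁻ (compare? o β (toℕ (v i)) (toℕ c * M + toℕ (v j))) t)
    ... | inj₂ q = let t , q′ = whenᵖ⁻ 𝔾 {b = does (compare? o β (toℕ c * M + toℕ (v i)) (toℕ (v j)))} {π = walk c ⁻¹} q in
      backward⁻ (Fin.toℕ<n (v i)) (Fin.toℕ<n (v j)) β<M o c (proj₂ (walk⁻ c q′))
        (does⁻ (compare? o β (toℕ c * M + toℕ (v i)) (toℕ (v j))) t)

  module Letters (τ : Word (order H)) (t : V H → Transition)
                 (tr⁺ : ∀ i → i ⊩ tr (t i)) (tr⁻ : ∀ i x → i ⊩ tr x → x ≡ t i)
                 (spell : ∀ i → letter (t i) ≗ τ i) where

    has⁺ : ∀ i a → a ∈ᴸ τ i → i ⊩ has a
    has⁺ i a p = ⋁⁺ 𝔾 transitions {f = λ t → when (letter t a) (tr t)} (t i)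
      (when⁺ 𝔾 {σ = tr (t i)} (subst T (sym (spell i a)) p) (tr⁺ i))

    has⁻ : ∀ i a → i ⊩ has a → a ∈ᴸ τ i
    has⁻ i a h with ⋁⁻ 𝔾 transitions {f = λ t → when (letter t a) (tr t)} h
    ... | x , p with when⁻ 𝔾 {b = letter x a} {σ = tr x} p
    ... | q , r′ = subst T (spell i a) (subst (λ x → T (letter x a)) (tr⁻ i x r′) q)

    -- `Prev` restated for the bare graph: `Prev` presupposes a `ValidSeq`, which soundness obtains
    -- only with the help of this module.
    Last : Clock ⊎ DS → V H → V H → Set
    Last (inj₁ x) i j = j Fin.< i × inj₂ (reset x) ∈ᴸ τ j × (∀ k → k Fin.< i → inj₂ (reset x) ∈ᴸ τ k → k Fin.≤ j)
    Last (inj₂ d) i j = E[_] H (data-edge d) j i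

    since⁺ : ∀ a {i j} → Last a i j → Joins (since a) j i
    since⁺ (inj₂ d) p = p
    since⁺ (inj₁ x) {i} {j} (j<i , rj , latest) with predecessor {j = j} {k = i} j<i
    ... | i′ , i′→i , j≤i′ = j , (refl , has⁺ j _ rj) , i′ ,
      all-hops⁺ {φ = ¬′ has (inj₂ (reset x))} j≤i′
        (λ m j<m m≤i′ p → ℕ.<⇒≱ j<m (latest m (ℕ.≤-<-trans m≤i′ (step⇒< i′→i)) (has⁻ m _ p))) ,
      next⁺ i′→i

    since⁻ : ∀ a {i j} → Joins (since a) j i → Last a i j
    since⁻ (inj₂ d) p = p
    since⁻ (inj₁ x) {i} {j} (_ , (refl , rj) , i′ , p , i′→i)
      with all-hops⁻ {φ = ¬′ has (inj₂ (reset x))} p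
    ... | j≤i′ , none = ℕ.≤-<-trans j≤i′ (step⇒< s) , has⁻ j _ rj , latest
      where
      s = next⁻ i′→i
      latest : ∀ k → k Fin.< i → inj₂ (reset x) ∈ᴸ τ k → k Fin.≤ j
      latest k k<i rk with toℕ k ℕ.≤? toℕ j
      ... | yes k≤j = k≤j
      ... | no  k≰j = contradiction (has⁺ k _ rk) (none k (ℕ.≰⇒> k≰j) (ℕ.≤-pred (subst (toℕ k <_) s k<i)))

    End : Term → V H → V H → Set
    End (inj₁ a) i k = i ≡ k
    End (inj₂ δ) i k = Last (subtrahend δ) i k

    until⁺ : ∀ D {i k} → End D i k → Joins (until D) i k
    until⁺ (inj₁ a) refl = refl , tt
    until⁺ (inj₂ δ) p    = since⁺ (subtrahend δ) p

    until⁻ : ∀ D {i k} → Joins (until D) i k → End D i k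
    until⁻ (inj₁ a) (e , _) = e
    until⁻ (inj₂ δ) p       = since⁻ (subtrahend δ) p

    -- The constraint, imposed at some node, bounds ts k − ts j.
    Spans : Constraint → V H → V H → Set
    Spans (D , ⋈ , β) j k = ∃ λ i → inj₂ (instruction D ⋈ β) ∈ᴸ τ i × Last (from D) i j × End D i k

    span⁺ : ∀ c {j k} → Spans c j k → Joins (span c) j k
    span⁺ (D , ⋈ , β) (i , p , l , e) = i , since⁺ (from D) l , i , (refl , has⁺ i _ p) , until⁺ D e

    span⁻ : ∀ c {j k} → Joins (span c) j k → Spans c j k
    span⁻ (D , ⋈ , β) (i , l , _ , (refl , p) , e) = i , has⁻ i _ p , since⁻ (from D) l , until⁻ D e

-- Soundness

not-does⁺ : ∀ {A : Set} (a? : Dec A) → ¬ A → T (not (does a?))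
not-does⁺ (yes a) ¬a = ¬a a
not-does⁺ (no _)  _  = tt

not-does⁻ : ∀ {A : Set} (a? : Dec A) → T (not (does a?)) → ¬ A
not-does⁻ (no ¬a) _ = ¬a

T-not⁺ : ∀ {b} → ¬ T b → T (not b)
T-not⁺ {true}  ¬b = ¬b tt
T-not⁺ {false} _  = tt

T-not⁻ : ∀ {b} → T (not b) → ¬ T b
T-not⁻ {false} _ ()

IsPath : {Σ DS : Set} → Graph Σ (Γ^ DS) → Set
IsPath H = ∀ i j → edge H i succ j ≡ does (toℕ j ℕ.≟ suc (toℕ i))

path-steps : ∀ {Σ DS : Set} {H : Graph Σ (Γ^ DS)} → IsPath H → ∀ i j → E[_] H succ i j ⇔ Step i j
path-steps path i j = mk⇔ (λ e → does⁻ (_ ℕ.≟ _) (subst T (path i j) e))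
                          (λ s → subst T (sym (path i j)) (does⁺ (_ ℕ.≟ _) s))

-- The least increments that the flags allow, summed up to and including the node; "at least 2" is
-- realised as 2.
total-jump : ∀ {n} → (Fin n → Fin 3) → Fin n → ℕ
total-jump c zero    = toℕ (c zero)
total-jump c (suc i) = toℕ (c zero) + total-jump (c ∘ suc) i

total-jump-step : ∀ {n} (c : Fin n → Fin 3) {i j} → Step i j → total-jump c j ≡ toℕ (c j) + total-jump c i
total-jump-step c {zero}  {suc zero} s = ℕ.+-comm (toℕ (c zero)) _
total-jump-step c {suc i} {suc j}    s =
  trans (cong (toℕ (c zero) +_) (total-jump-step (c ∘ suc) (ℕ.suc-injective s)))
        (exchange-left (toℕ (c zero)) (toℕ (c (suc j))) (total-jump (c ∘ suc) i))
  where
  exchange-left : ∀ a b c → a + (b + c) ≡ b + (a + c)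
  exchange-left = solve-∀

Jump-intro : ∀ c {p q} → q ≡ toℕ c + p → Jump c p q
Jump-intro zero             e = e
Jump-intro (suc zero)       e = e
Jump-intro (suc (suc zero)) e = ℕ.≤-reflexive (sym e)

<⇒≤[] : ∀ s {a b} → a < b → a ≤[ s ] b
<⇒≤[] false h = ℕ.<⇒≤ h
<⇒≤[] true  h = h

+-monoʳ-≤[] : ∀ s c {a b} → a ≤[ s ] b → (c + a) ≤[ s ] (c + b)
+-monoʳ-≤[] false c h = ℕ.+-monoʳ-≤ c h
+-monoʳ-≤[] true  c h = ℕ.+-monoʳ-< c h

-- A two-digit number in base n+1: a smaller leading digit wins, strictly, because `f` does not
-- exceed n.
lexicographic : ∀ s n {I J f g} → f ≤ n → I < J ⊎ (I ≡ J × f ≤[ s ] g) →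
                (I * suc n + f) ≤[ s ] (J * suc n + g)
lexicographic s n {I} f≤n (inj₂ (refl , h)) = +-monoʳ-≤[] s (I * suc n) h
lexicographic s n {I} {J} {f} {g} f≤n (inj₁ I<J) = <⇒≤[] s (begin-strict
  I * suc n + f          <⟨ ℕ.+-monoʳ-< (I * suc n) (s≤s f≤n) ⟩
  I * suc n + suc n      ≡⟨ ℕ.+-comm (I * suc n) (suc n) ⟩
  suc I * suc n          ≤⟨ ℕ.*-monoˡ-≤ (suc n) I<J ⟩
  J * suc n              ≤⟨ ℕ.m≤m+n (J * suc n) g ⟩
  J * suc n + g          ∎)
  where open ℕ.≤-Reasoning

module _ (s : Bool) (n : ℕ) {I J f g : ℕ} (β : ℕ) where

  private
    regroup : ∀ a b c d → (a + b) * c + d ≡ a * c + d + b * c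
    regroup = solve-∀

  lexicographic-+ʳ : f ≤ n → I < J + β ⊎ (I ≡ J + β × f ≤[ s ] g) →
                     (I * suc n + f) ≤[ s ] (J * suc n + g + β * suc n)
  lexicographic-+ʳ f≤n h =
    subst ((I * suc n + f) ≤[ s ]_) (regroup J β (suc n) g) (lexicographic s n {I} {J + β} {f} {g} f≤n h)

  lexicographic-+ˡ : g ≤ n → J + β < I ⊎ (J + β ≡ I × g ≤[ s ] f) →
                     (J * suc n + g + β * suc n) ≤[ s ] (I * suc n + f)
  lexicographic-+ˡ g≤n h =
    subst (_≤[ s ] (I * suc n + f)) (regroup J β (suc n) g) (lexicographic s n {J + β} {I} {g} {f} g≤n h)

module Soundness (𝒯 : TimedSystem) (H : Graph ⊥ (Γ^ (TimedSystem.DS 𝒯))) (path : IsPath H) (nonempty : 1 ≤ order H)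
                 (λ′ : V H → Fin (Encoding.#guessed 𝒯) → Bool)
                 (good : ∀ i → ¬ ⟦_⟧ˢ (expand H λ′) (Encoding.bad 𝒯) i) where
  open TimedSystem 𝒯
  open Encoding 𝒯
  open Semantics 𝒯 H (path-steps {H = H} path) λ′

  private
    good-run : ∀ i → ¬ i ⊩ bad-run
    good-run i p = good i (inj₁ p)

    good-matching : ∀ d i → ¬ i ⊩ bad-matching d
    good-matching d i p = good i (inj₂ (inj₁ (⋁⁺ 𝔾 (enum-Fin #DS) {f = bad-matching} d p)))

    good-value : ∀ i → ¬ i ⊩ bad-value
    good-value i p = good i (inj₂ (inj₂ (inj₁ p)))

    good-constraint : ∀ c i → ¬ i ⊩ bad-constraint c
    good-constraint c i p = good i (inj₂ (inj₂ (inj₂ (inj₁ (⋁⁺ 𝔾 constraints-enum {f = bad-constraint} c p)))))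

    acyclic : ∀ i → ¬ Joins (strict · weak ✶) i i
    acyclic i p = good i (inj₂ (inj₂ (inj₂ (inj₂ p))))

    -- Requirements reach this module as refuted defects. Truth in a finite graph is decidable, so
    -- the double negation can be removed.
    stable : ∀ {i} σ → ¬ i ⊩ ¬′ σ → i ⊩ σ
    stable {i} σ = decidable-stable (state? 𝔾 σ i)

    chosen : ∀ i → ∃ λ t → i ⊩ tr t
    chosen i = ⋁⁻ 𝔾 transitions {f = tr} (stable (⋁ transitions tr) (λ p → good-run i (inj₁ p)))

  t : V H → Transition
  t i = proj₁ (chosen i)

  private
    tr⁺ : ∀ i → i ⊩ tr (t i)
    tr⁺ i = proj₂ (chosen i)

    tr⁻ : ∀ i x → i ⊩ tr x → x ≡ t i
    tr⁻ i x p with x Fin.≟ t i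
    ... | yes e = e
    ... | no  ne = contradiction
      (inj₂ (inj₁ (⋁⁺ 𝔾 (transitions ×ᵉ transitions) {f = λ (t , t′) → when (not (does (t Fin.≟ t′))) (tr t ∧′ tr t′)}
        (x , t i) (when⁺ 𝔾 {σ = tr x ∧′ tr (t i)} (not-does⁺ (x Fin.≟ t i) ne) (∧⁺ 𝔾 {tr x} {tr (t i)} p (tr⁺ i))))))
      (good-run i)

    starts : ∀ i → toℕ i ≡ 0 → T (initial (source (t i)))
    starts i i≡0 = decidable-stable (T? _) λ ¬init → good-run i (inj₂ (inj₂ (inj₁
      (⋁⁺ 𝔾 transitions {f = λ t → when (not (initial (source t))) (tr t ∧′ ¬′ (⟨ next ⁻¹ ⟩ ⊤′))} (t i)
        (when⁺ 𝔾 {σ = tr (t i) ∧′ ¬′ (⟨ next ⁻¹ ⟩ ⊤′)} (T-not⁺ ¬init)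
          (∧⁺ 𝔾 {tr (t i)} {¬′ (⟨ next ⁻¹ ⟩ ⊤′)} (tr⁺ i)
            (λ (j , _ , s) → ℕ.1+n≢0 (trans (sym (next⁻ s)) i≡0))))))))

    ends : ∀ i → suc (toℕ i) ≡ order H → T (final (target (t i)))
    ends i i≡n = decidable-stable (T? _) λ ¬final → good-run i (inj₂ (inj₂ (inj₂ (inj₁
      (⋁⁺ 𝔾 transitions {f = λ t → when (not (final (target t))) (tr t ∧′ ¬′ (⟨ next ⟩ ⊤′))} (t i)
        (when⁺ 𝔾 {σ = tr (t i) ∧′ ¬′ (⟨ next ⟩ ⊤′)} (T-not⁺ ¬final)
          (∧⁺ 𝔾 {tr (t i)} {¬′ (⟨ next ⟩ ⊤′)} (tr⁺ i)
            (λ (j , _ , s) → ℕ.<-irrefl (trans (next⁻ s) i≡n) (Fin.toℕ<n j)))))))))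

    connects : ∀ i j → Step i j → target (t i) ≡ source (t j)
    connects i j s = decidable-stable (_ Fin.≟ _) λ ne → good-run i (inj₂ (inj₂ (inj₂ (inj₂
      (⋁⁺ 𝔾 (transitions ×ᵉ transitions)
        {f = λ (t , t′) → when (not (does (target t Fin.≟ source t′))) (tr t ∧′ ⟨ next ⟩ tr t′)} (t i , t j)
        (when⁺ 𝔾 {σ = tr (t i) ∧′ ⟨ next ⟩ tr (t j)} (not-does⁺ (target (t i) Fin.≟ source (t j)) ne)
          (∧⁺ 𝔾 {tr (t i)} {⟨ next ⟩ tr (t j)} (tr⁺ i) (j , tr⁺ j , next⁺ s))))))))

    accepts : ∀ {n} → 1 ≤ n → (t : Fin n → Transition) → (∀ i → toℕ i ≡ 0 → T (initial (source (t i)))) →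
              (∀ i → suc (toℕ i) ≡ n → T (final (target (t i)))) →
              (∀ i j → Step i j → target (t i) ≡ source (t j)) → Accepts (letter ∘ t)
    accepts {suc n} _ t init fin conn = ρ , init zero refl , fin (Fin.fromℕ n) (cong suc (Fin.toℕ-fromℕ n)) ,
      λ i → letter (t i) , subst (λ q → (q , letter (t i) , target (t i)) ∈ δ) (sym (enters i)) (∈-lookup {xs = δ} (t i)) , λ _ → refl
      where
      ρ : Fin (suc (suc n)) → Fin #states
      ρ zero    = source (t zero)
      ρ (suc i) = target (t i)
      enters : ∀ i → ρ (inject₁ i) ≡ source (t i)
      enters zero    = refl
      enters (suc i) = conn (inject₁ i) (suc i) (cong suc (sym (Fin.toℕ-inject₁ i)))

  τ : Word (order H)
  τ = letter ∘ t

  accepted : Accepts τ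
  accepted = accepts nonempty t starts ends connects

  open Letters τ t tr⁺ tr⁻ (λ _ _ → refl)
  open IsInstrSeq (wellFormed τ accepted) using (oneOp; σ)

  private
    σ⁺ : ∀ i o → inj₂ (op o) ∈ᴸ τ i → σ i ≡ o
    σ⁺ i o p = proj₂ (proj₂ (oneOp i)) p

    σ⁻ : ∀ i o → σ i ≡ o → i ⊩ has (inj₂ (op o))
    σ⁻ i o refl = has⁺ i _ (proj₁ (proj₂ (oneOp i)))

    module _ (d : DS) where
      _↷_ : Rel (V H) 0ℓ
      i ↷ j = T (edge H i (data-edge d) j)

      is-w : ∀ {i j} → i ↷ j → σ i ≡ w d
      is-w {i} {j} e = σ⁺ i _ (has⁻ i _ (stable (has (inj₂ (op (w d)))) λ ¬w →
        good-matching d i (inj₁ (∧⁺ 𝔾 {⟨ ⟶ (data-edge d) ⟩ ⊤′} {¬′ has (inj₂ (op (w d)))} (j , tt , e) ¬w))))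

      is-r : ∀ {i j} → i ↷ j → σ j ≡ r d
      is-r {i} {j} e = σ⁺ j _ (has⁻ j _ (stable (has (inj₂ (op (r d)))) λ ¬r →
        good-matching d j (inj₂ (inj₁ (∧⁺ 𝔾 {⟨ ⟶ (data-edge d) ⁻¹ ⟩ ⊤′} {¬′ has (inj₂ (op (r d)))} (i , tt , e) ¬r)))))

      ascends : ∀ {i j} → i ↷ j → i Fin.< j
      ascends {i} {j} e = ℕ.≰⇒> λ j≤i → good-matching d i (inj₂ (inj₂ (inj₁ (j , e , next✶⁺ j≤i))))

      read-unique : ∀ {i j j′} → i ↷ j → i ↷ j′ → j ≡ j′
      read-unique {i} {j} {j′} e e′ with ℕ.<-cmp (toℕ j) (toℕ j′)
      ... | tri≈ _ j≡j′ _ = Fin.toℕ-injective j≡j′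
      ... | tri< j<j′ _ _ = contradiction
        (inj₂ (inj₂ (inj₂ (inj₂ (inj₂ (inj₁ (i , e′ , j , e , later⁺ j<j′))))))) (good-matching d j′)
      ... | tri> _ _ j′<j = contradiction
        (inj₂ (inj₂ (inj₂ (inj₂ (inj₂ (inj₁ (i , e , j′ , e′ , later⁺ j′<j))))))) (good-matching d j)

      write-unique : ∀ {i i′ j} → i ↷ j → i′ ↷ j → i ≡ i′
      write-unique {i} {i′} {j} e e′ with ℕ.<-cmp (toℕ i) (toℕ i′)
      ... | tri≈ _ i≡i′ _ = Fin.toℕ-injective i≡i′
      ... | tri< i<i′ _ _ = contradiction
        (inj₂ (inj₂ (inj₂ (inj₂ (inj₂ (inj₂ (inj₁ (j , e′ , i , e , later⁺ i<i′)))))))) (good-matching d i′)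
      ... | tri> _ _ i′<i = contradiction
        (inj₂ (inj₂ (inj₂ (inj₂ (inj₂ (inj₂ (inj₁ (j , e , i′ , e′ , later⁺ i′<i)))))))) (good-matching d i)

      disciplined : ∀ k → (∀ i → ¬ i ⊩ bad-discipline k d) → Discipline {#DS} k _↷_
      disciplined stack ok {i} {j} {i′} {j′} e e′ (i<i′ , i′<j , j<j′) =
        ok i′ (j , (later⁺ i′<j , (j′ , e′ , later⁺ j<j′)) , i , e , later⁺ i<i′)
      disciplined queue ok {i} {j} {i′} {j′} e e′ i<i′ = ℕ.≰⇒> λ j′≤j →
        let u , s , p = later⁺ i<i′ in ok i (u , s , i′ , p , j′ , e′ , j , next✶⁺ j′≤j , e)

    matching : ∀ d → Matching kind σ d
    matching d = record
      { match      = λ i j → edge H i (data-edge d) j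
      ; sound      = λ e → is-w d e , is-r d e , ascends d e
      ; writes     = λ i σi → let j , _ , e = stable (⟨ ⟶ (data-edge d) ⟩ ⊤′) λ ¬e → good-matching d i
                                    (inj₂ (inj₂ (inj₂ (inj₁ (∧⁺ 𝔾 {has (inj₂ (op (w d)))} {¬′ (⟨ ⟶ (data-edge d) ⟩ ⊤′)} (σ⁻ i _ σi) ¬e)))))
                              in j , e , read-unique d e
      ; reads      = λ j σj → let i , _ , e = stable (⟨ ⟶ (data-edge d) ⁻¹ ⟩ ⊤′) λ ¬e → good-matching d j
                                    (inj₂ (inj₂ (inj₂ (inj₂ (inj₁ (∧⁺ 𝔾 {has (inj₂ (op (r d)))} {¬′ (⟨ ⟶ (data-edge d) ⁻¹ ⟩ ⊤′)} (σ⁻ j _ σj) ¬e))))))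
                              in i , e , write-unique d e
      ; discipline = disciplined d (kind d) (λ i p → good-matching d i (inj₂ (inj₂ (inj₂ (inj₂ (inj₂ (inj₂ (inj₂ p))))))))
      }

  validSeq : ValidSeq τ
  validSeq = record
    { isInstrSeq = wellFormed τ accepted
    ; valid      = matching⇒valid matching
    ; matching   = matching
    }

  private
    valued : ∀ i → ∃ λ a → i ⊩ val a
    valued i = ⋁⁻ 𝔾 consts {f = val} (stable (⋁ consts val) (λ p → good-value i (inj₁ p)))

    v : V H → Const
    v i = proj₁ (valued i)

    val⁻ : ∀ i a → i ⊩ val a → a ≡ v i
    val⁻ i a p with a Fin.≟ v i
    ... | yes e = e
    ... | no  ne = contradiction
      (inj₂ (inj₁ (⋁⁺ 𝔾 (consts ×ᵉ consts) {f = λ (a , b) → when (not (does (a Fin.≟ b))) (val a ∧′ val b)}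
        (a , v i) (when⁺ 𝔾 {σ = val a ∧′ val (v i)} (not-does⁺ (a Fin.≟ v i) ne) (∧⁺ 𝔾 {val a} {val (v i)} p (proj₂ (valued i)))))))
      (good-value i)

  open Values v (λ i → proj₂ (valued i)) val⁻ (total-jump class)
              (λ i j s → Jump-intro (class j) (total-jump-step class s))

  private
    n : ℕ
    n = order H

    int-step : ∀ {i j} → Step i j → int i ≤ int j
    int-step {i} {j} s = ℕ.≮⇒≥ λ j<i → good-value i (inj₂ (inj₂
      (j , next⁺ s , compared⁺ lt M≥1 (subst (int j <_) (sym (ℕ.+-identityʳ (int i))) j<i))))

    ahead : Route
    ahead = weak ✶ · strict · weak ✶

    abstract
      -- Counting strict predecessors is monotone along weak edges and, as no cycle
      -- has a strict edge, strictly monotone along strict ones.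
      frac : V H → ℕ
      frac v = count (λ u → does (path? 𝔾 ahead u v))

      frac≤n : ∀ i → frac i ≤ n
      frac≤n i = count≤n _

      weak-frac : ∀ {u v} → Joins weak u v → frac u ≤ frac v
      weak-frac {u} {v} p = count-mono λ x q →
        let y , a , z , b , c = does⁻ (path? 𝔾 ahead x u) q
        in does⁺ (path? 𝔾 ahead x v) (y , a , z , b , c ◅◅ (p ◅ ε))

      strict-frac : ∀ {u v} → Joins weak u v → Joins strict u v → frac u < frac v
      strict-frac {u} {v} p s = count-strict
        (λ x q → let y , a , z , b , c = does⁻ (path? 𝔾 ahead x u) q
                 in does⁺ (path? 𝔾 ahead x v) (y , a , z , b , c ◅◅ (p ◅ ε)))
        -- The node gained is `u` itself. It is counted for `v` through the strict edge; were it
        -- counted for `u`, rotating that cycle to begin with its strict edge would contradict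
        -- `acyclic`.
        u
        (λ q → let y , a , z , b , c = does⁻ (path? 𝔾 ahead u u) q in acyclic y (z , b , c ◅◅ a))
        (does⁺ (path? 𝔾 ahead u v) (u , ε , v , s , ε))

    link-frac : ∀ c h {u v} → T (h ∈ᶜ c) → Joins (link (c , h)) u v → frac u ≤[ isStrict h ] frac v
    link-frac c h {u} {v} h∈c p = by-strictness (isStrict h) refl
      where
      p-weak : Joins weak u v
      p-weak = inj₂ (⨁⁺ 𝔾 halves-enum {f = λ (c , h) → whenᵖ (h ∈ᶜ c) (link (c , h))} (c , h) (whenᵖ⁺ 𝔾 {π = link (c , h)} h∈c p))
      by-strictness : ∀ s → isStrict h ≡ s → frac u ≤[ s ] frac v
      by-strictness false _ = weak-frac p-weak
      by-strictness true  e = strict-frac p-weak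
        (⨁⁺ 𝔾 halves-enum {f = λ (c , h) → whenᵖ (h ∈ᶜ c) (whenᵖ (isStrict h) (link (c , h)))} (c , h)
          (whenᵖ⁺ 𝔾 {π = whenᵖ (isStrict h) (link (c , h))} h∈c (whenᵖ⁺ 𝔾 {π = link (c , h)} (subst T (sym e) tt) p)))

    -- The timestamp multiplied by n+1. Since `frac` is at most n, it contributes less than one time
    -- unit.
    stamp : V H → ℕ
    stamp i = int i * suc n + frac i

    stamp-mono : ∀ {i j} → i Fin.≤ j → stamp i ≤ stamp j
    stamp-mono {i} = upward-induction (λ j → stamp i ≤ stamp j) ℕ.≤-refl λ {u} {v} s _ h → ℕ.≤-trans h
      (lexicographic false n {int u} {int v} {frac u} {frac v} (frac≤n u) (Sum.map₂ (λ e → e , weak-frac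
        (inj₁ (next⁺ s , compared⁺ eq M≥1 (trans (sym e) (sym (ℕ.+-identityʳ (int u))))))) (ℕ.m≤n⇒m<n∨m≡n (int-step s))))

    not-violated : ∀ c h {j k} → T (h ∈ᶜ c) → Spans c j k →
                   ¬ Compare (violation h) (toℕ (proj₂ (proj₂ c))) (int j) (int k)
    not-violated c h {j} {k} h∈c sp l = good-constraint c j (inj₂ (inj₂ (⋁⁺ 𝔾 enum-Half
      {f = λ h → when (h ∈ᶜ c) (loop (span c · compared (violation h) (toℕ (proj₂ (proj₂ c))) ⁻¹))} h
      (when⁺ 𝔾 {σ = loop (span c · compared (violation h) (toℕ (proj₂ (proj₂ c))) ⁻¹)} h∈c
        (k , span⁺ c sp , compared⁺ (violation h) {toℕ (proj₂ (proj₂ c))} {j} {k} (Fin.toℕ<n (proj₂ (proj₂ c))) l)))))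

    -- Violation by the integer parts is excluded. Hence either they leave room, and the fractions
    -- do not matter, or they differ by exactly β, and then a link compares the fractions as
    -- required.
    satisfies-half : ∀ D ⋈ β h {j k} → T (h ∈ʰ ⋈) → Spans (D , ⋈ , β) j k →
                     Bounded h (fractionᴿ n (stamp k) -ᴿ fractionᴿ n (stamp j)) (fromℕᴿ (toℕ β))
    satisfies-half D ⋈ β (upper s) {j} {k} h∈c sp =
      upper-bound s n {stamp k} {stamp j} (toℕ β)
        (lexicographic-+ʳ s n {int k} {int j} {frac k} {frac j} (toℕ β) (frac≤n k) cases)
      where
      tie : int k ≡ int j + toℕ β → frac k ≤[ s ] frac j
      tie e = link-frac (D , ⋈ , β) (upper s) {k} {j} h∈c
        (span⁺ (D , ⋈ , β) {j} {k} sp , compared⁺ eq {toℕ β} {j} {k} (Fin.toℕ<n β) e)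
      int≤ : int k ≤ int j + toℕ β
      int≤ = ℕ.≮⇒≥ {int j + toℕ β} {int k} (not-violated (D , ⋈ , β) (upper s) {j} {k} h∈c sp)
      cases : int k < int j + toℕ β ⊎ (int k ≡ int j + toℕ β × frac k ≤[ s ] frac j)
      cases = Sum.map₂ (λ e → e , tie e) (ℕ.m≤n⇒m<n∨m≡n {int k} {int j + toℕ β} int≤)
    satisfies-half D ⋈ β (lower s) {j} {k} h∈c sp =
      lower-bound s n {stamp k} {stamp j} (toℕ β)
        (lexicographic-+ˡ s n {int k} {int j} {frac k} {frac j} (toℕ β) (frac≤n j) cases)
      where
      tie : int j + toℕ β ≡ int k → frac j ≤[ s ] frac k
      tie e = link-frac (D , ⋈ , β) (lower s) {j} {k} h∈c
        (span⁺ (D , ⋈ , β) {j} {k} sp , compared⁺ eq {toℕ β} {j} {k} (Fin.toℕ<n β) (sym e))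
      int≤ : int j + toℕ β ≤ int k
      int≤ = ℕ.≮⇒≥ {int k} {int j + toℕ β} (not-violated (D , ⋈ , β) (lower s) {j} {k} h∈c sp)
      cases : int j + toℕ β < int k ⊎ (int j + toℕ β ≡ int k × frac j ≤[ s ] frac k)
      cases = Sum.map₂ (λ e → e , tie e) (ℕ.m≤n⇒m<n∨m≡n {int j + toℕ β} {int k} int≤)

    satisfied : ∀ D ⋈ β i → inj₂ (instruction D ⋈ β) ∈ᴸ τ i →
                ∃₂ λ j k → Last (from D) i j × End D i k × (fractionᴿ n (stamp k) -ᴿ fractionᴿ n (stamp j)) ⟨ ⋈ ⟩ᴿ fromℕᴿ (toℕ β)
    satisfied D ⋈ β i p = j , k , l , e , bounded⇒cmp ⋈ (fractionᴿ n (stamp k) -ᴿ fractionᴿ n (stamp j)) (fromℕᴿ (toℕ β))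
        (λ h h∈ → satisfies-half D ⋈ β h {j} {k} h∈ (i , p , l , e))
      where
      c : Constraint
      c = D , ⋈ , β
      start : ∃ λ j → ⊤ × Joins (since (from D)) j i
      start = stable (⟨ since (from D) ⁻¹ ⟩ ⊤′) λ ¬s →
        good-constraint c i (inj₁ (∧⁺ 𝔾 {imposed c} {¬′ (⟨ since (from D) ⁻¹ ⟩ ⊤′)} (has⁺ i _ p) ¬s))
      stop : ∃ λ k → ⊤ × Joins (until D) i k
      stop = stable (⟨ until D ⟩ ⊤′) λ ¬s →
        good-constraint c i (inj₂ (inj₁ (∧⁺ 𝔾 {imposed c} {¬′ (⟨ until D ⟩ ⊤′)} (has⁺ i _ p) ¬s)))
      j k : V H
      j = proj₁ start
      k = proj₁ stop
      l : Last (from D) i j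
      l = since⁻ (from D) (proj₂ (proj₂ start))
      e : End D i k
      e = until⁻ D (proj₂ (proj₂ stop))

    last⇒prev : ∀ a {i j} → Last a i j → Prev validSeq a i j
    last⇒prev (inj₁ x) p = p
    last⇒prev (inj₂ d) p = p

  feasible : Feasible validSeq
  feasible = record
    { ts          = λ i → fractionᴿ n (stamp i)
    ; nonNegative = λ i → fractionᴿ-nonNeg n (stamp i)
    ; monotone    = λ i j i≤j → fractionᴿ-mono n {stamp i} {stamp j} (stamp-mono i≤j)
    ; constraints = λ i a ⋈ β p → case-constraint a i ⋈ β (satisfied (inj₁ a) ⋈ β i p)
    ; diffs       = λ i δ ⋈ β p → let j , k , l , e , b = satisfied (inj₂ δ) ⋈ β i p
                                  in j , k , last⇒prev (minuend δ) l , last⇒prev (subtrahend δ) e , b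
    }
    where
    case-constraint : ∀ a i ⋈ β → (∃₂ λ j k → Last a i j × i ≡ k × (fractionᴿ n (stamp k) -ᴿ fractionᴿ n (stamp j)) ⟨ ⋈ ⟩ᴿ fromℕᴿ (toℕ β)) →
                      ∃ λ j → Prev validSeq a i j × (fractionᴿ n (stamp i) -ᴿ fractionᴿ n (stamp j)) ⟨ ⋈ ⟩ᴿ fromℕᴿ (toℕ β)
    case-constraint a i ⋈ β (j , _ , l , refl , b) = j , last⇒prev a l , b

  sequence : L
  sequence = record { accepted = accepted ; validSeq = validSeq }

  reading : Interpretation (restrict inj₁ (L.G sequence)) 𝔾 (λ p → has (inj₁ p))
  reading = record
    { to      = λ i → i
    ; from    = λ i → i
    ; to-from = λ _ → refl
    ; from-to = λ _ → refl
    ; edges   = λ { i succ j → sym (path i j) ; i (data-edge d) j → refl }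
    ; labels⁺ = λ i p → has⁺ i (inj₁ p)
    ; labels⁻ = λ i p → has⁻ i (inj₁ p)
    }

-- Completeness

classify : ∀ {A B : Set} → Dec A → Dec B → Fin 3
classify (yes _) _       = zero
classify (no _)  (yes _) = suc zero
classify (no _)  (no _)  = suc (suc zero)

jump-between : ℕ → ℕ → Fin 3
jump-between p q = classify (q ℕ.≟ p) (q ℕ.≟ suc p)

Jump-between : ∀ {p q} → p ≤ q → Jump (jump-between p q) p q
Jump-between {p} {q} p≤q = by-class (q ℕ.≟ p) (q ℕ.≟ suc p)
  where
  by-class : (d : Dec (q ≡ p)) (e : Dec (q ≡ suc p)) → Jump (classify d e) p q
  by-class (yes q≡p) _           = q≡p
  by-class (no _)    (yes q≡1+p) = q≡1+p
  by-class (no q≢p)  (no q≢1+p)  = ℕ.≤∧≢⇒< (ℕ.≤∧≢⇒< p≤q (q≢p ∘ sym)) (q≢1+p ∘ sym)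

step⇒pred : ∀ {n} {u v : Fin n} → Step u v → Fin.pred v ≡ u
step⇒pred {v = suc v} s = Fin.toℕ-injective (trans (Fin.toℕ-inject₁ v) (ℕ.suc-injective s))

has-predecessor : ∀ {n} (i : Fin n) → toℕ i ≡ 0 ⊎ ∃ λ u → Step u i
has-predecessor zero    = inj₁ refl
has-predecessor (suc i) = inj₂ (inject₁ i , cong suc (sym (Fin.toℕ-inject₁ i)))

has-successor : ∀ {n} (i : Fin n) → suc (toℕ i) ≡ n ⊎ ∃ λ u → Step i u
has-successor i with ℕ.m≤n⇒m<n∨m≡n (Fin.toℕ<n i)
... | inj₁ l = inj₂ (Fin.fromℕ< l , Fin.toℕ-fromℕ< l)
... | inj₂ e = inj₁ e

module _ (𝒯 : TimedSystem) (sequence : TimedSystem.L 𝒯) (ts : Fin (TimedSystem.L.len sequence) → ℝ) where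
  open TimedSystem 𝒯
  open L sequence

  SatisfiesConstraints SatisfiesDiffs : Set
  SatisfiesConstraints = ∀ i a ⋈ β → inj₂ (constraint a ⋈ β) ∈ᴸ word i →
    ∃ λ j → Prev validSeq a i j × (ts i -ᴿ ts j) ⟨ ⋈ ⟩ᴿ fromℕᴿ (toℕ β)
  SatisfiesDiffs = ∀ i δ ⋈ β → inj₂ (diff δ ⋈ β) ∈ᴸ word i →
    ∃₂ λ j k → Prev validSeq (minuend δ) i j × Prev validSeq (subtrahend δ) i k × (ts k -ᴿ ts j) ⟨ ⋈ ⟩ᴿ fromℕᴿ (toℕ β)

-- A Feasible record is passed by its fields: with ts a variable, conversion
-- checking does not unfold the arithmetic of reals.
module Completeness (𝒯 : TimedSystem) (sequence : TimedSystem.L 𝒯)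
                    (ts : Fin (TimedSystem.L.len sequence) → ℝ)
                    (monotone : ∀ i j → i Fin.≤ j → ts i ≤ᴿ ts j)
                    (constraints : SatisfiesConstraints 𝒯 sequence ts)
                    (diffs : SatisfiesDiffs 𝒯 sequence ts)
                    (q : Fin (TimedSystem.L.len sequence) → ℕ)
                    (floors : ∀ i → IsFloor (ts i) (q i)) where
  open TimedSystem 𝒯
  open Encoding 𝒯
  open L sequence renaming (word to τ)
  open ValidSeq validSeq using (σ; oneOp; nonempty; matching)

  H : Graph ⊥ Γ
  H = restrict ⊥-elim (L.G sequence)

  private
    instance
      M≢0 : NonZero M
      M≢0 = >-nonZero M≥1

    ρ : Fin (suc len) → Fin #states
    ρ = proj₁ accepted

    fires : ∀ i → ∃ λ a → (ρ (inject₁ i) , a , ρ (suc i)) ∈ δ × a ≗ τ i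
    fires = proj₂ (proj₂ (proj₂ accepted))

    t : V H → Transition
    t i = Any.index (proj₁ (proj₂ (fires i)))

    transition : ∀ i → (ρ (inject₁ i) , proj₁ (fires i) , ρ (suc i)) ≡ lookup δ (t i)
    transition i = lookup-index (proj₁ (proj₂ (fires i)))

    t-source : ∀ i → source (t i) ≡ ρ (inject₁ i)
    t-source i = sym (cong proj₁ (transition i))

    t-target : ∀ i → target (t i) ≡ ρ (suc i)
    t-target i = sym (cong (proj₂ ∘ proj₂) (transition i))

    spell : ∀ i → letter (t i) ≗ τ i
    spell i a = trans (sym (cong (λ x → proj₁ (proj₂ x) a) (transition i)))
                      (proj₂ (proj₂ (fires i)) a)

    v : V H → Const
    v i = q i mod M

    Q : V H → ℕ
    Q i = q i / M

    -- If q j + 1 ≤ q i, then 0 ≤ ts i - q i ≤ ts j - q i ≤ ts j - (q j + 1) < 0.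
    q-mono : ∀ {i j} → i Fin.≤ j → q i ≤ q j
    q-mono {i} {j} i≤j = ℕ.≮⇒≥ λ qj<qi → ≺-irrefl {𝟎}
      (≼-≺-trans {𝟎} {ts i ↓ q i} (floor-≤ (floors i))
      (≼-≺-trans {ts i ↓ q i} {ts j ↓ q i} (↓-mono (ts i) (ts j) (q i) (monotone i j i≤j))
      (≼-≺-trans {ts j ↓ q i} {ts j ↓ suc (q j)} (↓-antitone (ts j) qj<qi) (floor-< (floors j)))))

    c : V H → Fin 3
    -- `Fin.pred` sends the first node to itself, which therefore gets class zero.
    c i = jump-between (Q (Fin.pred i)) (Q i)

  λ′ : V H → Fin #guessed → Bool
  -- Flag `b` marks class `suc b`; class zero is the absence of both flags.
  λ′ i x = [ (λ y → does (y Fin.≟ t i)) , [ (λ a → does (a Fin.≟ v i)) , (λ b → does (suc b Fin.≟ c i)) ] ∘ Fin.splitAt M ]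
           (Fin.splitAt #transitions x)

  private
    λ′-tr : ∀ i x → λ′ i (trᵛ x) ≡ does (x Fin.≟ t i)
    λ′-tr i x rewrite Fin.splitAt-↑ˡ #transitions x (M + 2) = refl

    λ′-val : ∀ i a → λ′ i (valᵛ a) ≡ does (a Fin.≟ v i)
    λ′-val i a rewrite Fin.splitAt-↑ʳ #transitions (M + 2) (a Fin.↑ˡ 2) | Fin.splitAt-↑ˡ M a 2 = refl

    λ′-flag : ∀ i b → λ′ i (flagᵛ b) ≡ does (suc b Fin.≟ c i)
    λ′-flag i b rewrite Fin.splitAt-↑ʳ #transitions (M + 2) (M Fin.↑ʳ b) | Fin.splitAt-↑ʳ M 2 b = refl

    is-path : IsPath H
    is-path i j = refl

  open Semantics 𝒯 H (path-steps {H = H} is-path) λ′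

  private
    class≡c : ∀ i → class i ≡ c i
    class≡c i = trans (cong₂ jump-class (λ′-flag i zero) (λ′-flag i (suc zero))) (decode (c i))
      where
      decode : ∀ c → jump-class (does (suc zero Fin.≟ c)) (does (suc (suc zero) Fin.≟ c)) ≡ c
      decode zero             = refl
      decode (suc zero)       = refl
      decode (suc (suc zero)) = refl

    jumps : ∀ i j → Step i j → Jump (class j) (Q i) (Q j)
    jumps i j s rewrite class≡c j | step⇒pred s = Jump-between (/-monoˡ-≤ M (q-mono (ℕ.<⇒≤ (step⇒< s))))

    tr⁺ : ∀ i → i ⊩ tr (t i)
    tr⁺ i = subst T (sym (λ′-tr i (t i))) (does⁺ (t i Fin.≟ t i) refl)

    tr⁻ : ∀ i x → i ⊩ tr x → x ≡ t i
    tr⁻ i x p = does⁻ (x Fin.≟ t i) (subst T (λ′-tr i x) p)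

    val⁺ : ∀ i → i ⊩ val (v i)
    val⁺ i = subst T (sym (λ′-val i (v i))) (does⁺ (v i Fin.≟ v i) refl)

    val⁻ : ∀ i a → i ⊩ val a → a ≡ v i
    val⁻ i a p = does⁻ (a Fin.≟ v i) (subst T (λ′-val i a) p)

  open Values v val⁺ val⁻ Q jumps
  open Letters τ t tr⁺ tr⁻ spell

  private
    int≡q : ∀ i → int i ≡ q i
    int≡q i = begin
      Q i * M + toℕ (v i)       ≡⟨ cong (Q i * M +_) (Fin.toℕ-fromℕ< _) ⟩
      Q i * M + q i % M         ≡⟨ ℕ.+-comm (Q i * M) (q i % M) ⟩
      q i % M + Q i * M         ≡⟨ m≡m%n+[m/n]*n (q i) M ⟨
      q i                       ∎
      where open ≡-Reasoning

    ordered : ∀ o {β i j} → β < M → Joins (compared o β) i j → Compare o β (q i) (q j)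
    ordered o {β} {i} {j} β<M p = subst₂ (Compare o β) (int≡q i) (int≡q j) (compared⁻ o β<M p)

    run-good : ∀ i → ¬ i ⊩ bad-run
    run-good i (inj₁ p) = p (⋁⁺ 𝔾 transitions {f = tr} (t i) (tr⁺ i))
    run-good i (inj₂ (inj₁ p)) with ⋁⁻ 𝔾 (transitions ×ᵉ transitions) {f = λ (t , t′) → when (not (does (t Fin.≟ t′))) (tr t ∧′ tr t′)} p
    ... | (x , y) , p′ with when⁻ 𝔾 {b = not (does (x Fin.≟ y))} {σ = tr x ∧′ tr y} p′
    ... | x≢y , (_ , py , refl , px) = not-does⁻ (x Fin.≟ y) x≢y (trans (tr⁻ i x px) (sym (tr⁻ i y py)))
    run-good i (inj₂ (inj₂ (inj₁ p)))
      with ⋁⁻ 𝔾 transitions {f = λ t → when (not (initial (source t))) (tr t ∧′ ¬′ (⟨ next ⁻¹ ⟩ ⊤′))} p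
    ... | x , p′ with when⁻ 𝔾 {b = not (initial (source x))} {σ = tr x ∧′ ¬′ (⟨ next ⁻¹ ⟩ ⊤′)} p′
    ... | ¬init , (_ , none , refl , px) with has-predecessor i | tr⁻ i x px
    ... | inj₂ (u , s) | _    = none (u , tt , next⁺ s)
    ... | inj₁ i≡0     | refl = T-not⁻ ¬init (subst (T ∘ initial) (sym (trans (t-source i) (cong ρ
      (Fin.toℕ-injective {j = zero} (trans (Fin.toℕ-inject₁ i) i≡0))))) (proj₁ (proj₂ accepted)))
    run-good i (inj₂ (inj₂ (inj₂ (inj₁ p))))
      with ⋁⁻ 𝔾 transitions {f = λ t → when (not (final (target t))) (tr t ∧′ ¬′ (⟨ next ⟩ ⊤′))} p
    ... | x , p′ with when⁻ 𝔾 {b = not (final (target x))} {σ = tr x ∧′ ¬′ (⟨ next ⟩ ⊤′)} p′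
    ... | ¬final , (_ , none , refl , px) with has-successor i | tr⁻ i x px
    ... | inj₂ (u , s) | _    = none (u , tt , next⁺ s)
    ... | inj₁ i≡n     | refl = T-not⁻ ¬final (subst (T ∘ final) (sym (trans (t-target i) (cong ρ
      (Fin.toℕ-injective (trans i≡n (sym (Fin.toℕ-fromℕ len))))))) (proj₁ (proj₂ (proj₂ accepted))))
    run-good i (inj₂ (inj₂ (inj₂ (inj₂ p))))
      with ⋁⁻ 𝔾 (transitions ×ᵉ transitions)
             {f = λ (t , t′) → when (not (does (target t Fin.≟ source t′))) (tr t ∧′ ⟨ next ⟩ tr t′)} p
    ... | (x , y) , p′ with when⁻ 𝔾 {b = not (does (target x Fin.≟ source y))} {σ = tr x ∧′ ⟨ next ⟩ tr y} p′
    ... | ne , (_ , (j , py , s) , refl , px) with tr⁻ i x px | tr⁻ j y py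
    ... | refl | refl = not-does⁻ (target (t i) Fin.≟ source (t j)) ne
      (trans (t-target i) (trans (cong ρ (Fin.toℕ-injective (trans (sym (next⁻ s)) (sym (Fin.toℕ-inject₁ j))))) (sym (t-source j))))

    σ⁺ : ∀ i o → σ i ≡ o → i ⊩ has (inj₂ (op o))
    σ⁺ i o refl = has⁺ i _ (proj₁ (proj₂ (oneOp i)))

    σ⁻ : ∀ i o → i ⊩ has (inj₂ (op o)) → σ i ≡ o
    σ⁻ i o p = proj₂ (proj₂ (oneOp i)) (has⁻ i _ p)

    module _ (d : DS) where
      open Matching (matching d)

      read-unique : ∀ {i j j′} → i ↷ j → i ↷ j′ → j ≡ j′
      read-unique {i} e e′ = trans (sym (unique e)) (unique e′)
        where unique = λ {y} → proj₂ (proj₂ (writes i (proj₁ (sound e)))) {y}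

      write-unique : ∀ {i i′ j} → i ↷ j → i′ ↷ j → i ≡ i′
      write-unique {j = j} e e′ = trans (sym (unique e)) (unique e′)
        where unique = λ {y} → proj₂ (proj₂ (reads j (proj₁ (proj₂ (sound e))))) {y}

      discipline-good : ∀ k → Discipline {#DS} k _↷_ → ∀ i → ¬ i ⊩ bad-discipline k d
      discipline-good stack ok i′ (j , (i′<j , (j′ , e′ , j<j′)) , i , e , i<i′) =
        ok e e′ (later⁻ i<i′ , later⁻ i′<j , later⁻ j<j′)
      discipline-good queue ok i (u , s , i′ , p , j′ , e′ , j , j′≤j , e) =
        ℕ.<⇒≱ (ok e e′ (later⁻ (u , s , p))) (next✶⁻ j′≤j)

      matching-good : ∀ i → ¬ i ⊩ bad-matching d
      matching-good i (inj₁ (_ , ¬w , refl , j , _ , e)) = ¬w (σ⁺ i _ (proj₁ (sound e)))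
      matching-good j (inj₂ (inj₁ (_ , ¬r , refl , i , _ , e))) = ¬r (σ⁺ j _ (proj₁ (proj₂ (sound e))))
      matching-good i (inj₂ (inj₂ (inj₁ (j , e , j≤i)))) = ℕ.<⇒≱ (proj₂ (proj₂ (sound e))) (next✶⁻ j≤i)
      matching-good i (inj₂ (inj₂ (inj₂ (inj₁ (_ , none , refl , p))))) =
        let j , e , _ = writes i (σ⁻ i _ p) in none (j , tt , e)
      matching-good j (inj₂ (inj₂ (inj₂ (inj₂ (inj₁ (_ , none , refl , p)))))) =
        let i , e , _ = reads j (σ⁻ j _ p) in none (i , tt , e)
      matching-good j (inj₂ (inj₂ (inj₂ (inj₂ (inj₂ (inj₁ (i , e , j′ , e′ , l))))))) =
        ℕ.<-irrefl (cong toℕ (read-unique e′ e)) (later⁻ l)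
      matching-good i (inj₂ (inj₂ (inj₂ (inj₂ (inj₂ (inj₂ (inj₁ (j , e , i′ , e′ , l)))))))) =
        ℕ.<-irrefl (cong toℕ (write-unique e′ e)) (later⁻ l)
      matching-good i (inj₂ (inj₂ (inj₂ (inj₂ (inj₂ (inj₂ (inj₂ p))))))) = discipline-good (kind d) discipline i p

    value-good : ∀ i → ¬ i ⊩ bad-value
    value-good i (inj₁ p) = p (⋁⁺ 𝔾 consts {f = val} (v i) (val⁺ i))
    value-good i (inj₂ (inj₁ p)) with ⋁⁻ 𝔾 (consts ×ᵉ consts) {f = λ (a , b) → when (not (does (a Fin.≟ b))) (val a ∧′ val b)} p
    ... | (a , b) , p′ with when⁻ 𝔾 {b = not (does (a Fin.≟ b))} {σ = val a ∧′ val b} p′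
    ... | a≢b , (_ , pb , refl , pa) = not-does⁻ (a Fin.≟ b) a≢b (trans (val⁻ i a pa) (sym (val⁻ i b pb)))
    value-good i (inj₂ (inj₂ (j , s , p))) =
      ℕ.<⇒≱ (subst (q j <_) (ℕ.+-identityʳ (q i)) (ordered lt {0} {i} {j} M≥1 p)) (q-mono (ℕ.<⇒≤ (step⇒< (next⁻ s))))

    prev⇒last : ∀ a {i j} → Prev validSeq a i j → Last a i j
    prev⇒last (inj₁ x) p = p
    prev⇒last (inj₂ d) p = p

    last-unique : ∀ a {i j j′} → Last a i j → Last a i j′ → j ≡ j′
    last-unique (inj₁ x) (j<i , rj , latest) (j′<i , rj′ , latest′) =
      Fin.toℕ-injective (ℕ.≤-antisym (latest′ _ j<i rj) (latest _ j′<i rj′))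
    last-unique (inj₂ d) p p′ = write-unique d p p′

    end-unique : ∀ D {i k k′} → End D i k → End D i k′ → k ≡ k′
    end-unique (inj₁ a) refl refl = refl
    end-unique (inj₂ δ) p p′ = last-unique (subtrahend δ) p p′

    satisfied : ∀ D ⋈ β i → inj₂ (instruction D ⋈ β) ∈ᴸ τ i →
                ∃₂ λ j k → Last (from D) i j × End D i k × (ts k -ᴿ ts j) ⟨ ⋈ ⟩ᴿ fromℕᴿ (toℕ β)
    satisfied (inj₁ a) ⋈ β i p with constraints i a ⋈ β p
    ... | j , l , b = j , i , prev⇒last a {i} {j} l , refl , b
    satisfied (inj₂ δ) ⋈ β i p with diffs i δ ⋈ β p
    ... | j , k , l , e , b = j , k , prev⇒last (minuend δ) {i} {j} l , prev⇒last (subtrahend δ) {i} {k} e , b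

    transport : ∀ ⋈ (β : Const) {j k} j′ k′ → j′ ≡ j → k′ ≡ k →
                (ts k′ -ᴿ ts j′) ⟨ ⋈ ⟩ᴿ fromℕᴿ (toℕ β) → (ts k -ᴿ ts j) ⟨ ⋈ ⟩ᴿ fromℕᴿ (toℕ β)
    transport ⋈ β _ _ refl refl b = b

    -- Feasibility names its own two nodes for the constraint at i. They are the ends of the span
    -- because p_a(i) and p_b(i) are unique.
    spans⇒cmp : ∀ D ⋈ β {j k} → Spans (D , ⋈ , β) j k → (ts k -ᴿ ts j) ⟨ ⋈ ⟩ᴿ fromℕᴿ (toℕ β)
    spans⇒cmp D ⋈ β {j} {k} (i , p , l , e) = finish (satisfied D ⋈ β i p)
      where
      finish : (∃₂ λ j k → Last (from D) i j × End D i k × (ts k -ᴿ ts j) ⟨ ⋈ ⟩ᴿ fromℕᴿ (toℕ β)) →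
               (ts k -ᴿ ts j) ⟨ ⋈ ⟩ᴿ fromℕᴿ (toℕ β)
      finish (j′ , k′ , l′ , e′ , b) =
        transport ⋈ β {j} {k} j′ k′ (last-unique (from D) {i} {j′} {j} l′ l) (end-unique D {i} {k′} {k} e′ e) b

    spans⇒bounded : ∀ D ⋈ β h {j k} → T (h ∈ʰ ⋈) → Spans (D , ⋈ , β) j k → Bounded h (ts k -ᴿ ts j) (fromℕᴿ (toℕ β))
    spans⇒bounded D ⋈ β h {j} {k} h∈ sp = cmp⇒bounded ⋈ h (ts k -ᴿ ts j) (fromℕᴿ (toℕ β)) h∈ (spans⇒cmp D ⋈ β {j} {k} sp)

    -- For an upper bound, q k ≥ q j + 1 + β would give 0 ≤ ts k - q k ≤ ts k - (q j + 1 + β) ≤ ts j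
    -- - (q j + 1) < 0. The weak form of the bound is enough, and lower bounds are dual.
    not-violated : ∀ D ⋈ β h {j k} → T (h ∈ʰ ⋈) → Spans (D , ⋈ , β) j k → ¬ Compare (violation h) (toℕ β) (q j) (q k)
    not-violated D ⋈ β (upper s) {j} {k} h∈ sp l = ≺-irrefl {𝟎}
      (≼-≺-trans {𝟎} {ts k ↓ q k} (floor-≤ (floors k))
      (≼-≺-trans {ts k ↓ q k} {ts k ↓ (suc (q j) + toℕ β)} (↓-antitone (ts k) l)
      (≼-≺-trans {ts k ↓ (suc (q j) + toℕ β)} {ts j ↓ suc (q j)}
        (≼[]⇒≼ s (upper-bounded s (ts k) (ts j) (suc (q j)) (toℕ β) (spans⇒bounded D ⋈ β (upper s) {j} {k} h∈ sp)))
        (floor-< (floors j)))))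
    not-violated D ⋈ β (lower s) {j} {k} h∈ sp l = ≺-irrefl {𝟎}
      (≼-≺-trans {𝟎} {ts j ↓ q j} (floor-≤ (floors j))
      (≼-≺-trans {ts j ↓ q j} {ts k ↓ (q j + toℕ β)}
        (≼[]⇒≼ s (lower-bounded s (ts k) (ts j) (q j) (toℕ β) (spans⇒bounded D ⋈ β (lower s) {j} {k} h∈ sp)))
      (≼-≺-trans {ts k ↓ (q j + toℕ β)} {ts k ↓ suc (q k)} (↓-antitone (ts k) l) (floor-< (floors k)))))

    constraint-good : ∀ c i → ¬ i ⊩ bad-constraint c
    constraint-good (D , ⋈ , β) i (inj₁ (_ , none , refl , p)) =
      let j , k , l , e , _ = satisfied D ⋈ β i (has⁻ i _ p) in none (j , tt , since⁺ (from D) l)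
    constraint-good (D , ⋈ , β) i (inj₂ (inj₁ (_ , none , refl , p))) =
      let j , k , l , e , _ = satisfied D ⋈ β i (has⁻ i _ p) in none (k , tt , until⁺ D e)
    constraint-good (D , ⋈ , β) j (inj₂ (inj₂ p))
      with ⋁⁻ 𝔾 enum-Half {f = λ h → when (h ∈ʰ ⋈) (loop (span (D , ⋈ , β) · compared (violation h) (toℕ β) ⁻¹))} p
    ... | h , p′ with when⁻ 𝔾 {b = h ∈ʰ ⋈} {σ = loop (span (D , ⋈ , β) · compared (violation h) (toℕ β) ⁻¹)} p′
    ... | h∈ , (k , sp , cmp) =
      not-violated D ⋈ β h {j} {k} h∈ (span⁻ (D , ⋈ , β) sp) (ordered (violation h) {toℕ β} {j} {k} (Fin.toℕ<n β) cmp)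

    frac : V H → ℕ → ℚ
    frac i = ts i ↓ q i

    link-frac : ∀ D ⋈ β h {u v} → T (h ∈ʰ ⋈) → Joins (link ((D , ⋈ , β) , h)) u v → frac u ≼[ isStrict h ] frac v
    link-frac D ⋈ β (upper s) {k} {j} h∈ (sp , cmp) = subst (λ a → (ts k ↓ a) ≼[ s ] frac j)
      (sym (ordered eq {toℕ β} {j} {k} (Fin.toℕ<n β) cmp))
      (upper-bounded s (ts k) (ts j) (q j) (toℕ β) (spans⇒bounded D ⋈ β (upper s) {j} {k} h∈ (span⁻ (D , ⋈ , β) sp)))
    link-frac D ⋈ β (lower s) {j} {k} h∈ (sp , cmp) = subst (λ a → frac j ≼[ s ] (ts k ↓ a))
      (sym (ordered eq {toℕ β} {j} {k} (Fin.toℕ<n β) cmp))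
      (lower-bounded s (ts k) (ts j) (q j) (toℕ β) (spans⇒bounded D ⋈ β (lower s) {j} {k} h∈ (span⁻ (D , ⋈ , β) sp)))

    weak-frac : ∀ {u v} → Joins weak u v → frac u ≼ frac v
    weak-frac {u} {v} (inj₁ (s , cmp)) = subst (λ a → frac u ≼ (ts v ↓ a))
      (sym (trans (ordered eq {0} {u} {v} M≥1 cmp) (ℕ.+-identityʳ (q u))))
      (↓-mono (ts u) (ts v) (q u) (monotone u v (ℕ.<⇒≤ (step⇒< (next⁻ s)))))
    weak-frac {u} {v} (inj₂ p) =
      let ((D , ⋈ , β) , h) , p′ = ⨁⁻ 𝔾 halves-enum {f = λ (c , h) → whenᵖ (h ∈ᶜ c) (link (c , h))} p
          h∈ , p″ = whenᵖ⁻ 𝔾 {b = h ∈ʰ ⋈} {π = link ((D , ⋈ , β) , h)} p′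
      in ≼[]⇒≼ (isStrict h) (link-frac D ⋈ β h {u} {v} h∈ p″)

    strict-frac : ∀ {u v} → Joins strict u v → frac u ≺ frac v
    strict-frac {u} {v} p =
      let ((D , ⋈ , β) , h) , p′ = ⨁⁻ 𝔾 halves-enum {f = λ (c , h) → whenᵖ (h ∈ᶜ c) (whenᵖ (isStrict h) (link (c , h)))} p
          h∈ , p″ = whenᵖ⁻ 𝔾 {b = h ∈ʰ ⋈} {π = whenᵖ (isStrict h) (link ((D , ⋈ , β) , h))} p′
          st , p‴ = whenᵖ⁻ 𝔾 {b = isStrict h} {π = link ((D , ⋈ , β) , h)} p″
      in strictly (isStrict h) st (link-frac D ⋈ β h {u} {v} h∈ p‴)
      where
      strictly : ∀ s → T s → frac u ≼[ s ] frac v → frac u ≺ frac v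
      strictly true _ h = h

    weak✶-frac : ∀ {u v} → Joins (weak ✶) u v → frac u ≼ frac v
    weak✶-frac {u} ε = ≡⇒≼ {frac u} {frac u} (λ _ → refl)
    weak✶-frac {u} {v} (_◅_ {j = x} p ps) = ≼-trans {frac u} {frac x} {frac v} (weak-frac {u} {x} p) (weak✶-frac {x} {v} ps)

    -- Around such a cycle the fractional part of `i` would lie strictly below itself.
    acyclic : ∀ i → ¬ Joins (strict · weak ✶) i i
    acyclic i (x , p , ps) = ≺-irrefl {frac i} (≺-≼-trans {frac i} {frac x} {frac i} (strict-frac {i} {x} p) (weak✶-frac {x} {i} ps))

    all-good : ∀ i → ¬ i ⊩ bad
    all-good i (inj₁ p) = run-good i p
    all-good i (inj₂ (inj₁ p)) = let d , p′ = ⋁⁻ 𝔾 (enum-Fin #DS) {f = bad-matching} p in matching-good d i p′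
    all-good i (inj₂ (inj₂ (inj₁ p))) = value-good i p
    all-good i (inj₂ (inj₂ (inj₂ (inj₁ p)))) =
      let c , p′ = ⋁⁻ 𝔾 constraints-enum {f = bad-constraint} p in constraint-good c i p′
    all-good i (inj₂ (inj₂ (inj₂ (inj₂ p)))) = acyclic i p

    reading : Interpretation (restrict inj₁ (L.G sequence)) 𝔾 (λ p → has (inj₁ p))
    reading = record
      { to      = λ i → i
      ; from    = λ i → i
      ; to-from = λ _ → refl
      ; from-to = λ _ → refl
      ; edges   = λ _ _ _ → refl
      ; labels⁺ = λ i p → has⁺ i (inj₁ p)
      ; labels⁻ = λ i p → has⁻ i (inj₁ p)
      }

  models : ∀ Φ → ¬ (restrict inj₁ (L.G sequence) ⊨ Φ) → 𝔾 ⊨ matrix (encode Φ)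
  models Φ ¬Φ (inj₁ (i , p))      = all-good i p
  models Φ ¬Φ (inj₂ (inj₁ p))     = ¬Φ (Interpretation.sentenceFrom reading Φ p)
  models Φ ¬Φ (inj₂ (inj₂ empty)) = empty (Fin.fromℕ< nonempty , (refl , tt) , (refl , tt))

-- Transfer along isomorphisms, decidability of models, and the two directions

module _ {Γ : Set} {k : ℕ} {G H : Graph ⊥ Γ} (to : V G → V H) (from : V H → V G)
         (to-from : ∀ x → to (from x) ≡ x) (from-to : ∀ v → from (to v) ≡ v)
         (edges : ∀ u γ v → edge G u γ v ≡ edge H (to u) γ (to v))
         {λ₁ : V G → Fin k → Bool} {λ₂ : V H → Fin k → Bool} (agree : ∀ v x → λ₁ v x ≡ λ₂ (to v) x) where

  private
    isomorphism : Interpretation (expand G λ₁) (expand H λ₂) prop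
    isomorphism = record
      { to      = to
      ; from    = from
      ; to-from = to-from
      ; from-to = from-to
      ; edges   = edges
      ; labels⁺ = λ { v (inj₂ x) p → subst T (agree v x) p }
      ; labels⁻ = λ { v (inj₂ x) p → subst T (sym (agree v x)) p }
      }
    open Interpretation isomorphism using (sentenceTo; sentenceFrom)

  iso-to : ∀ Φ → expand G λ₁ ⊨ Φ → expand H λ₂ ⊨ Φ
  iso-to Φ p = subst (expand H λ₂ ⊨_) (substᶠ-prop Φ) (sentenceTo Φ p)

  iso-from : ∀ Φ → expand H λ₂ ⊨ Φ → expand G λ₁ ⊨ Φ
  iso-from Φ p = sentenceFrom Φ (subst (expand H λ₂ ⊨_) (sym (substᶠ-prop Φ)) p)

module _ {Γ : Set} (G : Graph ⊥ Γ) (Ψ : EQ-ICPDL ⊥ Γ) where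

  private
    k = #vars Ψ

    bit : Fin 2 → Bool
    bit zero    = false
    bit (suc _) = true

    unbit : Bool → Fin 2
    unbit b = if b then suc zero else zero

    bit-unbit : ∀ b → bit (unbit b) ≡ b
    bit-unbit false = refl
    bit-unbit true  = refl

    labelling : (Fin (order G * k) → Fin 2) → V G → Fin k → Bool
    labelling f v x = bit (f (Fin.combine v x))

    table : (V G → Fin k → Bool) → Fin (order G * k) → Fin 2
    table λ′ y = let v , x = Fin.remQuot {order G} k y in unbit (λ′ v x)

    labelling-table : ∀ λ′ v x → labelling (table λ′) v x ≡ λ′ v x
    labelling-table λ′ v x = trans (bit-unbit _) (cong (λ (v , x) → λ′ v x) (Fin.remQuot-combine v x))

    respects : ∀ {λ₁ λ₂ : V G → Fin k → Bool} → (∀ v x → λ₁ v x ≡ λ₂ v x) →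
               expand G λ₁ ⊨ matrix Ψ → expand G λ₂ ⊨ matrix Ψ
    respects agree = iso-to {G = G} {G} id id (λ _ → refl) (λ _ → refl) (λ _ _ _ → refl) agree (matrix Ψ)

  -- A labelling is coded as one table of bits indexed by pairs of a node and a proposition, which
  -- makes the search an instance of `anyFunction?`. Tables return labellings up to pointwise
  -- equality, and `respects` bridges this.
  model? : Dec (G ⊨∃ Ψ)
  model? = map′
    (λ (f , p) → labelling f , p)
    (λ (λ′ , p) → table λ′ , respects (λ v x → sym (labelling-table λ′ v x)) p)
    (anyFunction? (λ f≗g → respects (λ v x → cong bit (f≗g (Fin.combine v x)))) λ f → sentence? (expand G (labelling f)) (matrix Ψ))

T-≡ : ∀ {a b} → (T a → T b) → (T b → T a) → a ≡ b
T-≡ {false} {false} _ _ = refl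
T-≡ {false} {true}  _ g = ⊥-elim (g tt)
T-≡ {true}  {false} f _ = ⊥-elim (f tt)
T-≡ {true}  {true}  _ _ = refl

module _ (𝒯 : TimedSystem) (Φ : ICPDL (TimedSystem.AP 𝒯) (Γ^ (TimedSystem.DS 𝒯))) (G : Graph ⊥ (Γ^ (TimedSystem.DS 𝒯))) where
  open TimedSystem 𝒯
  open Encoding 𝒯 using (encode; #guessed)

  Realised : Set
  Realised = Σ[ τ ∈ L ] Feasible (L.validSeq τ) × (G ≅ restrict ⊥-elim (L.G τ)) × (¬ (restrict inj₁ (L.G τ) ⊨ Φ))

  -- The vertices of G may be numbered in any order. Renumbering them by `rank` gives a graph H
  -- whose successor edges follow the numbering, as positions in a word do.
  sound : Linear G → G ⊨∃ encode Φ → Realised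
  sound (_⊑_ , total-order , covers) (λ₁ , models) = sequence , feasible , iso , λ p →
    models′ (inj₂ (inj₁ (Interpretation.sentenceTo reading Φ p)))
    where
    to from : V G → V G
    to   = rank total-order
    from = unrank total-order

    H : Graph ⊥ (Γ^ DS)
    order H = order G
    edge H i succ j = does (toℕ j ℕ.≟ suc (toℕ i))
    edge H i (data-edge d) j = edge G (from i) (data-edge d) (from j)
    label H _ ()

    edges : ∀ u γ v → edge G u γ v ≡ edge H (to u) γ (to v)
    edges u succ v = T-≡
      (λ e → does⁺ (_ ℕ.≟ _) (covers⇒step total-order (Equivalence.to (covers u v) e)))
      (λ s → Equivalence.from (covers u v) (step⇒covers total-order (does⁻ (_ ℕ.≟ _) s)))
    edges u (data-edge d) v =
      sym (cong₂ (λ u v → edge G u (data-edge d) v) (unrank-rank total-order u) (unrank-rank total-order v))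

    models′ : expand H (λ₁ ∘ from) ⊨ matrix (encode Φ)
    models′ = iso-to {G = G} {H} to from (rank-unrank total-order) (unrank-rank total-order) edges
      (λ v x → cong (λ u → λ₁ u x) (sym (unrank-rank total-order v))) (matrix (encode Φ)) models

    inhabited : ∀ {n} → ¬ ¬ Fin n → 1 ≤ n
    inhabited {zero}  h = contradiction (λ ()) h
    inhabited {suc n} _ = s≤s z≤n

    -- The disjunct that excludes the empty graph yields only the double negation of a node;
    -- inspecting the number of nodes turns this into the bound.
    open Soundness 𝒯 H (λ _ _ → refl) (inhabited λ none → models′ (inj₂ (inj₂ λ (i , _) → none i)))
                   (λ₁ ∘ from) (λ i p → models′ (inj₁ (i , p)))

    iso : G ≅ restrict ⊥-elim (L.G sequence)
    iso = record
      { vertices = mk↔ₛ′ to from (rank-unrank total-order) (unrank-rank total-order)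
      ; edges    = λ { u succ v → edges u succ v ; u (data-edge d) v → edges u (data-edge d) v }
      ; labels   = λ _ ()
      }

  complete-encoding : Realised → G ⊨∃ encode Φ
  complete-encoding (τ , record { ts = ts ; nonNegative = ts≥0 ; monotone = mono ; constraints = sat ; diffs = sat-diffs } , iso , ¬Φ) =
    decidable-stable (model? G (encode Φ)) λ ¬model → floors-exist ts ts≥0 λ (q , floors) →
      let open Completeness 𝒯 τ ts mono sat sat-diffs q floors
      in ¬model (λ′ ∘ to , iso-from {G = G} {H} to from (λ _ → strictlyInverseˡ _) (λ _ → strictlyInverseʳ _) (_≅_.edges iso)
                             (λ _ _ → refl) (matrix (encode Φ)) (models Φ ¬Φ))
    where open Inverse (_≅_.vertices iso)

corollary26 : Σ[ P ∈ Polynomial ]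
    ((𝒯 : TimedSystem) (Φ : LCPDL (TimedSystem.AP 𝒯) (Γ^ (TimedSystem.DS 𝒯))) →
    Σ[ Ψ ∈ EQ-ICPDL ⊥ (Γ^ (TimedSystem.DS 𝒯)) ]
    (size∃ Ψ ≤ eval P (TimedSystem.size-𝒯 𝒯 + size (proj₁ Φ))) ×
    (width∃ Ψ ≡ 2) ×
    ((G : Graph ⊥ (Γ^ (TimedSystem.DS 𝒯))) → Linear G →
    (G ⊨∃ Ψ) ⇔
    (Σ[ τ ∈ TimedSystem.L 𝒯 ]
    TimedSystem.Feasible 𝒯 (TimedSystem.L.validSeq τ) ×
    (G ≅ restrict ⊥-elim (TimedSystem.L.G τ)) ×
    (¬ (restrict inj₁ (TimedSystem.L.G τ) ⊨ proj₁ Φ)))))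
corollary26 = polynomial (proj₁ encode-small) , λ 𝒯 (Φ , free) →
  let small = proj₂ encode-small 𝒯 Φ free
  in Encoding.encode 𝒯 Φ ,
     ℕ.≤-trans (Small∃.size≤ small) (ℕ.≤-reflexive (sym (eval-polynomial (proj₁ encode-small) (TimedSystem.size-𝒯 𝒯 + size Φ)))) ,
     Small∃.width≡ small ,
     λ G linear → mk⇔ (sound 𝒯 Φ G linear) (complete-encoding 𝒯 Φ G)
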